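{- Let $\delta \geq 2$ and $n$ be integers. Let $r(n,\delta,4)$ denote the maximum radius of a connected triangle-free graph on $n$ vertices with minimum degree $\delta$ (defined whenever such a graph exists). Then: (i) if $n<2\delta$, there exists no connected triangle-free graph on $n$ vertices with minimum degree $\delta$; (ii) if $n \in \{2\delta, 2\delta+1\}$, then $r(n,\delta,4)=2$; (iii) if $2\delta+2 \leq n < 4\delta$, then $r(n,\delta,4)=3$; (iv) if $n \geq 4\delta$, then $$r(n,\delta,4)=\begin{cases}\frac{n}{\delta}-1 & \text{if $\delta$ is odd and $n=k\delta$ for some odd integer $k$},\\ \left\lfloor \frac{n}{\delta}\right\rfloor & \text{otherwise.}\end{cases}$$
   Context: All graphs are finite and simple. The radius of a connected graph $G$ is $\min_{v} \max_{w} d(v,w)$, where $d$ is the graph distance. A graph is triangle-free if it contains no cycle of length 3. -}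

module Defs where

open import Data.Nat using (ℕ; zero; suc; _+_; _*_; _∸_; _≤_; _<_)
open import Data.Fin using (Fin)
open import Data.Bool using (Bool; true; false; T)
open import Data.List using (length; filterᵇ; allFin)
open import Data.Product using (Σ; ∃; ∃-syntax; _×_)
open import Relation.Nullary using (¬_)
open import Relation.Binary.PropositionalEquality using (_≡_)

record Graph (n : ℕ) : Set where
  field
    adj     : Fin n → Fin n → Bool
    symm    : ∀ u v → adj u v ≡ adj v u
    irrefl  : ∀ v → adj v v ≡ false
open Graph public

Adj : ∀ {n} → Graph n → Fin n → Fin n → Set
Adj G u v = T (adj G u v)

deg : ∀ {n} → Graph n → Fin n → ℕ
deg {n} G v = length (filterᵇ (adj G v) (allFin n))

MinDegree : ∀ {n} → Graph n → ℕ → Set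
MinDegree G δ = (∀ v → δ ≤ deg G v) × (∃[ v ] deg G v ≡ δ)

TriangleFree : ∀ {n} → Graph n → Set
TriangleFree G = ∀ u v w → ¬ (Adj G u v × Adj G v w × Adj G u w)

data Walk {n} (G : Graph n) : Fin n → Fin n → ℕ → Set where
  here : ∀ {v} → Walk G v v 0
  step : ∀ {u v w k} → Adj G u v → Walk G v w k → Walk G u w (suc k)

DistLe : ∀ {n} → Graph n → Fin n → Fin n → ℕ → Set
DistLe G u w k = ∃[ j ] (j ≤ k × Walk G u w j)

Connected : ∀ {n} → Graph n → Set
Connected G = ∀ u w → ∃[ k ] Walk G u w k

EccLe : ∀ {n} → Graph n → Fin n → ℕ → Set
EccLe G v r = ∀ w → DistLe G v w r

HasRadius : ∀ {n} → Graph n → ℕ → Set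
HasRadius G r = (∃[ v ] EccLe G v r) × (∀ r' → ∃[ v ] EccLe G v r' → r ≤ r')

Admissible : ∀ {n} → Graph n → ℕ → Set
Admissible G δ = Connected G × TriangleFree G × MinDegree G δ

MaxRadius : ℕ → ℕ → ℕ → Set
MaxRadius n δ R =
  (∃[ G ] (Admissible {n} G δ × HasRadius G R)) ×
  (∀ (G : Graph n) r → Admissible G δ → HasRadius G r → r ≤ R)

Odd : ℕ → Set
Odd k = ∃[ m ] k ≡ suc (2 * m)

{-# OPTIONS --safe #-}
module Submission where

-- Upper bound.  Let every vertex have eccentricity at least r ≥ 4, and let v₀ be a vertex with the
-- fewest vertices at distance ≥ r.  Follow a geodesic P from v₀ to P_r.  Vertices of P are closer to
-- P_r than r, so by the choice of v₀ each of them is at distance ≥ r from some vertex that is at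
-- distance < r from v₀.  Apply this to P_3, getting w and a geodesic Q from v₀ to w of length r − t
-- with t ∈ {1, 2, 3}, and to P_1, getting y.  The triangle inequality then severely limits which
-- vertices of P, Q and y have common neighbours.  In each case this produces either 2r vertices such
-- that nobody is adjacent to more than two of them, or r vertices such that nobody is adjacent to
-- more than one; counting edges gives rδ ≤ n.  The count is strict because some vertex is adjacent
-- to fewer, unless the 2r vertices form a cycle; then the two parity classes of the cycle have
-- disjoint neighbourhoods of size at least ⌈rδ/2⌉, so the count is strict when r and δ are odd.
--
-- Lower bound.  Complete bipartite graphs, blow-ups of K_{δ+1,δ+1} minus a perfect matching, and
-- blow-ups of the cycle of length 2r with weights alternating between ⌈δ/2⌉ and ⌊δ/2⌋ in pairs.

-- The extremal graphs dictate the target: a blown-up cycle of length 2r, in which every vertex sees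
-- two classes. Within one geodesic this is automatic, because triangle-freeness and distance allow
-- a common neighbour of distinct P_i and P_j only when the indices differ by 2. The difficulty lies
-- between the two paths, where t measures a trade-off. P has r + 1 vertices and Q adds r - t, so t
-- - 1 are missing from 2r; but a common neighbour of P_i and Q_j with i ≤ 3 forces i + j + t ≤ 5,
-- so a larger t separates the paths better. For t = 2 the missing vertex is y; for t = 3 the
-- missing ones are y and, if it exists, a common neighbour z of y and w. For t = 1 none is missing,
-- but the paths may run so close that some vertex is adjacent to three of theirs. This forces a
-- common first step u towards P_4 and Q_3, and the full paths are replaced by two consecutive
-- levels out of every four. When r is 3 modulo 4 that selection is one short; applying the choice
-- of v₀ to u supplies the last vertex.

open import Defs
open import Data.Bool using (Bool; true; false; T; not; _∧_; _∨_; _xor_; if_then_else_)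
open import Data.Bool.Properties using (T?; not-involutive; not-¬; ∨-comm; xor-comm)
open import Data.Empty using (⊥; ⊥-elim)
open import Data.Fin using (Fin)
open import Data.Fin.Properties using (any?; _≟_)
open import Data.Integer as ℤ using (ℤ; -[1+_]) renaming (+_ to pos)
open import Data.List using (List; []; _∷_; _∷ʳ_; _++_; map; concatMap; length; replicate; zipWith; filterᵇ; allFin; applyUpTo; downFrom; lookup)
open import Data.List.Membership.Propositional using (_∈_)
open import Data.List.Membership.Propositional.Properties using (∈-allFin; ∈-lookup; ∈-++⁺ˡ; ∈-++⁺ʳ; ∈-++⁻; ∈-map⁺; ∈-map⁻; ∈-downFrom⁺; ∈-downFrom⁻)
open import Data.List.Properties using (length-++; length-map; length-replicate; length-tabulate; length-applyUpTo; length-downFrom; map-tabulate; tabulate-lookup)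
open import Data.List.Relation.Unary.All as All using (All; []; _∷_)
import Data.List.Relation.Unary.All.Properties as All
open import Data.List.Relation.Unary.AllPairs using (AllPairs; []; _∷_)
import Data.List.Relation.Unary.AllPairs.Properties as AllPairs
open import Data.List.Relation.Unary.Any using (here; there; index)
open import Data.List.Relation.Unary.Any.Properties using (lookup-index)
open import Data.Nat using (ℕ; zero; suc; _+_; _*_; _∸_; _≤_; _<_; _≤ᵇ_; _<ᵇ_; _≡ᵇ_; _≤?_; _<?_; NonZero; z≤n; s≤s; s≤s⁻¹)
open import Data.Nat.DivMod using (_/_; m*n/n≡m; m/n*n≤m; /-monoˡ-≤)
open import Data.Nat.Induction using (<-wellFounded)
open import Data.Nat.ListAction using (sum)
open import Data.Nat.Properties hiding (_≟_)
open import Data.Nat.Tactic.RingSolver using (solve-∀)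
open import Data.Product using (_×_; _,_; proj₁; proj₂; ∃-syntax)
open import Data.Sum using (_⊎_; inj₁; inj₂)
open import Data.Unit using (⊤; tt)
open import Function using (id)
open import Induction.WellFounded using (Acc; acc)
open import Relation.Binary.Definitions using (tri<; tri≈; tri>)
open import Relation.Binary.PropositionalEquality
open import Relation.Nullary using (¬_; Dec; yes; no)
open import Relation.Nullary.Decidable using (⌊_⌋; _×-dec_; map′; toWitness; fromWitness)

-- Linear arithmetic over ℕ

infix 8 #_
infixl 6 _⊕_
infixl 7 _⊛_
infix 4 _≼_ _≋_ ⊢_≼_ ⊢_≋_
infixr 3 _⇒_

data Expr : Set where
  var : ℕ → Expr
  #_  : ℕ → Expr
  _⊕_ : Expr → Expr → Expr
  _⊛_ : ℕ → Expr → Expr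

data Atom : Set where
  _≼_ _≋_ : Expr → Expr → Atom

data Sequent : Set where
  absurd : Sequent
  ⊢_≼_ ⊢_≋_ : Expr → Expr → Sequent
  _⇒_    : Atom → Sequent → Sequent

entry : List ℕ → ℕ → ℕ
entry []      _       = 0
entry (x ∷ _) zero    = x
entry (_ ∷ ρ) (suc i) = entry ρ i

eval : Expr → List ℕ → ℕ
eval (var i) ρ = entry ρ i
eval (# c)   ρ = c
eval (a ⊕ b) ρ = eval a ρ + eval b ρ
eval (m ⊛ a) ρ = m * eval a ρ

⟦_⟧ : Sequent → List ℕ → Set
⟦ absurd ⟧      ρ = ⊥
⟦ ⊢ a ≼ b ⟧     ρ = eval a ρ ≤ eval b ρ
⟦ ⊢ a ≋ b ⟧     ρ = eval a ρ ≡ eval b ρ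
⟦ (a ≼ b) ⇒ s ⟧ ρ = eval a ρ ≤ eval b ρ → ⟦ s ⟧ ρ
⟦ (a ≋ b) ⇒ s ⟧ ρ = eval a ρ ≡ eval b ρ → ⟦ s ⟧ ρ

SequentIn : ℕ → Set
SequentIn zero    = Sequent
SequentIn (suc n) = Expr → SequentIn n

instantiate : ∀ n → ℕ → SequentIn n → Sequent
instantiate zero    i s = s
instantiate (suc n) i s = instantiate n (suc i) (s (var i))

Universal : ℕ → Sequent → List ℕ → Set
Universal zero    s ρ = ⟦ s ⟧ ρ
Universal (suc n) s ρ = (x : ℕ) → Universal n s (ρ ∷ʳ x)

LinForm : Set
LinForm = ℕ × List ℕ

dot : List ℕ → List ℕ → ℕ
dot []       _       = 0
dot (_ ∷ _)  []      = 0
dot (a ∷ as) (x ∷ ρ) = a * x + dot as ρ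

value : LinForm → List ℕ → ℕ
value (c , as) ρ = c + dot as ρ

unit : ℕ → List ℕ
unit zero    = 1 ∷ []
unit (suc i) = 0 ∷ unit i

addᶜ : List ℕ → List ℕ → List ℕ
addᶜ []       bs       = bs
addᶜ (a ∷ as) []       = a ∷ as
addᶜ (a ∷ as) (b ∷ bs) = a + b ∷ addᶜ as bs

addᶠ : LinForm → LinForm → LinForm
addᶠ (c , as) (d , bs) = c + d , addᶜ as bs

scaleᶠ : ℕ → LinForm → LinForm
scaleᶠ m (c , as) = m * c , map (m *_) as

normalise : Expr → LinForm
normalise (var i) = 0 , unit i
normalise (# c)   = c , []
normalise (a ⊕ b) = addᶠ (normalise a) (normalise b)
normalise (m ⊛ a) = scaleᶠ m (normalise a)

dot-unit : ∀ i ρ → dot (unit i) ρ ≡ entry ρ i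
dot-unit zero    []      = refl
dot-unit zero    (x ∷ ρ) = trans (+-identityʳ _) (+-identityʳ _)
dot-unit (suc i) []      = refl
dot-unit (suc i) (x ∷ ρ) = dot-unit i ρ

dot-add : ∀ as bs ρ → dot (addᶜ as bs) ρ ≡ dot as ρ + dot bs ρ
dot-add []       bs       ρ       = refl
dot-add (a ∷ as) []       ρ       = sym (+-identityʳ _)
dot-add (a ∷ as) (b ∷ bs) []      = refl
dot-add (a ∷ as) (b ∷ bs) (x ∷ ρ) rewrite dot-add as bs ρ = lemma a b x (dot as ρ) (dot bs ρ)
  where
  lemma : ∀ a b x u v → (a + b) * x + (u + v) ≡ a * x + u + (b * x + v)
  lemma = solve-∀

dot-scale : ∀ m as ρ → dot (map (m *_) as) ρ ≡ m * dot as ρ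
dot-scale m []       ρ       = sym (*-zeroʳ m)
dot-scale m (a ∷ as) []      = sym (*-zeroʳ m)
dot-scale m (a ∷ as) (x ∷ ρ) rewrite dot-scale m as ρ = lemma m a x (dot as ρ)
  where
  lemma : ∀ m a x u → m * a * x + m * u ≡ m * (a * x + u)
  lemma = solve-∀

value-add : ∀ f g ρ → value (addᶠ f g) ρ ≡ value f ρ + value g ρ
value-add (c , as) (d , bs) ρ rewrite dot-add as bs ρ = lemma c d (dot as ρ) (dot bs ρ)
  where
  lemma : ∀ c d u v → c + d + (u + v) ≡ c + u + (d + v)
  lemma = solve-∀

value-scale : ∀ m f ρ → value (scaleᶠ m f) ρ ≡ m * value f ρ
value-scale m (c , as) ρ rewrite dot-scale m as ρ = sym (*-distribˡ-+ m c (dot as ρ))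

value-normalise : ∀ e ρ → value (normalise e) ρ ≡ eval e ρ
value-normalise (var i) ρ = dot-unit i ρ
value-normalise (# c)   ρ = +-identityʳ c
value-normalise (a ⊕ b) ρ rewrite value-add (normalise a) (normalise b) ρ | value-normalise a ρ | value-normalise b ρ = refl
value-normalise (m ⊛ a) ρ rewrite value-scale m (normalise a) ρ | value-normalise a ρ = refl

Inequality : Set
Inequality = Expr × Expr

Holds : List ℕ → List Inequality → Set
Holds ρ []             = ⊤
Holds ρ ((a , b) ∷ is) = (eval a ρ ≤ eval b ρ) × Holds ρ is

combine : List ℕ → List Inequality → LinForm × LinForm
combine (m ∷ ms) ((a , b) ∷ is) =
  addᶠ (scaleᶠ m (normalise a)) (proj₁ (combine ms is)) , addᶠ (scaleᶠ m (normalise b)) (proj₂ (combine ms is))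
combine _        _              = (0 , []) , (0 , [])

combine-sound : ∀ ρ ms is → Holds ρ is → value (proj₁ (combine ms is)) ρ ≤ value (proj₂ (combine ms is)) ρ
combine-sound ρ []       is             hs = z≤n
combine-sound ρ (m ∷ ms) []             hs = z≤n
combine-sound ρ (m ∷ ms) ((a , b) ∷ is) (h , hs)
  rewrite value-add (scaleᶠ m (normalise a)) (proj₁ (combine ms is)) ρ
        | value-add (scaleᶠ m (normalise b)) (proj₂ (combine ms is)) ρ
        | value-scale m (normalise a) ρ | value-scale m (normalise b) ρ
        | value-normalise a ρ | value-normalise b ρ
  = +-mono-≤ (*-monoʳ-≤ m h) (combine-sound ρ ms is hs)

-- Coefficients need only be comparable, not equal: variables range over ℕ, so a surplus on the
-- larger side does no harm.
dominatedᶜ : List ℕ → List ℕ → Bool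
dominatedᶜ []       _        = true
dominatedᶜ (b ∷ bs) []       = (b ≤ᵇ 0) ∧ dominatedᶜ bs []
dominatedᶜ (b ∷ bs) (a ∷ as) = (b ≤ᵇ a) ∧ dominatedᶜ bs as

T-∧ : ∀ a {b} → T (a ∧ b) → T a × T b
T-∧ true t = _ , t

dominatedᶜ-sound : ∀ bs as ρ → T (dominatedᶜ bs as) → dot bs ρ ≤ dot as ρ
dominatedᶜ-sound []       as       ρ       t = z≤n
dominatedᶜ-sound (b ∷ bs) as       []      t = z≤n
dominatedᶜ-sound (b ∷ bs) []       (x ∷ ρ) t with T-∧ (b ≤ᵇ 0) t
... | p , q = +-mono-≤ (*-monoˡ-≤ x (≤ᵇ⇒≤ b 0 p)) (dominatedᶜ-sound bs [] ρ q)
dominatedᶜ-sound (b ∷ bs) (a ∷ as) (x ∷ ρ) t with T-∧ (b ≤ᵇ a) t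
... | p , q = +-mono-≤ (*-monoˡ-≤ x (≤ᵇ⇒≤ b a p)) (dominatedᶜ-sound bs as ρ q)

contradictory : LinForm × LinForm → Bool
contradictory ((c , as) , (d , bs)) = (d <ᵇ c) ∧ dominatedᶜ bs as

-- Fourier–Motzkin elimination.  A row carries the multipliers it was built with; nothing
-- about the search needs to be proved, since its answer is checked by `contradictory`.
Row : Set
Row = List ℕ × ℤ × List ℤ

difference : ℕ → ℕ → List ℕ → List ℕ → List ℤ
difference zero    i as bs = []
difference (suc n) i as bs = (pos (entry bs i) ℤ.- pos (entry as i)) ∷ difference n (suc i) as bs

rows : ℕ → ℕ → ℕ → List Inequality → List Row
rows n i l []             = []
rows n i l ((a , b) ∷ is) with normalise a | normalise b
... | c , as | d , bs = (replicate i 0 ++ 1 ∷ replicate (l ∸ suc i) 0 , pos d ℤ.- pos c , difference n 0 as bs) ∷ rows n (suc i) l is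

sumRow : ℕ → Row → ℕ → Row → Row
sumRow p (ms , c , as) q (ms′ , d , bs) =
  zipWith (λ m m′ → p * m + q * m′) ms ms′ , (pos p ℤ.* c) ℤ.+ (pos q ℤ.* d) , zipWith (λ a b → (pos p ℤ.* a) ℤ.+ (pos q ℤ.* b)) as bs

Split : Set
Split = List Row × List (ℕ × Row) × List (ℕ × Row)

split : List Row → Split
split [] = [] , [] , []
split ((ms , c , []) ∷ rs) = split rs
split ((ms , c , pos zero ∷ as) ∷ rs) with split rs
... | z , p , q = (ms , c , as) ∷ z , p , q
split ((ms , c , pos (suc a) ∷ as) ∷ rs) with split rs
... | z , p , q = z , (suc a , ms , c , as) ∷ p , q
split ((ms , c , -[1+ a ] ∷ as) ∷ rs) with split rs
... | z , p , q = z , p , (suc a , ms , c , as) ∷ q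

eliminate : ℕ → ℕ → List Row → List Row
eliminate zero    l rs = rs
eliminate (suc n) l rs with split rs
-- The row added to `p` says that the eliminated variable is nonnegative. It uses no hypothesis,
-- hence its zero multipliers; `dominatedᶜ` later tolerates the term that it cancels here.
... | z , p , q = eliminate n l
  (z ++ concatMap (λ (a , r) → map (λ (b , r′) → sumRow b r a r′) q) ((1 , replicate l 0 , pos 0 , replicate n (pos 0)) ∷ p))

firstNegative : List Row → List ℕ
firstNegative []                      = []
firstNegative ((ms , -[1+ _ ] , _) ∷ _) = ms
firstNegative ((ms , pos _ , _) ∷ rs)   = firstNegative rs

multipliers : ℕ → List Inequality → List ℕ
multipliers n is = firstNegative (eliminate n (length is) (rows n 0 (length is) is))

refutable : ℕ → List Inequality → Bool
refutable n is = contradictory (combine (multipliers n is) is)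

contradictory-sound : ∀ ρ fg → T (contradictory fg) → value (proj₁ fg) ρ ≤ value (proj₂ fg) ρ → ⊥
contradictory-sound ρ ((c , as) , (d , bs)) t h with T-∧ (d <ᵇ c) t
... | p , q = <-irrefl refl (<-≤-trans (+-mono-<-≤ (<ᵇ⇒< d c p) (dominatedᶜ-sound bs as ρ q)) h)

refutable-sound : ∀ n ρ is → T (refutable n is) → Holds ρ is → ⊥
refutable-sound n ρ is t hs = contradictory-sound ρ (combine (multipliers n is) is) t (combine-sound ρ (multipliers n is) is hs)

-- Goals are proved by refuting their negation, which over ℕ is again linear: a ≤ b fails exactly
-- when 1 + b ≤ a. An equation costs two refutations.
valid : ℕ → List Inequality → Sequent → Bool
valid n is absurd          = refutable n is
valid n is (⊢ a ≼ b)       = refutable n ((# 1 ⊕ b , a) ∷ is)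
valid n is (⊢ a ≋ b)       = refutable n ((# 1 ⊕ b , a) ∷ is) ∧ refutable n ((# 1 ⊕ a , b) ∷ is)
valid n is ((a ≼ b) ⇒ s)   = valid n ((a , b) ∷ is) s
valid n is ((a ≋ b) ⇒ s)   = valid n ((a , b) ∷ (b , a) ∷ is) s

valid-sound : ∀ n ρ is s → T (valid n is s) → Holds ρ is → ⟦ s ⟧ ρ
valid-sound n ρ is absurd        t hs   = refutable-sound n ρ is t hs
valid-sound n ρ is (⊢ a ≼ b)     t hs   = ≮⇒≥ λ h → refutable-sound n ρ ((# 1 ⊕ b , a) ∷ is) t (h , hs)
valid-sound n ρ is (⊢ a ≋ b)     t hs   with T-∧ (refutable n ((# 1 ⊕ b , a) ∷ is)) t
... | t₁ , t₂ = ≤-antisym (≮⇒≥ λ h → refutable-sound n ρ ((# 1 ⊕ b , a) ∷ is) t₁ (h , hs))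
                          (≮⇒≥ λ h → refutable-sound n ρ ((# 1 ⊕ a , b) ∷ is) t₂ (h , hs))
valid-sound n ρ is ((a ≼ b) ⇒ s) t hs h = valid-sound n ρ _ s t (h , hs)
valid-sound n ρ is ((a ≋ b) ⇒ s) t hs h = valid-sound n ρ _ s t (≤-reflexive h , ≤-reflexive (sym h) , hs)

universally : ∀ n s ρ → (∀ ρ′ → ⟦ s ⟧ ρ′) → Universal n s ρ
universally zero    s ρ h   = h ρ
universally (suc n) s ρ h x = universally n s (ρ ∷ʳ x) h

-- The hidden argument is `T` of a closed Boolean, so evaluating the search fills it in.
linear : ∀ n (s : SequentIn n) {_ : T (valid n [] (instantiate n 0 s))} → Universal n (instantiate n 0 s) []
linear n s {t} = universally n _ [] λ ρ → valid-sound n ρ [] (instantiate n 0 s) t tt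

-- Double counting

count : ∀ {A : Set} → (A → Bool) → List A → ℕ
count p xs = length (filterᵇ p xs)

indicator : Bool → ℕ
indicator true  = 1
indicator false = 0

count-∷ : ∀ {A : Set} (p : A → Bool) x xs → count p (x ∷ xs) ≡ indicator (p x) + count p xs
count-∷ p x xs with p x
... | true  = refl
... | false = refl

sum-map-+ : ∀ {A : Set} (f g : A → ℕ) xs → sum (map (λ x → f x + g x) xs) ≡ sum (map f xs) + sum (map g xs)
sum-map-+ f g []       = refl
sum-map-+ f g (x ∷ xs) rewrite sum-map-+ f g xs = lemma (f x) (g x) (sum (map f xs)) (sum (map g xs))
  where
  lemma : ∀ a b c d → a + b + (c + d) ≡ a + c + (b + d)
  lemma = solve-∀

sum-map-mono : ∀ {A : Set} (f g : A → ℕ) {xs} → All (λ x → f x ≤ g x) xs → sum (map f xs) ≤ sum (map g xs)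
sum-map-mono f g []       = z≤n
sum-map-mono f g (h ∷ hs) = +-mono-≤ h (sum-map-mono f g hs)

sum-map-bounded : ∀ {A : Set} (f : A → ℕ) c → (∀ x → f x ≤ c) → ∀ xs → sum (map f xs) ≤ c * length xs
sum-map-bounded f c h []       = z≤n
sum-map-bounded f c h (x ∷ xs) = ≤-trans (+-mono-≤ (h x) (sum-map-bounded f c h xs)) (≤-reflexive (sym (*-suc c (length xs))))

sum-map-bounded-< : ∀ {A : Set} (f : A → ℕ) c → (∀ x → f x ≤ c) → ∀ {e xs} → e ∈ xs → f e < c → sum (map f xs) < c * length xs
sum-map-bounded-< f c h {e} (here {x} {xs} refl) fe<c =
  ≤-trans (+-mono-<-≤ fe<c (sum-map-bounded f c h xs)) (≤-reflexive (sym (*-suc c (length xs))))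
sum-map-bounded-< f c h (there {x} {xs} e∈xs) fe<c =
  ≤-trans (+-mono-≤-< (h x) (sum-map-bounded-< f c h e∈xs fe<c)) (≤-reflexive (sym (*-suc c (length xs))))

count-as-sum : ∀ {A : Set} (p : A → Bool) xs → count p xs ≡ sum (map (λ x → indicator (p x)) xs)
count-as-sum p []       = refl
count-as-sum p (x ∷ xs) = trans (count-∷ p x xs) (cong (indicator (p x) +_) (count-as-sum p xs))

sum-count-swap : ∀ {A B : Set} (R : A → B → Bool) as bs →
  sum (map (λ a → count (R a) bs) as) ≡ sum (map (λ b → count (λ a → R a b) as) bs)
sum-count-swap R []       []       = refl
sum-count-swap R []       (b ∷ bs) = sum-count-swap R [] bs
sum-count-swap R (a ∷ as) bs       = begin
  count (R a) bs + sum (map (λ a → count (R a) bs) as)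
    ≡⟨ cong₂ _+_ (count-as-sum (R a) bs) (sum-count-swap R as bs) ⟩
  sum (map (λ b → indicator (R a b)) bs) + sum (map (λ b → count (λ a → R a b) as) bs)
    ≡⟨ sym (sum-map-+ _ _ bs) ⟩
  sum (map (λ b → indicator (R a b) + count (λ a → R a b) as) bs)
    ≡⟨ cong sum (map-cong′ bs) ⟩
  sum (map (λ b → count (λ a → R a b) (a ∷ as)) bs) ∎
  where
  open ≡-Reasoning
  map-cong′ : ∀ bs → map (λ b → indicator (R a b) + count (λ a → R a b) as) bs ≡ map (λ b → count (λ a → R a b) (a ∷ as)) bs
  map-cong′ []       = refl
  map-cong′ (b ∷ bs) = cong₂ _∷_ (sym (count-∷ (λ a → R a b) a as)) (map-cong′ bs)

double-count : ∀ {A B : Set} (R : A → B → Bool) (size : A → ℕ) as bs c →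
  All (λ a → size a ≤ count (R a) bs) as → (∀ b → count (λ a → R a b) as ≤ c) → sum (map size as) ≤ c * length bs
double-count R size as bs c sizes atMost = ≤-trans (sum-map-mono _ _ sizes)
  (≤-trans (≤-reflexive (sum-count-swap R as bs)) (sum-map-bounded _ c atMost bs))

double-count-< : ∀ {A B : Set} (R : A → B → Bool) (size : A → ℕ) as bs c →
  All (λ a → size a ≤ count (R a) bs) as → (∀ b → count (λ a → R a b) as ≤ c) →
  ∀ {e} → e ∈ bs → count (λ a → R a e) as < c → sum (map size as) < c * length bs
double-count-< R size as bs c sizes atMost e∈bs fewer = ≤-<-trans (sum-map-mono _ _ sizes)
  (≤-<-trans (≤-reflexive (sum-count-swap R as bs)) (sum-map-bounded-< _ c atMost e∈bs fewer))

count≡0 : ∀ {A : Set} (p : A → Bool) {xs} → All (λ x → ¬ T (p x)) xs → count p xs ≡ 0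
count≡0 p []                 = refl
count≡0 p (_∷_ {x} ¬px ¬pxs) with p x
... | true  = ⊥-elim (¬px tt)
... | false = count≡0 p ¬pxs

module _ {A : Set} {Ok : A → Set} {_⊏_ : A → A → Set} (p : A → Bool) where

  private
    no-hits : ∀ {x xs} → All Ok xs → All (x ⊏_) xs → (∀ {b} → Ok b → x ⊏ b → T (p b) → ⊥) → All (λ b → ¬ T (p b)) xs
    no-hits []       []       h = []
    no-hits (o ∷ os) (r ∷ rs) h = h o r ∷ no-hits os rs h

  -- Two hits occur in list order, so only pairs with a ⊏ b have to be excluded; `Ok` transports
  -- what is known about every entry, such as its index range.
  count≤1 : ∀ {xs} → All Ok xs → AllPairs _⊏_ xs →
    (∀ {a b} → Ok a → Ok b → a ⊏ b → T (p a) → T (p b) → ⊥) → count p xs ≤ 1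
  count≤1 []               []       h = z≤n
  count≤1 (_∷_ {a} o os) (r ∷ rs) h with p a in eq
  ... | true  rewrite count≡0 p (no-hits os r (λ o′ a⊏b → h o o′ a⊏b (subst T (sym eq) tt))) = ≤-refl
  ... | false = count≤1 os rs h

module _ {A : Set} {Ok : A → Set} {_⊏_ : A → A → Set} (p : A → Bool) where

  private
    attach : ∀ {R S : A → Set} {xs} → All R xs → All S xs → All (λ b → R b × S b) xs
    attach []       []       = []
    attach (r ∷ rs) (s ∷ ss) = (r , s) ∷ attach rs ss

  -- After a first hit a, the tail falls under `count≤1`, with the relation to a recorded in the
  -- predicate of its entries.
  count≤2 : ∀ {xs} → All Ok xs → AllPairs _⊏_ xs →
    (∀ {a b c} → Ok a → Ok b → Ok c → a ⊏ b → a ⊏ c → b ⊏ c → T (p a) → T (p b) → T (p c) → ⊥) → count p xs ≤ 2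
  count≤2 []               []       h = z≤n
  count≤2 (_∷_ {a} o os) (r ∷ rs) h with p a in eq
  ... | true  = s≤s (count≤1 p (attach os r) rs
                  (λ (ob , a⊏b) (oc , a⊏c) b⊏c → h o ob oc a⊏b a⊏c b⊏c (subst T (sym eq) tt)))
  ... | false = count≤2 os rs h

count-mono : ∀ {A : Set} (p q : A → Bool) → (∀ x → T (p x) → T (q x)) → ∀ xs → count p xs ≤ count q xs
count-mono p q h []       = z≤n
count-mono p q h (x ∷ xs) with p x | q x | h x
... | true  | true  | _  = s≤s (count-mono p q h xs)
... | true  | false | h′ = ⊥-elim (h′ tt)
... | false | true  | _  = ≤-trans (count-mono p q h xs) (n≤1+n _)
... | false | false | _  = count-mono p q h xs

count-mono-< : ∀ {A : Set} (p q : A → Bool) → (∀ x → T (p x) → T (q x)) →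
  ∀ {z xs} → z ∈ xs → ¬ T (p z) → T (q z) → count p xs < count q xs
count-mono-< p q h {z} (here {x} {xs} refl) ¬pz qz with p z | q z
... | true  | _     = ⊥-elim (¬pz tt)
... | false | true  = s≤s (count-mono p q h xs)
count-mono-< p q h (there {x} {xs} z∈xs) ¬pz qz with p x | q x | h x
... | true  | true  | _  = s≤s (count-mono-< p q h z∈xs ¬pz qz)
... | true  | false | h′ = ⊥-elim (h′ tt)
... | false | true  | _  = <-trans (count-mono-< p q h z∈xs ¬pz qz) (n<1+n _)
... | false | false | _  = count-mono-< p q h z∈xs ¬pz qz

1≤count : ∀ {A : Set} (p : A → Bool) {z xs} → z ∈ xs → T (p z) → 1 ≤ count p xs
1≤count p z∈xs pz = ≤-trans (s≤s z≤n) (count-mono-< (λ _ → false) p (λ _ ()) z∈xs (λ ()) pz)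

count-witness : ∀ {A : Set} (p : A → Bool) xs → 1 ≤ count p xs → ∃[ x ] T (p x)
count-witness p (x ∷ xs) h with p x in eq
... | true  = x , subst T (sym eq) tt
... | false = count-witness p xs h

count-witness-all : ∀ {A : Set} {Ok : A → Set} (p : A → Bool) {xs} → All Ok xs → 1 ≤ count p xs → ∃[ x ] (Ok x × T (p x))
count-witness-all p (_∷_ {x} o os) h with p x in eq
... | true  = x , o , subst T (sym eq) tt
... | false = count-witness-all p os h

sum-map-*2 : ∀ {A : Set} (f : A → ℕ) xs → sum (map (λ x → 2 * f x) xs) ≡ 2 * sum (map f xs)
sum-map-*2 f []       = refl
sum-map-*2 f (x ∷ xs) = trans (cong (2 * f x +_) (sum-map-*2 f xs)) (sym (*-distribˡ-+ 2 (f x) (sum (map f xs))))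

-- Only those b that are hit at all are charged, twice each. This bounds the union of the
-- neighbourhoods from below, as the two parity classes of a closed cycle require.
double-count-covered : ∀ {A B : Set} (R : A → B → Bool) (size : A → ℕ) as bs →
  All (λ a → size a ≤ count (R a) bs) as → (∀ b → count (λ a → R a b) as ≤ 2) →
  sum (map size as) ≤ 2 * count (λ b → 1 ≤ᵇ count (λ a → R a b) as) bs
double-count-covered R size as bs sizes atMost = begin
  sum (map size as)                                    ≤⟨ sum-map-mono _ _ sizes ⟩
  sum (map (λ a → count (R a) bs) as)                  ≡⟨ sum-count-swap R as bs ⟩
  sum (map (λ b → count (λ a → R a b) as) bs)          ≤⟨ sum-map-mono _ _ (All.universal (λ b → atMostTwice _ (atMost b)) bs) ⟩
  sum (map (λ b → 2 * indicator (covered b)) bs)       ≡⟨ sum-map-*2 _ bs ⟩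
  2 * sum (map (λ b → indicator (covered b)) bs)       ≡⟨ cong (2 *_) (sym (count-as-sum covered bs)) ⟩
  2 * count covered bs                                 ∎
  where
  open ≤-Reasoning
  covered = λ b → 1 ≤ᵇ count (λ a → R a b) as
  atMostTwice : ∀ c → c ≤ 2 → c ≤ 2 * indicator (1 ≤ᵇ c)
  atMostTwice zero    _ = z≤n
  atMostTwice (suc c) h = h

count-disjoint : ∀ {A : Set} (p q : A → Bool) → (∀ x → T (p x) → T (q x) → ⊥) → ∀ xs → count p xs + count q xs ≤ length xs
count-disjoint p q h []       = z≤n
count-disjoint p q h (x ∷ xs) with p x | q x | h x
... | true  | true  | h′ = ⊥-elim (h′ tt tt)
... | true  | false | _  = s≤s (count-disjoint p q h xs)
... | false | true  | _  = ≤-trans (≤-reflexive (+-suc _ _)) (s≤s (count-disjoint p q h xs))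
... | false | false | _  = ≤-trans (count-disjoint p q h xs) (n≤1+n _)

-- Distances and geodesics

least : {P : ℕ → Set} → (∀ k → Dec (P k)) → ∀ k → P k → ∃[ m ] (P m × (∀ j → P j → m ≤ j))
least {P} P? k pk = go 0 k (λ j ()) (+-identityʳ k)
  where
  go : ∀ m d → (∀ j → j < m → ¬ P j) → d + m ≡ k → ∃[ m ] (P m × (∀ j → P j → m ≤ j))
  go m zero    below refl = m , pk , λ j pj → ≮⇒≥ λ j<m → below j j<m pj
  go m (suc d) below eq   with P? m
  ... | yes pm = m , pm , λ j pj → ≮⇒≥ λ j<m → below j j<m pj
  ... | no ¬pm = go (suc m) d below′ (trans (+-suc d m) eq)
    where
    below′ : ∀ j → j < suc m → ¬ P j
    below′ j j≤m pj with m≤n⇒m<n∨m≡n (s≤s⁻¹ j≤m)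
    ... | inj₁ j<m  = below j j<m pj
    ... | inj₂ refl = ¬pm pj

minimiser : ∀ {n} (f : Fin n → ℕ) → Fin n → ∃[ v ] (∀ u → f v ≤ f u)
minimiser f v₀ = go v₀ (<-wellFounded (f v₀))
  where
  go : ∀ v → Acc _<_ (f v) → ∃[ v ] (∀ u → f v ≤ f u)
  go v (acc rec) with any? (λ u → f u <? f v)
  ... | yes (u , fu<fv) = go u (rec fu<fv)
  ... | no  ¬smaller    = v , λ u → ≮⇒≥ λ fu<fv → ¬smaller (u , fu<fv)

module _ {n} (G : Graph n) where

  adj-sym : ∀ {u v} → Adj G u v → Adj G v u
  adj-sym {u} {v} = subst T (symm G u v)

  walk? : ∀ u w k → Dec (Walk G u w k)
  walk? u w zero with u ≟ w
  ... | yes refl = yes here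
  ... | no u≢w   = no λ { here → u≢w refl }
  walk? u w (suc k) = map′ (λ (v , a , p) → step a p) (λ { (step a p) → _ , a , p })
    (any? λ v → T? (adj G u v) ×-dec walk? v w k)

  _⧺_ : ∀ {u v w j k} → Walk G u v j → Walk G v w k → Walk G u w (j + k)
  here     ⧺ q = q
  step a p ⧺ q = step a (p ⧺ q)

  reverse-walk : ∀ {u w k} → Walk G u w k → Walk G w u k
  reverse-walk here               = here
  reverse-walk (step {k = k} a p) =
    subst (Walk G _ _) (+-comm k 1) (reverse-walk p ⧺ step (adj-sym a) here)

module Metric {n} (G : Graph n) (connected : Connected G) where

  V : Set
  V = Fin n

  abstract
    shortest : ∀ u w → ∃[ m ] (Walk G u w m × (∀ j → Walk G u w j → m ≤ j))
    shortest u w = least (walk? G u w) (proj₁ (connected u w)) (proj₂ (connected u w))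

  dist : V → V → ℕ
  dist u w = proj₁ (shortest u w)

  dist-walk : ∀ u w → Walk G u w (dist u w)
  dist-walk u w = proj₁ (proj₂ (shortest u w))

  dist≤walk : ∀ {u w k} → Walk G u w k → dist u w ≤ k
  dist≤walk {u} {w} {k} = proj₂ (proj₂ (shortest u w)) k

  dist-triangle : ∀ u v w → dist u w ≤ dist u v + dist v w
  dist-triangle u v w = dist≤walk (_⧺_ G (dist-walk u v) (dist-walk v w))

  dist-sym : ∀ u w → dist u w ≡ dist w u
  dist-sym u w = ≤-antisym (dist≤walk (reverse-walk G (dist-walk w u))) (dist≤walk (reverse-walk G (dist-walk u w)))

  dist-refl : ∀ u → dist u u ≡ 0
  dist-refl u = n≤0⇒n≡0 (dist≤walk here)

  dist-adj : ∀ {u w} → Adj G u w → dist u w ≤ 1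
  dist-adj a = dist≤walk (step a here)

  dist-common : ∀ {u w x} → Adj G u x → Adj G w x → dist u w ≤ 2
  dist-common a b = dist≤walk (step a (step (adj-sym G b) here))

  -- `path` is total so that indices need no bounds in their type; its values beyond ℓ carry no
  -- information.
  record Geodesic (u : V) (ℓ : ℕ) : Set where
    field
      path  : ℕ → V
      start : path 0 ≡ u
      edge  : ∀ i → i < ℓ → Adj G (path i) (path (suc i))
      level : ∀ i → i ≤ ℓ → dist u (path i) ≡ i

    ahead : ∀ i d → i + d ≤ ℓ → dist (path i) (path (i + d)) ≤ d
    ahead i zero    h rewrite +-identityʳ i = ≤-reflexive (dist-refl (path i))
    ahead i (suc d) h rewrite +-suc i d = ≤-trans (dist-triangle _ (path (i + d)) _)
      (≤-trans (+-mono-≤ (ahead i d (<⇒≤ h)) (dist-adj (edge (i + d) h))) (≤-reflexive (+-comm d 1)))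

    -- Stated without truncated subtraction, so that it can be fed to `linear`.
    between : ∀ {i j} → i ≤ j → j ≤ ℓ → dist (path i) (path j) + i ≤ j
    between {i} {j} i≤j j≤ℓ with ahead i (j ∸ i) (≤-trans (≤-reflexive (m+[n∸m]≡n i≤j)) j≤ℓ)
    ... | h rewrite m+[n∸m]≡n i≤j = ≤-trans (+-monoˡ-≤ i h) (≤-reflexive (m∸n+n≡m i≤j))

  private
    vertexAt : ∀ {u w k} → Walk G u w k → ℕ → V
    vertexAt {u} p          zero    = u
    vertexAt     (here {v}) (suc i) = v
    vertexAt     (step a p) (suc i) = vertexAt p i

    vertexAt-end : ∀ {u w k} (p : Walk G u w k) → vertexAt p k ≡ w
    vertexAt-end here       = refl
    vertexAt-end (step a p) = vertexAt-end p

    vertexAt-edge : ∀ {u w k} (p : Walk G u w k) i → i < k → Adj G (vertexAt p i) (vertexAt p (suc i))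
    vertexAt-edge (step a here)       zero    h = a
    vertexAt-edge (step a (step b p)) zero    h = a
    vertexAt-edge (step a p)          (suc i) (s≤s h) = vertexAt-edge p i h

    upTo : ∀ {u w k} (p : Walk G u w k) i → i ≤ k → Walk G u (vertexAt p i) i
    upTo p          zero    h       = here
    upTo (step a p) (suc i) (s≤s h) = step a (upTo p i h)

    from : ∀ {u w k} (p : Walk G u w k) i → i ≤ k → dist (vertexAt p i) w + i ≤ k
    from p          zero    h       = ≤-trans (≤-reflexive (+-identityʳ _)) (dist≤walk p)
    from (step a p) (suc i) (s≤s h) = ≤-trans (≤-reflexive (+-suc _ i)) (s≤s (from p i h))

  -- A prefix of a shortest walk is shortest, since a shortcut to an inner vertex would shorten the
  -- whole walk. Hence the target w may lie further away than ℓ.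
  geodesic : ∀ u w {ℓ} → ℓ ≤ dist u w → Geodesic u ℓ
  geodesic u w {ℓ} ℓ≤d = record
    { path = vertexAt p ; start = refl
    ; edge = λ i i<ℓ → vertexAt-edge p i (≤-trans i<ℓ ℓ≤d)
    ; level = λ i i≤ℓ → ≤-antisym (dist≤walk (upTo p i (≤-trans i≤ℓ ℓ≤d)))
        (linear 4 (λ i d a b → d ≼ a ⊕ b ⇒ b ⊕ i ≼ d ⇒ ⊢ i ≼ a) i (dist u w) _ _
          (dist-triangle u (vertexAt p i) w) (from p i (≤-trans i≤ℓ ℓ≤d))) }
    where p = dist-walk u w

  geodesic-end : ∀ u w → Geodesic.path (geodesic u w ≤-refl) (dist u w) ≡ w
  geodesic-end u w = vertexAt-end (dist-walk u w)

  module _ (r : ℕ) where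

    far : V → V → Bool
    far v w = r ≤ᵇ dist v w

    -- If F(v) = {w : dist v w ≥ r} has the least possible size, then whenever u is close to
    -- some member of F(v) it must gain a member outside F(v).
    Balanced : V → Set
    Balanced v = ∀ u z → r ≤ dist v z → dist u z < r → ∃[ w ] (r ≤ dist u w × dist v w < r)

    balanced-vertex : V → ∃[ v ] Balanced v
    balanced-vertex v₀ with minimiser (λ v → count (far v) (allFin n)) v₀
    ... | v , minimal = v , balanced
      where
      balanced : Balanced v
      balanced u z vz uz with any? (λ w → (r ≤? dist u w) ×-dec (dist v w <? r))
      ... | yes gained = gained
      -- Without a gain, F(u) is contained in F(v) and misses z, against the minimality of F(v).
      ... | no ¬gained = ⊥-elim (<⇒≱ fewer (minimal u))
        where
        fewer : count (far u) (allFin n) < count (far v) (allFin n)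
        fewer = count-mono-< (far u) (far v)
          (λ w uw → ≤⇒≤ᵇ (≮⇒≥ λ vw → ¬gained (w , ≤ᵇ⇒≤ r _ uw , vw)))
          (∈-allFin z) (λ h → <⇒≱ uz (≤ᵇ⇒≤ r _ h)) (≤⇒≤ᵇ vz)

-- Neighbourhood packings along two paths

-- Names of vertices rather than vertices: sums run over names with multiplicity, and conditions on
-- common neighbours are checked by cases on the names. The order `_⊏_` lets every pair or triple be
-- treated only once.
data Item : Set where
  P Q : ℕ → Item
  Y Z : Item

_⊏_ : Item → Item → Set
P i ⊏ P j = i < j
P i ⊏ _   = ⊤
Q i ⊏ P j = ⊥
Q i ⊏ Q j = i < j
Q i ⊏ _   = ⊤
Y   ⊏ Z   = ⊤
Y   ⊏ _   = ⊥
Z   ⊏ _   = ⊥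

data Extras : Set where
  none justY justZ both : Extras

extras : Extras → List Item
extras none  = []
extras justY = Y ∷ []
extras justZ = Z ∷ []
extras both  = Y ∷ Z ∷ []

items : List ℕ → List ℕ → Extras → List Item
items is js x = map P is ++ map Q js ++ extras x

items-sorted : ∀ {is js} → AllPairs _<_ is → AllPairs _<_ js → ∀ x → AllPairs _⊏_ (items is js x)
items-sorted {is} {js} ps qs x = AllPairs.++⁺ (AllPairs.map⁺ ps) (AllPairs.++⁺ (AllPairs.map⁺ qs) (sorted x) (Q-before x))
  (All.map⁺ (All.universal (λ i → All.++⁺ (All.map⁺ (All.universal (λ _ → tt) js)) (P-extras i x)) is))
  where
  sorted : ∀ x → AllPairs _⊏_ (extras x)
  sorted none  = []
  sorted justY = [] ∷ []
  sorted justZ = [] ∷ []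
  sorted both  = (tt ∷ []) ∷ [] ∷ []
  P-extras : ∀ i x → All (P i ⊏_) (extras x)
  P-extras i none  = []
  P-extras i justY = tt ∷ []
  P-extras i justZ = tt ∷ []
  P-extras i both  = tt ∷ tt ∷ []
  Q-extras : ∀ j x → All (Q j ⊏_) (extras x)
  Q-extras j none  = []
  Q-extras j justY = tt ∷ []
  Q-extras j justZ = tt ∷ []
  Q-extras j both  = tt ∷ tt ∷ []
  Q-before : ∀ x → All (λ a → All (a ⊏_) (extras x)) (map Q js)
  Q-before x = All.map⁺ (All.universal (λ j → Q-extras j x) js)

module _ {A : Set} (δ : ℕ) where
  sum-const : ∀ (xs : List A) → sum (map (λ _ → δ) xs) ≡ length xs * δ
  sum-const []       = refl
  sum-const (x ∷ xs) = cong (δ +_) (sum-const xs)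

length-items : ∀ is js x → length (items is js x) ≡ length is + (length js + length (extras x))
length-items is js x rewrite length-++ (map P is) {map Q js ++ extras x} | length-++ (map Q js) {extras x}
  | length-map P is | length-map Q js = refl

module Packing {n} (G : Graph n) {δ} (minDegree : ∀ v → δ ≤ deg G v)
    (p q : ℕ → Fin n) (y z : Fin n) where

  vertex : Item → Fin n
  vertex (P i) = p i
  vertex (Q j) = q j
  vertex Y     = y
  vertex Z     = z

  _∼_ : Item → Fin n → Set
  a ∼ x = Adj G (vertex a) x

  private
    sizes : ∀ as → All (λ a → δ ≤ count (adj G (vertex a)) (allFin n)) as
    sizes = All.universal (λ a → minDegree (vertex a))

    rephrase : ∀ {as : List Item} c → sum (map (λ _ → δ) as) ≤ c * length (allFin n) → length as * δ ≤ c * n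
    rephrase {as} c h = subst₂ (λ a b → a ≤ c * b) (sum-const δ as) (length-tabulate {n = n} (λ i → i)) h

    rephrase-< : ∀ {as : List Item} c → sum (map (λ _ → δ) as) < c * length (allFin n) → length as * δ < c * n
    rephrase-< {as} c h = subst₂ (λ a b → a < c * b) (sum-const δ as) (length-tabulate {n = n} (λ i → i)) h

  NoPair NoTriple : (Item → Set) → Fin n → Set
  NoPair Ok x = ∀ {a b} → Ok a → Ok b → a ⊏ b → a ∼ x → b ∼ x → ⊥
  NoTriple Ok x = ∀ {a b c} → Ok a → Ok b → Ok c → a ⊏ b → a ⊏ c → b ⊏ c → a ∼ x → b ∼ x → c ∼ x → ⊥

  module _ {Ok : Item → Set} {as : List Item} (ok : All Ok as) (sorted : AllPairs _⊏_ as) where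

    packing₁ : (∀ x → NoPair Ok x) → length as * δ ≤ 1 * n
    packing₁ h = rephrase {as} 1 (double-count (λ a → adj G (vertex a)) _ as (allFin n) 1 (sizes as)
      λ x → count≤1 (λ a → adj G (vertex a) x) ok sorted (h x))

    packing₁-< : (∀ x → NoPair Ok x) → ∀ e → (∀ {a} → Ok a → a ∼ e → ⊥) → length as * δ < 1 * n
    packing₁-< h e g = rephrase-< {as} 1 (double-count-< (λ a → adj G (vertex a)) _ as (allFin n) 1 (sizes as)
      (λ x → count≤1 (λ a → adj G (vertex a) x) ok sorted (h x)) (∈-allFin e)
      (s≤s (≤-reflexive (count≡0 (λ a → adj G (vertex a) e) (All.map g ok)))))

    packing₂-< : (∀ x → NoTriple Ok x) → ∀ e → NoPair Ok e → length as * δ < 2 * n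
    packing₂-< h e g = rephrase-< {as} 2 (double-count-< (λ a → adj G (vertex a)) _ as (allFin n) 2 (sizes as)
      (λ x → count≤2 (λ a → adj G (vertex a) x) ok sorted (h x)) (∈-allFin e)
      (s≤s (count≤1 (λ a → adj G (vertex a) e) ok sorted g)))

    covered : Fin n → Bool
    covered x = 1 ≤ᵇ count (λ a → adj G (vertex a) x) as

    covering₂ : (∀ x → NoTriple Ok x) → length as * δ ≤ 2 * count covered (allFin n)
    covering₂ h = subst (_≤ 2 * count covered (allFin n)) (sum-const δ as)
      (double-count-covered (λ a → adj G (vertex a)) _ as (allFin n) (sizes as)
        λ x → count≤2 (λ a → adj G (vertex a) x) ok sorted (h x))

-- Two indices out of every four

early : ℕ → Bool
early 0 = true
early 1 = true
early 2 = false
early 3 = false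
early (suc (suc (suc (suc i)))) = early i

-- Difference 2 is the one to avoid: on a geodesic it is the only one that permits a common
-- neighbour.
early-apart : ∀ i → T (early i) → T (early (2 + i)) → ⊥
early-apart 0 _ ()
early-apart 1 _ ()
early-apart 2 ()
early-apart 3 ()
early-apart (suc (suc (suc (suc i)))) = early-apart i

Selected : ℕ → ℕ → Set
Selected s i = T (early (s + i))

selected-apart : ∀ s i → Selected s i → Selected s (2 + i) → ⊥
selected-apart s i a b = early-apart (s + i) a
  (subst (λ m → T (early m)) (linear 2 (λ s i → ⊢ s ⊕ (# 2 ⊕ i) ≋ # 2 ⊕ (s ⊕ i)) s i) b)

steps : ℕ → ℕ → ℕ → List ℕ
steps a b zero    = []
steps a b (suc m) = a ∷ b ∷ steps (4 + a) (4 + b) m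

length-steps : ∀ a b m → length (steps a b m) ≡ m + m
length-steps a b zero    = refl
length-steps a b (suc m) = cong suc (trans (cong suc (length-steps (4 + a) (4 + b) m)) (sym (+-suc m m)))

module _ {R : ℕ → Set} (periodic : ∀ i → R i → R (4 + i)) where

  -- The largest entry is b + 4(m - 1); adding 4 to both sides avoids the subtraction.
  steps-all : ∀ {a b} m → a ≤ b → R a → R b → All (λ i → R i × a ≤ i × 4 + i ≤ b + 4 * m) (steps a b m)
  steps-all {a} {b} zero    a≤b ra rb = []
  steps-all {a} {b} (suc m) a≤b ra rb =
    (ra , ≤-refl , linear 3 (λ a b m → a ≼ b ⇒ ⊢ # 4 ⊕ a ≼ b ⊕ 4 ⊛ (# 1 ⊕ m)) a b m a≤b) ∷
    (rb , a≤b , linear 2 (λ b m → ⊢ # 4 ⊕ b ≼ b ⊕ 4 ⊛ (# 1 ⊕ m)) b m) ∷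
    All.map (λ {i} (ri , l , u) → ri , linear 2 (λ a i → # 4 ⊕ a ≼ i ⇒ ⊢ a ≼ i) a i l ,
              linear 3 (λ b m i → # 4 ⊕ i ≼ # 4 ⊕ b ⊕ 4 ⊛ m ⇒ ⊢ # 4 ⊕ i ≼ b ⊕ 4 ⊛ (# 1 ⊕ m)) b m i u)
      (steps-all m (+-monoʳ-≤ 4 a≤b) (periodic a ra) (periodic b rb))

steps-sorted : ∀ {a b} m → a < b → b < 4 + a → AllPairs _<_ (steps a b m)
steps-sorted zero    a<b b<4+a = []
steps-sorted {a} {b} (suc m) a<b b<4+a =
  (a<b ∷ All.map (<-trans a<b) later) ∷ later ∷ steps-sorted m (+-monoʳ-< 4 a<b) (+-monoʳ-< 4 b<4+a)
  where
  later : All (b <_) (steps (4 + a) (4 + b) m)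
  later = All.map (λ (_ , l , _) → ≤-trans b<4+a l)
    (steps-all {R = λ _ → ℕ} (λ _ x → x) m (+-monoʳ-≤ 4 (<⇒≤ a<b)) 0 0)

residue₄ : ∀ r → ∃[ q ] (r ≡ 4 * q ⊎ r ≡ 1 + 4 * q ⊎ r ≡ 2 + 4 * q ⊎ r ≡ 3 + 4 * q)
residue₄ 0 = 0 , inj₁ refl
residue₄ 1 = 0 , inj₂ (inj₁ refl)
residue₄ 2 = 0 , inj₂ (inj₂ (inj₁ refl))
residue₄ 3 = 0 , inj₂ (inj₂ (inj₂ refl))
residue₄ (suc (suc (suc (suc r)))) with residue₄ r
... | q , inj₁ eq               = suc q , inj₁ (linear 2 (λ r q → r ≋ 4 ⊛ q ⇒ ⊢ # 4 ⊕ r ≋ 4 ⊛ (# 1 ⊕ q)) r q eq)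
... | q , inj₂ (inj₁ eq)        = suc q , inj₂ (inj₁ (linear 2 (λ r q → r ≋ # 1 ⊕ 4 ⊛ q ⇒ ⊢ # 4 ⊕ r ≋ # 1 ⊕ 4 ⊛ (# 1 ⊕ q)) r q eq))
... | q , inj₂ (inj₂ (inj₁ eq)) = suc q , inj₂ (inj₂ (inj₁ (linear 2 (λ r q → r ≋ # 2 ⊕ 4 ⊛ q ⇒ ⊢ # 4 ⊕ r ≋ # 2 ⊕ 4 ⊛ (# 1 ⊕ q)) r q eq)))
... | q , inj₂ (inj₂ (inj₂ eq)) = suc q , inj₂ (inj₂ (inj₂ (linear 2 (λ r q → r ≋ # 3 ⊕ 4 ⊛ q ⇒ ⊢ # 4 ⊕ r ≋ # 3 ⊕ 4 ⊛ (# 1 ⊕ q)) r q eq)))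

-- The upper bound

applyUpTo-sorted : ∀ f m → (∀ {i j} → i < j → f i < f j) → AllPairs _<_ (applyUpTo f m)
applyUpTo-sorted f m mono = AllPairs.applyUpTo⁺₁ f m λ i<j _ → mono i<j

applyUpTo-all : ∀ {R : ℕ → Set} f m → (∀ i → i < m → R (f i)) → All R (applyUpTo f m)
applyUpTo-all f m h = All.applyUpTo⁺₁ f m λ {i} → h i

items-all : ∀ {Ok : Item → Set} {is js x} →
  All (λ i → Ok (P i)) is → All (λ j → Ok (Q j)) js → All Ok (extras x) → All Ok (items is js x)
items-all a b c = All.++⁺ (All.map⁺ a) (All.++⁺ (All.map⁺ b) c)

lit : ∀ a b {_ : T (a ≤ᵇ b)} → a ≤ b
lit a b {h} = ≤ᵇ⇒≤ a b h

halve-< : ∀ a b δ n → a ≡ b + b → a * δ < 2 * n → b * δ < n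
halve-< a b δ n refl h = *-cancelˡ-< 2 _ _ (≤-trans (s≤s (≤-reflexive (lemma b δ))) h)
  where
  lemma : ∀ b δ → 2 * (b * δ) ≡ (b + b) * δ
  lemma = solve-∀

module UpperBound {n} (G : Graph n) (connected : Connected G) (triangleFree : TriangleFree G)
    {δ} (minDegree : ∀ v → δ ≤ deg G v) {r} (4≤r : 4 ≤ r) where

  open Metric G connected
  open Geodesic

  noTriangle : ∀ {u v x} → Adj G u v → Adj G v x → Adj G u x → ⊥
  noTriangle a b c = triangleFree _ _ _ (a , b , c)

  -- Both geodesics start at u, so their indices are distances from u, and these differ by at most 2
  -- across a common neighbour.
  level-gap : ∀ {u k ℓ} (g : Geodesic u k) (h : Geodesic u ℓ) {i j x} → i ≤ k → j ≤ ℓ →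
    Adj G (path g i) x → Adj G (path h j) x → j ≤ 2 + i
  level-gap {u} g h {i} {j} i≤k j≤ℓ a b =
    linear 5 (λ i j A B C → B ≼ A ⊕ C ⇒ A ≋ i ⇒ B ≋ j ⇒ C ≼ # 2 ⇒ ⊢ j ≼ # 2 ⊕ i) i j _ _ _
      (dist-triangle u (path g i) (path h j)) (level g i i≤k) (level h j j≤ℓ) (dist-common a b)

  -- Difference 1 would close a triangle, and more than 2 contradicts `level-gap`.
  two-apart : ∀ {u ℓ} (g : Geodesic u ℓ) {i j x} → i < j → j ≤ ℓ →
    Adj G (path g i) x → Adj G (path g j) x → j ≡ 2 + i
  two-apart g {i} {j} i<j j≤ℓ a b with m≤n⇒m<n∨m≡n i<j
  ... | inj₁ 1+i<j = ≤-antisym (level-gap g g (≤-trans (<⇒≤ i<j) j≤ℓ) j≤ℓ a b) 1+i<j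
  ... | inj₂ refl  = ⊥-elim (noTriangle (edge g i j≤ℓ) b a)

  no-three : ∀ {u ℓ} (g : Geodesic u ℓ) {i j k x} → j ≤ ℓ → k ≤ ℓ → i < j → j < k →
    Adj G (path g i) x → Adj G (path g j) x → Adj G (path g k) x → ⊥
  no-three g {i} {j} {k} j≤ℓ k≤ℓ i<j j<k a b c =
    linear 3 (λ i j k → j ≋ # 2 ⊕ i ⇒ k ≋ # 2 ⊕ i ⇒ # 1 ⊕ j ≼ k ⇒ absurd) i j k
      (two-apart g i<j j≤ℓ a b) (two-apart g (<-trans i<j j<k) k≤ℓ a c) j<k

  -- The second component is what lowers the maximum radius by one in the exceptional case of the
  -- theorem.
  Bound : Set
  Bound = r * δ ≤ n × (Odd r → Odd δ → r * δ < n)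

  strictly : r * δ < n → Bound
  strictly h = <⇒≤ h , λ _ _ → h

  evenly : ∀ m → r ≡ 2 * m → r * δ ≤ n → Bound
  evenly m r≡ h = h , λ (m′ , r≡′) _ → ⊥-elim (even≢odd m m′ (trans (sym r≡) r≡′))

  *-odd : ∀ {a b} → Odd a → Odd b → Odd (a * b)
  *-odd (x , refl) (y , refl) = y + x * suc (2 * y) , lemma x y
    where
    lemma : ∀ x y → suc (2 * x) * suc (2 * y) ≡ suc (2 * (y + x * suc (2 * y)))
    lemma = solve-∀

  -- Common neighbours of two geodesics

  module TwoGeodesics {v₀ ℓ t} (p : Geodesic v₀ r) (q : Geodesic v₀ ℓ) (ℓ+t : ℓ + t ≡ r)
      (w-far : r ≤ dist (path p 3) (path q ℓ)) where

    3≤r : 3 ≤ r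
    3≤r = <⇒≤ 4≤r

    w : V
    w = path q ℓ

    private
      via : ∀ i j → r ≤ dist (path p 3) (path p i) + (dist (path p i) (path q j) + dist (path q j) w)
      via i j = ≤-trans w-far (≤-trans (dist-triangle _ (path p i) _)
        (+-monoʳ-≤ (dist (path p 3) (path p i)) (dist-triangle _ (path q j) _)))

    -- The route from P_3 along P to P_i, across to Q_j and along Q to w must have length at least
    -- r. Its first leg is 3 - i here and i - 3 in `PQ-after`.
    PQ-before : ∀ {i j d} → i ≤ 3 → j ≤ ℓ → dist (path p i) (path q j) ≤ d → i + j + t ≤ 3 + d
    PQ-before {i} {j} {d} i≤3 j≤ℓ close =
      linear 9 (λ i j r ℓ t d A B C → r ≼ A ⊕ (B ⊕ C) ⇒ B ≼ d ⇒ A ⊕ i ≼ # 3 ⇒ C ⊕ j ≼ ℓ ⇒ ℓ ⊕ t ≋ r ⇒ ⊢ i ⊕ j ⊕ t ≼ # 3 ⊕ d)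
        i j r ℓ t d _ _ _ (via i j) close
        (≤-trans (≤-reflexive (cong (_+ i) (dist-sym (path p 3) (path p i)))) (between p i≤3 3≤r))
        (between q j≤ℓ ≤-refl) ℓ+t

    PQ-after : ∀ {i j d} → 3 ≤ i → i ≤ r → j ≤ ℓ → dist (path p i) (path q j) ≤ d → t + j + 3 ≤ i + d
    PQ-after {i} {j} {d} 3≤i i≤r j≤ℓ close =
      linear 9 (λ i j r ℓ t d A B C → r ≼ A ⊕ (B ⊕ C) ⇒ B ≼ d ⇒ A ⊕ # 3 ≼ i ⇒ C ⊕ j ≼ ℓ ⇒ ℓ ⊕ t ≋ r ⇒ ⊢ t ⊕ j ⊕ # 3 ≼ i ⊕ d)
        i j r ℓ t d _ _ _ (via i j) close (between p 3≤i i≤r) (between q j≤ℓ ≤-refl) ℓ+t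

    PQ-common : ∀ {i j x} → i ≤ r → j ≤ ℓ → Adj G (path p i) x → Adj G (path q j) x →
      (i ≤ 3 × i + j + t ≤ 5) ⊎ (3 ≤ i × t + j + 1 ≤ i)
    PQ-common {i} {j} i≤r j≤ℓ a b with i ≤? 3
    ... | yes i≤3 = inj₁ (i≤3 , PQ-before i≤3 j≤ℓ (dist-common a b))
    ... | no ¬i≤3 = inj₂ (<⇒≤ (≰⇒> ¬i≤3) , linear 3 (λ i j t → t ⊕ j ⊕ # 3 ≼ i ⊕ # 2 ⇒ ⊢ t ⊕ j ⊕ # 1 ≼ i) i j t
                        (PQ-after (<⇒≤ (≰⇒> ¬i≤3)) i≤r j≤ℓ (dist-common a b)))

    w≁P : ∀ {i} → i ≤ r → Adj G (path p i) w → 2 ≤ ℓ → ⊥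
    w≁P {i} i≤r a 2≤ℓ with i ≤? 3
    ... | yes i≤3 = linear 5 (λ i r ℓ t A → A ≼ i ⊕ # 1 ⇒ A ≋ ℓ ⇒ # 2 ≼ ℓ ⇒ i ⊕ ℓ ⊕ t ≼ # 4 ⇒ ℓ ⊕ t ≋ r ⇒ # 4 ≼ r ⇒ absurd) i r ℓ t _
          (≤-trans (dist-triangle v₀ (path p i) w) (+-mono-≤ (≤-reflexive (level p i i≤r)) (dist-adj a)))
          (level q ℓ ≤-refl) 2≤ℓ (PQ-before i≤3 ≤-refl (dist-adj a)) ℓ+t 4≤r
    ... | no ¬i≤3 = linear 4 (λ i r ℓ t → t ⊕ ℓ ⊕ # 3 ≼ i ⊕ # 1 ⇒ ℓ ⊕ t ≋ r ⇒ i ≼ r ⇒ absurd) i r ℓ t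
          (PQ-after (<⇒≤ (≰⇒> ¬i≤3)) i≤r ≤-refl (dist-adj a)) ℓ+t i≤r

    w∼Q : ∀ {j} → j ≤ ℓ → Adj G (path q j) w → ℓ ≤ 1 + j
    w∼Q {j} j≤ℓ a = linear 3 (λ j ℓ A → A ≼ j ⊕ # 1 ⇒ A ≋ ℓ ⇒ ⊢ ℓ ≼ # 1 ⊕ j) j ℓ _
          (≤-trans (dist-triangle v₀ (path q j) w) (+-mono-≤ (≤-reflexive (level q j j≤ℓ)) (dist-adj a))) (level q ℓ ≤-refl)

    end∼ : ∀ {k} (g : Geodesic v₀ k) {i} → i ≤ k → Adj G (path g i) (path p r) → r ≤ 1 + i
    end∼ g {i} i≤k a = linear 3 (λ i r A → A ≼ i ⊕ # 1 ⇒ A ≋ r ⇒ ⊢ r ≼ # 1 ⊕ i) i r _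
          (≤-trans (dist-triangle v₀ (path g i) (path p r)) (+-mono-≤ (≤-reflexive (level g i i≤k)) (dist-adj a)))
          (level p r ≤-refl)

    irreflexive : ∀ {v} → Adj G v v → ⊥
    irreflexive {v} a = subst T (irrefl G v) a

    -- `Q 0` is left out because it is the vertex v₀, already present as `P 0`.
    OkPath : Extras → Item → Set
    OkPath x     (P i) = i ≤ r
    OkPath x     (Q j) = 1 ≤ j × j ≤ ℓ
    OkPath none  Y     = ⊥
    OkPath justY Y     = ⊤
    OkPath justZ Y     = ⊥
    OkPath both  Y     = ⊤
    OkPath none  Z     = ⊥
    OkPath justY Z     = ⊥
    OkPath justZ Z     = ⊤
    OkPath both  Z     = ⊤

    ok-paths : ∀ x → All (OkPath x) (items (applyUpTo (λ i → i) (suc r)) (applyUpTo suc ℓ) x)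
    ok-paths x = items-all {OkPath x} {x = x} (applyUpTo-all _ (suc r) λ i i<1+r → s≤s⁻¹ i<1+r)
      (applyUpTo-all suc ℓ λ j j<ℓ → s≤s z≤n , j<ℓ) (extras-ok x)
      where
      extras-ok : ∀ x → All (OkPath x) (extras x)
      extras-ok none  = []
      extras-ok justY = tt ∷ []
      extras-ok justZ = tt ∷ []
      extras-ok both  = tt ∷ tt ∷ []

    sorted-paths : ∀ x → AllPairs _⊏_ (items (applyUpTo (λ i → i) (suc r)) (applyUpTo suc ℓ) x)
    sorted-paths x = items-sorted (applyUpTo-sorted _ (suc r) λ h → h) (applyUpTo-sorted suc ℓ s≤s) x

    length-paths : ∀ x → length (items (applyUpTo (λ i → i) (suc r)) (applyUpTo suc ℓ) x) ≡ suc r + (ℓ + length (extras x))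
    length-paths x = trans (length-items (applyUpTo (λ i → i) (suc r)) (applyUpTo suc ℓ) x)
      (cong₂ (λ a b → a + (b + length (extras x))) (length-applyUpTo (λ i → i) (suc r)) (length-applyUpTo suc ℓ))

    Q₀≡P₀ : path q 0 ≡ path p 0
    Q₀≡P₀ = trans (start q) (sym (start p))

    P₀Q₁ : ∀ {x} → 1 ≤ ℓ → Adj G (path p 0) x → Adj G (path q 1) x → ⊥
    P₀Q₁ 1≤ℓ a b = noTriangle (edge q 0 1≤ℓ) b (subst (λ v → Adj G v _) (sym Q₀≡P₀) a)

    end≁Q : ∀ {j} → 1 ≤ t → 2 ≤ ℓ → j ≤ ℓ → Adj G (path q j) (path p r) → ⊥
    end≁Q {j} 1≤t 2≤ℓ j≤ℓ a with m≤n⇒m<n∨m≡n j≤ℓ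
    ... | inj₁ j<ℓ  = linear 4 (λ j ℓ t r → # 1 ⊕ j ≼ ℓ ⇒ r ≼ # 1 ⊕ j ⇒ ℓ ⊕ t ≋ r ⇒ # 1 ≼ t ⇒ absurd) j ℓ t r
                        j<ℓ (end∼ q j≤ℓ a) ℓ+t 1≤t
    ... | inj₂ refl = w≁P ≤-refl (adj-sym G a) 2≤ℓ

    module WithExtras (y z : V) where
      open Packing G minDegree (path p) (path q) y z public

      NoPairAt NoTripleAt : Extras → V → Set
      NoPairAt x   = NoPair (OkPath x)
      NoTripleAt x = NoTriple (OkPath x)

      -- There are r + 1 + ℓ items on the paths, so t - 1 extras make 2r; the strict inequality 2rδ
      -- < 2n is then halved.
      paths-bound : ∀ x → suc (ℓ + length (extras x)) ≡ r → (∀ v → NoTripleAt x v) → ∀ e → NoPairAt x e → r * δ < n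
      paths-bound x size noTriple e noPair = halve-< _ r δ n
        (trans (length-paths x) (trans (sym (+-suc r _)) (cong (r +_) size)))
        (packing₂-< (ok-paths x) (sorted-paths x) noTriple e noPair)

      module _ {Ok : Item → Set} {is js x} (ok-is : All (λ i → Ok (P i)) is) (ok-js : All (λ j → Ok (Q j)) js) (ok-x : All Ok (extras x))
          (sorted-is : AllPairs _<_ is) (sorted-js : AllPairs _<_ js) (size : length is + (length js + length (extras x)) ≡ r)
          (noPair : ∀ v → NoPair Ok v) where

        private
          rescale : length (items is js x) * δ ≡ r * δ
          rescale = cong (_* δ) (trans (length-items is js x) size)

        sparse-bound : r * δ ≤ n
        sparse-bound = subst₂ _≤_ rescale (+-identityʳ n)
          (packing₁ (items-all {Ok} {x = x} ok-is ok-js ok-x) (items-sorted sorted-is sorted-js x) noPair)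

        sparse-bound-< : ∀ e → (∀ {a} → Ok a → a ∼ e → ⊥) → r * δ < n
        sparse-bound-< e isolated = subst₂ _<_ rescale (+-identityʳ n)
          (packing₁-< (items-all {Ok} {x = x} ok-is ok-js ok-x) (items-sorted sorted-is sorted-js x) noPair e isolated)

      -- A neighbour of P_r has level at least r - 1. On P this leaves only the predecessor of P_r;
      -- on Q it could leave only w, which `w≁P` excludes.
      end-noPair : ∀ x → 1 ≤ t → 2 ≤ ℓ → (OkPath x Y → Adj G y (path p r) → ⊥) → (OkPath x Z → Adj G z (path p r) → ⊥) →
        NoPairAt x (path p r)
      end-noPair x 1≤t 2≤ℓ y≁ z≁ {P i} {P j} oi oj i<j a b
        with ≤-antisym oj (≤-trans (end∼ p oi a) i<j)
      ... | refl = irreflexive b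
      end-noPair x 1≤t 2≤ℓ y≁ z≁ {P i} {Q j} oi (_ , oj) _ a b = end≁Q 1≤t 2≤ℓ oj b
      end-noPair x 1≤t 2≤ℓ y≁ z≁ {P i} {Y}   oi oj _ a b = y≁ oj b
      end-noPair x 1≤t 2≤ℓ y≁ z≁ {P i} {Z}   oi oj _ a b = z≁ oj b
      end-noPair x 1≤t 2≤ℓ y≁ z≁ {Q i} {b}   (_ , oi) oj _ a _ = end≁Q 1≤t 2≤ℓ oi a
      end-noPair x 1≤t 2≤ℓ y≁ z≁ {Y}   {b}   oi oj _ a _ = y≁ oi a

    module WithY (y : V) (y-far : r ≤ dist (path p 1) y) where

      y-level : r ≤ 1 + dist v₀ y
      y-level = linear 4 (λ r A B C → r ≼ A ⇒ A ≼ B ⊕ C ⇒ B ≋ # 1 ⇒ ⊢ r ≼ # 1 ⊕ C) r _ _ _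
        y-far (dist-triangle _ v₀ y) (trans (dist-sym _ v₀) (level p 1 (≤-trans (s≤s z≤n) 4≤r)))

      -- P_i is only i - 1 steps from P_1, where y is known to be far. For a general geodesic from
      -- v₀ the detour to P_1 costs 2 more, hence the weaker `YQ-close`.
      YP-close : ∀ {i d} → 1 ≤ i → i ≤ r → dist (path p i) y ≤ d → 1 + r ≤ i + d
      YP-close {i} {d} 1≤i i≤r close =
        linear 6 (λ i r d A B C → r ≼ A ⇒ A ≼ B ⊕ C ⇒ B ⊕ # 1 ≼ i ⇒ C ≼ d ⇒ ⊢ # 1 ⊕ r ≼ i ⊕ d) i r d _ _ _
          y-far (dist-triangle _ (path p i) y) (between p 1≤i i≤r) close

      YQ-close : ∀ {k} (g : Geodesic v₀ k) {j d} → j ≤ k → dist (path g j) y ≤ d → r ≤ 1 + (j + d)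
      YQ-close g {j} {d} j≤k close =
        linear 6 (λ j r d A B C → r ≼ # 1 ⊕ A ⇒ A ≼ B ⊕ C ⇒ B ≋ j ⇒ C ≼ d ⇒ ⊢ r ≼ # 1 ⊕ (j ⊕ d)) j r d _ _ _
          y-level (dist-triangle v₀ (path g j) y) (level g j j≤k) close

      PY-common : ∀ {i x} → i ≤ r → Adj G (path p i) x → Adj G y x → r ≤ 1 + i
      PY-common {zero}  i≤r a b = ⊥-elim (linear 1 (λ r → # 4 ≼ r ⇒ r ≼ # 3 ⇒ absurd) r 4≤r (YQ-close p i≤r (dist-common a b)))
      PY-common {suc i} i≤r a b = linear 2 (λ i r → # 1 ⊕ r ≼ # 1 ⊕ i ⊕ # 2 ⇒ ⊢ r ≼ # 2 ⊕ i) i r (YP-close (s≤s z≤n) i≤r (dist-common a b))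

      QY-common : ∀ {j x} → j ≤ ℓ → Adj G (path q j) x → Adj G y x → r ≤ 3 + j
      QY-common {j} j≤ℓ a b = linear 2 (λ j r → r ≼ # 1 ⊕ (j ⊕ # 2) ⇒ ⊢ r ≼ # 3 ⊕ j) j r (YQ-close q j≤ℓ (dist-common a b))

      module t≡2 (t≡2 : t ≡ 2) where

        open WithExtras y y

        2≤ℓ : 2 ≤ ℓ
        2≤ℓ = linear 3 (λ ℓ t r → ℓ ⊕ t ≋ r ⇒ t ≋ # 2 ⇒ # 4 ≼ r ⇒ ⊢ # 2 ≼ ℓ) ℓ t r ℓ+t t≡2 4≤r

        -- Beyond P_3 a common neighbour would need i ≥ j + 3, more than the level gap allows.
        PQ : ∀ {i j x} → i ≤ r → j ≤ ℓ → Adj G (path p i) x → Adj G (path q j) x → i + j ≤ 3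
        PQ {i} {j} i≤r j≤ℓ a b with PQ-common i≤r j≤ℓ a b
        ... | inj₁ (_ , h) = linear 3 (λ i j t → i ⊕ j ⊕ t ≼ # 5 ⇒ t ≋ # 2 ⇒ ⊢ i ⊕ j ≼ # 3) i j t h t≡2
        ... | inj₂ (_ , h) = ⊥-elim (linear 3 (λ i j t → t ⊕ j ⊕ # 1 ≼ i ⇒ t ≋ # 2 ⇒ i ≼ # 2 ⊕ j ⇒ absurd) i j t h t≡2
                               (level-gap q p j≤ℓ i≤r b a))

        noTriple : ∀ x → NoTripleAt justY x
        noTriple x {P i} {P j} {P k} oi oj ok i<j i<k j<k a b c =
          no-three p oj ok i<j j<k a b c
        noTriple x {P i} {P j} {Q k} oi oj (1≤k , ok) i<j _ _ a b c with two-apart p i<j oj a b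
        noTriple x {P zero}    {P j} {Q 1}             oi oj (1≤k , ok) i<j _ _ a b c | refl = P₀Q₁ ok a c
        noTriple x {P zero}    {P j} {Q (suc (suc k))} oi oj (1≤k , ok) i<j _ _ a b c | refl =
          linear 1 (λ k → # 2 ⊕ (# 2 ⊕ k) ≼ # 3 ⇒ absurd) k (PQ oj ok b c)
        noTriple x {P (suc i)} {P j} {Q k}             oi oj (1≤k , ok) i<j _ _ a b c | refl =
          linear 2 (λ i k → # 3 ⊕ i ⊕ k ≼ # 3 ⇒ # 1 ≼ k ⇒ absurd) i k (PQ oj ok b c) 1≤k
        noTriple x {P i} {P j} {Y} oi oj _ i<j _ _ a b c =
          linear 3 (λ i j r → j ≋ # 2 ⊕ i ⇒ j ≼ r ⇒ r ≼ # 1 ⊕ i ⇒ absurd) i j r (two-apart p i<j oj a b) oj (PY-common oi a c)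
        noTriple x {P i} {Q j} {Q k} oi (1≤j , oj) (1≤k , ok) _ _ j<k a b c with two-apart q j<k ok b c
        noTriple x {P zero}    {Q 1}             {Q k} oi (1≤j , oj) (1≤k , ok) _ _ j<k a b c | refl = P₀Q₁ oj a b
        noTriple x {P zero}    {Q (suc (suc j))} {Q k} oi (1≤j , oj) (1≤k , ok) _ _ j<k a b c | refl =
          linear 1 (λ j → # 4 ⊕ j ≼ # 3 ⇒ absurd) j (PQ oi ok a c)
        noTriple x {P (suc i)} {Q j}             {Q k} oi (1≤j , oj) (1≤k , ok) _ _ j<k a b c | refl =
          linear 2 (λ i j → # 1 ⊕ i ⊕ (# 2 ⊕ j) ≼ # 3 ⇒ # 1 ≼ j ⇒ absurd) i j (PQ oi ok a c) 1≤j
        noTriple x {P i} {Q j} {Y} oi (1≤j , oj) _ _ _ _ a b c =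
          linear 3 (λ i j r → i ⊕ j ≼ # 3 ⇒ # 1 ≼ j ⇒ r ≼ # 1 ⊕ i ⇒ # 4 ≼ r ⇒ absurd) i j r (PQ oi oj a b) 1≤j (PY-common oi a c) 4≤r
        noTriple x {Q i} {Q j} {Q k} (_ , oi) (_ , oj) (_ , ok) i<j i<k j<k a b c =
          no-three q oj ok i<j j<k a b c
        noTriple x {Q i} {Q j} {Y} (_ , oi) (_ , oj) _ i<j _ _ a b c =
          linear 5 (λ i j ℓ t r → j ≋ # 2 ⊕ i ⇒ j ≼ ℓ ⇒ r ≼ # 3 ⊕ i ⇒ ℓ ⊕ t ≋ r ⇒ t ≋ # 2 ⇒ absurd) i j ℓ t r
            (two-apart q i<j oj a b) oj (QY-common oi a c) ℓ+t t≡2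

        noTriple x {c = Z} oi oj ()

        -- P_r meets only P_(r−1), unless it is next to y; in that case w meets only Q_(ℓ−1).
        bound : r * δ < n
        bound with T? (adj G y (path p r))
        ... | no y≁ = paths-bound justY size noTriple (path p r) (end-noPair justY (≤-trans (s≤s z≤n) (≤-reflexive (sym t≡2))) 2≤ℓ (λ _ → y≁) λ ())
          where
          size : suc (ℓ + 1) ≡ r
          size = linear 3 (λ ℓ t r → ℓ ⊕ t ≋ r ⇒ t ≋ # 2 ⇒ ⊢ # 1 ⊕ (ℓ ⊕ # 1) ≋ r) ℓ t r ℓ+t t≡2
        ... | yes y∼ = paths-bound justY size noTriple w noPair
          where
          size : suc (ℓ + 1) ≡ r
          size = linear 3 (λ ℓ t r → ℓ ⊕ t ≋ r ⇒ t ≋ # 2 ⇒ ⊢ # 1 ⊕ (ℓ ⊕ # 1) ≋ r) ℓ t r ℓ+t t≡2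
          -- Otherwise y is a common neighbour of P_r and w, whereas the route through P_r shows
          -- these to be at distance at least 3.
          y≁w : Adj G y w → ⊥
          y≁w a = linear 3 (λ ℓ t r → t ⊕ ℓ ⊕ # 3 ≼ r ⊕ # 2 ⇒ ℓ ⊕ t ≋ r ⇒ absurd) ℓ t r
            (PQ-after 3≤r ≤-refl ≤-refl (dist-common (adj-sym G y∼) (adj-sym G a))) ℓ+t
          noPair : NoPairAt justY w
          noPair {P i} oi oj _ a b = w≁P oi a 2≤ℓ
          noPair {Q i} {Q j} (_ , oi) (_ , oj) i<j a b with ≤-antisym oj (≤-trans (w∼Q oi a) i<j)
          ... | refl = irreflexive b
          noPair {Q i} {Y} oi oj _ a b = y≁w b
          noPair {Y} {Z} oi () _ a b

    -- A neighbour of v₀ from which both geodesics can still be followed optimally.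
    Shared : V → Set
    Shared u = Adj G (path p 0) u × dist u (path q 3) ≤ 2 × dist u (path p 4) ≤ 3

    module t≡1 (t≡1 : t ≡ 1) where

      open WithExtras v₀ v₀

      3≤ℓ : 3 ≤ ℓ
      3≤ℓ = linear 3 (λ ℓ t r → ℓ ⊕ t ≋ r ⇒ t ≋ # 1 ⇒ # 4 ≼ r ⇒ ⊢ # 3 ≼ ℓ) ℓ t r ℓ+t t≡1 4≤r

      PQ : ∀ {i j x} → i ≤ r → j ≤ ℓ → Adj G (path p i) x → Adj G (path q j) x → (i ≤ 3 × i + j ≤ 4) ⊎ (3 ≤ i × i ≡ 2 + j)
      PQ {i} {j} i≤r j≤ℓ a b with PQ-common i≤r j≤ℓ a b
      ... | inj₁ (i≤3 , h) = inj₁ (i≤3 , linear 3 (λ i j t → i ⊕ j ⊕ t ≼ # 5 ⇒ t ≋ # 1 ⇒ ⊢ i ⊕ j ≼ # 4) i j t h t≡1)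
      ... | inj₂ (3≤i , h) = inj₂ (3≤i , linear 3 (λ i j t → t ⊕ j ⊕ # 1 ≼ i ⇒ t ≋ # 1 ⇒ i ≼ # 2 ⊕ j ⇒ ⊢ i ≋ # 2 ⊕ j) i j t h t≡1
                                (level-gap q p j≤ℓ i≤r b a))

      Q₁-adjacent : Adj G (path p 0) (path q 1)
      Q₁-adjacent = subst (λ v → Adj G v _) Q₀≡P₀ (edge q 0 (≤-trans (s≤s z≤n) 3≤ℓ))

      P-edge : ∀ i → i < 4 → Adj G (path p i) (path p (suc i))
      P-edge i i<4 = edge p i (≤-trans i<4 4≤r)

      Q-edge : ∀ j → j < 3 → Adj G (path q j) (path q (suc j))
      Q-edge j j<3 = edge q j (≤-trans j<3 3≤ℓ)

      Q₁-shared : dist (path q 1) (path p 4) ≤ 3 → Shared (path q 1)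
      Q₁-shared h = Q₁-adjacent , dist≤walk (step (Q-edge 1 (s≤s (s≤s z≤n))) (step (Q-edge 2 ≤-refl) here)) , h

      -- Only (i, k) = (0, 2), (1, 1) and (2, 2) survive, and x is then a crossing between the
      -- paths: in the first case x itself is shared, in the others Q_1 reaches P_4 through x.
      bad-PPQ : ∀ {i k x} → 2 + i ≤ r → 1 ≤ k → k ≤ ℓ → Adj G (path p i) x → Adj G (path p (2 + i)) x → Adj G (path q k) x →
        ∃[ u ] Shared u
      bad-PPQ {zero} {k} {x} h 1≤k k≤ℓ a b c with PQ h k≤ℓ b c
      ... | inj₂ (s≤s (s≤s ()) , _)
      ... | inj₁ (_ , k≤2) with k
      ... | 1 = ⊥-elim (P₀Q₁ k≤ℓ a c)
      ... | 2 = x , a , dist≤walk (step (adj-sym G c) (step (Q-edge 2 ≤-refl) here)) ,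
        dist≤walk (step (adj-sym G b) (step (P-edge 2 (s≤s (s≤s (s≤s z≤n)))) (step (P-edge 3 ≤-refl) here)))
      ... | suc (suc (suc _)) = ⊥-elim (<⇒≱ (s≤s (s≤s (s≤s (s≤s (s≤s z≤n))))) k≤2)
      bad-PPQ {suc i} {k} {x} h 1≤k k≤ℓ a b c with k≡i
        where
        k≡i : k ≡ suc i
        k≡i with PQ h k≤ℓ b c
        ... | inj₁ (_ , g)  = linear 2 (λ i k → # 3 ⊕ i ⊕ k ≼ # 4 ⇒ # 1 ≼ k ⇒ ⊢ k ≋ # 1 ⊕ i) i k g 1≤k
        ... | inj₂ (_ , eq) = linear 2 (λ i k → # 3 ⊕ i ≋ # 2 ⊕ k ⇒ ⊢ k ≋ # 1 ⊕ i) i k eq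
      ... | refl with PQ (≤-trans (m≤n+m (suc i) 2) h) k≤ℓ a c
      ... | inj₂ (_ , eq) = ⊥-elim (linear 1 (λ i → # 1 ⊕ i ≋ # 3 ⊕ i ⇒ absurd) i eq)
      ... | inj₁ (_ , g) with i
      ... | 0 = _ , Q₁-shared (dist≤walk (step c (step (adj-sym G b) (step (P-edge 3 ≤-refl) here))))
      ... | 1 = _ , Q₁-shared (dist≤walk (step (Q-edge 1 (s≤s (s≤s z≤n))) (step c (step (adj-sym G b) here))))
      ... | suc (suc i) = ⊥-elim (linear 1 (λ i → # 3 ⊕ i ⊕ (# 3 ⊕ i) ≼ # 4 ⇒ absurd) i g)

      -- Only i = j = 1 survives; then P_1 reaches Q_3 through x.
      bad-PQQ : ∀ {i j x} → i ≤ r → 1 ≤ j → 2 + j ≤ ℓ → Adj G (path p i) x → Adj G (path q j) x → Adj G (path q (2 + j)) x →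
        ∃[ u ] Shared u
      bad-PQQ {i} {j} {x} i≤r 1≤j h a b c with PQ i≤r h a c
      ... | inj₂ (_ , eq) = ⊥-elim (linear 2 (λ i j → i ≋ # 4 ⊕ j ⇒ i ≼ # 2 ⊕ j ⇒ absurd) i j eq
                              (level-gap q p (≤-trans (m≤n+m j 2) h) i≤r b a))
      bad-PQQ {zero} {1} {x} i≤r 1≤j h a b c | inj₁ _ = ⊥-elim (P₀Q₁ (≤-trans (s≤s z≤n) h) a b)
      bad-PQQ {zero} {suc (suc j)} {x} i≤r 1≤j h a b c | inj₁ _ = ⊥-elim (linear 1 (λ j → # 4 ⊕ j ≼ # 2 ⇒ absurd) j (level-gap p q i≤r h a c))
      bad-PQQ {1} {1} {x} i≤r 1≤j h a b c | inj₁ _ = path p 1 , P-edge 0 (s≤s z≤n) , dist-common a c ,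
        ahead p 1 3 4≤r
      bad-PQQ {1} {suc (suc j)} {x} i≤r 1≤j h a b c | inj₁ (_ , g) = ⊥-elim (linear 1 (λ j → # 5 ⊕ j ≼ # 4 ⇒ absurd) j g)
      bad-PQQ {suc (suc i)} {j} {x} i≤r 1≤j h a b c | inj₁ (_ , g) =
        ⊥-elim (linear 2 (λ i j → # 2 ⊕ i ⊕ (# 2 ⊕ j) ≼ # 4 ⇒ # 1 ≼ j ⇒ absurd) i j g 1≤j)

      module Unshared (unshared : ∀ u → ¬ Shared u) where

        noTriple : ∀ x → NoTripleAt none x
        noTriple x {P i} {P j} {P k} oi oj ok i<j i<k j<k a b c = no-three p oj ok i<j j<k a b c
        noTriple x {P i} {P j} {Q k} oi oj (1≤k , ok) i<j _ _ a b c with two-apart p i<j oj a b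
        ... | refl with bad-PPQ oj 1≤k ok a b c
        ... | u , shared = unshared u shared
        noTriple x {P i} {Q j} {Q k} oi (1≤j , oj) (1≤k , ok) _ _ j<k a b c with two-apart q j<k ok b c
        ... | refl with bad-PQQ oi 1≤j ok a b c
        ... | u , shared = unshared u shared
        noTriple x {Q i} {Q j} {Q k} (_ , oi) (_ , oj) (_ , ok) i<j i<k j<k a b c = no-three q oj ok i<j j<k a b c
        noTriple x {c = Y} oi oj ()
        noTriple x {c = Z} oi oj ()

        bound : r * δ < n
        bound = paths-bound none (linear 3 (λ ℓ t r → ℓ ⊕ t ≋ r ⇒ t ≋ # 1 ⇒ ⊢ # 1 ⊕ (ℓ ⊕ # 0) ≋ r) ℓ t r ℓ+t t≡1)
          noTriple (path p r) (end-noPair none (≤-reflexive (sym t≡1)) (<⇒≤ 3≤ℓ) (λ ()) (λ ()))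

      -- The range i ≤ 3 contributes only i = 3, j = 1, which fits the same equation.
      PQ-after-3 : ∀ {i j x} → 3 ≤ i → i ≤ r → j ≤ ℓ → Adj G (path p i) x → Adj G (path q j) x → i ≡ 2 + j
      PQ-after-3 {i} {j} 3≤i i≤r j≤ℓ a b with PQ i≤r j≤ℓ a b
      ... | inj₁ (_ , h)  = linear 2 (λ i j → i ⊕ j ≼ # 4 ⇒ # 3 ≼ i ⇒ i ≼ # 2 ⊕ j ⇒ ⊢ i ≋ # 2 ⊕ j) i j h 3≤i (level-gap q p j≤ℓ i≤r b a)
      ... | inj₂ (_ , eq) = eq

      -- Common neighbours of P_i and Q_j now force i = j + 2, so the same residues modulo 4 are used on both paths.
      module Sparse (s : ℕ) where

        Ok : Item → Set
        Ok (P i) = Selected s i × 3 ≤ i × i ≤ r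
        Ok (Q j) = Selected s j × j ≤ ℓ
        Ok _     = ⊥

        noPair : ∀ x → NoPair Ok x
        noPair x {P i} {P j} (si , _ , _) (sj , _ , oj) i<j a b with two-apart p i<j oj a b
        ... | refl = selected-apart s i si sj
        noPair x {P i} {Q j} (si , 3≤i , oi) (sj , oj) _ a b with PQ-after-3 3≤i oi oj a b
        ... | refl = selected-apart s j sj si
        noPair x {Q i} {Q j} (si , oi) (sj , oj) i<j a b with two-apart q i<j oj a b
        ... | refl = selected-apart s i si sj

      -- Residues 0 and 3: P supplies 3, 4, 7, 8, ..., r and Q supplies 0, 3, 4, ..., r - 1, with 2m
      -- indices each.
      bound₀ : ∀ m → r ≡ 4 * m → r * δ ≤ n
      bound₀ m r≡ = sparse-bound {Ok} {x = none}
        (All.map (λ {i} (si , l , u) → si , l , linear 3 (λ i r m → # 4 ⊕ i ≼ # 4 ⊕ 4 ⊛ m ⇒ r ≋ 4 ⊛ m ⇒ ⊢ i ≼ r) i r m u r≡)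
          (steps-all {Selected 1} (λ _ h → h) m (lit 3 4) tt tt))
        (All.map (λ {j} (sj , l , u) → sj , linear 5 (λ j r m ℓ t → # 4 ⊕ j ≼ # 3 ⊕ 4 ⊛ m ⇒ r ≋ 4 ⊛ m ⇒ ℓ ⊕ t ≋ r ⇒ t ≋ # 1 ⇒ ⊢ j ≼ ℓ) j r m ℓ t u r≡ ℓ+t t≡1)
          (steps-all {Selected 1} (λ _ h → h) m z≤n tt tt))
        [] (steps-sorted m (lit 4 4) (lit 5 7)) (steps-sorted m (lit 1 3) (lit 4 4)) size noPair
        where
        open Sparse 1
        size : length (steps 3 4 m) + (length (steps 0 3 m) + 0) ≡ r
        size rewrite length-steps 3 4 m | length-steps 0 3 m =
          linear 2 (λ m r → r ≋ 4 ⊛ m ⇒ ⊢ m ⊕ m ⊕ (m ⊕ m ⊕ # 0) ≋ r) m r r≡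

      -- The odd vertex out is v₀ itself, as `Q 0`. All other chosen levels are at least 3, so v₀ is
      -- adjacent to no chosen vertex and the count is strict.
      bound₁ : ∀ m → r ≡ 1 + 4 * m → r * δ < n
      bound₁ m r≡ = sparse-bound-< {Ok} {x = none}
        (All.map (λ {i} (si , l , u) → si , l , linear 3 (λ i r m → # 4 ⊕ i ≼ # 4 ⊕ 4 ⊛ m ⇒ r ≋ # 1 ⊕ 4 ⊛ m ⇒ ⊢ i ≼ r) i r m u r≡) inner)
        ((tt , z≤n) ∷ All.map (λ {j} (sj , l , u) → sj , linear 5 (λ j r m ℓ t → # 4 ⊕ j ≼ # 4 ⊕ 4 ⊛ m ⇒ r ≋ # 1 ⊕ 4 ⊛ m ⇒ ℓ ⊕ t ≋ r ⇒ t ≋ # 1 ⇒ ⊢ j ≼ ℓ) j r m ℓ t u r≡ ℓ+t t≡1) inner)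
        [] (steps-sorted m (lit 4 4) (lit 5 7)) (All.map (λ (_ , l , _) → ≤-trans (s≤s z≤n) l) inner ∷ steps-sorted m (lit 4 4) (lit 5 7)) size
        noPair v₀ isolated
        where
        open Sparse 1
        inner : All (λ i → Selected 1 i × 3 ≤ i × 4 + i ≤ 4 + 4 * m) (steps 3 4 m)
        inner = steps-all {Selected 1} (λ _ h → h) m (lit 3 4) tt tt
        size : length (steps 3 4 m) + (suc (length (steps 3 4 m)) + 0) ≡ r
        size rewrite length-steps 3 4 m =
          linear 2 (λ m r → r ≋ # 1 ⊕ 4 ⊛ m ⇒ ⊢ m ⊕ m ⊕ (# 1 ⊕ (m ⊕ m) ⊕ # 0) ≋ r) m r r≡
        close : ∀ {k} (g : Geodesic v₀ k) {i} → i ≤ k → Adj G (path g i) v₀ → i ≤ 1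
        close g {i} i≤k a = ≤-trans (≤-reflexive (trans (sym (level g i i≤k)) (dist-sym v₀ _))) (dist-adj a)
        isolated : ∀ {a} → Ok a → a ∼ v₀ → ⊥
        isolated {P i} (_ , 3≤i , oi) a = <⇒≱ (≤-trans (s≤s (close p oi a)) (≤-trans (lit 2 3) 3≤i)) ≤-refl
        isolated {Q 0} (_ , oj) a = irreflexive (subst (λ v → Adj G v v₀) (start q) a)
        isolated {Q 1} (() , oj) a
        isolated {Q (suc (suc j))} (_ , oj) a = <⇒≱ (s≤s (s≤s z≤n)) (close q oj a)

      bound₂ : ∀ m → r ≡ 2 + 4 * m → r * δ ≤ n
      bound₂ m r≡ = sparse-bound {Ok} {x = none}
        (All.map (λ {i} (si , l , u) → si , ≤-trans (lit 3 4) l , linear 3 (λ i r m → # 4 ⊕ i ≼ # 5 ⊕ 4 ⊛ m ⇒ r ≋ # 2 ⊕ 4 ⊛ m ⇒ ⊢ i ≼ r) i r m u r≡)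
          (steps-all {Selected 0} (λ _ h → h) m (lit 4 5) tt tt))
        (All.map (λ {j} (sj , l , u) → sj , linear 5 (λ j r m ℓ t → # 4 ⊕ j ≼ # 1 ⊕ 4 ⊛ (# 1 ⊕ m) ⇒ r ≋ # 2 ⊕ 4 ⊛ m ⇒ ℓ ⊕ t ≋ r ⇒ t ≋ # 1 ⇒ ⊢ j ≼ ℓ) j r m ℓ t u r≡ ℓ+t t≡1)
          (steps-all {Selected 0} (λ _ h → h) (suc m) z≤n tt tt))
        [] (steps-sorted m (lit 5 5) (lit 6 8)) (steps-sorted (suc m) (lit 1 1) (lit 2 4)) size noPair
        where
        open Sparse 0
        size : length (steps 4 5 m) + (length (steps 0 1 (suc m)) + 0) ≡ r
        size rewrite length-steps 4 5 m =
          linear 2 (λ m r → r ≋ # 2 ⊕ 4 ⊛ m ⇒ ⊢ m ⊕ m ⊕ (# 2 ⊕ (m ⊕ m ⊕ # 0)) ≋ r) m r r≡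

      -- From P_4 and Q_3 onwards u is one step closer than v₀. A vertex y far from u is therefore
      -- so far from all chosen vertices, whose levels stop at r - 2, that it is not adjacent to
      -- them and shares no neighbour with them. It completes the r vertices and makes the count
      -- strict.
      module Apex {u y} (shared : Shared u) (y-far : r ≤ dist u y) (m : ℕ) (r≡ : r ≡ 3 + 4 * m) where

        open WithExtras y y using () renaming (NoPair to NoPairY; _∼_ to _∼ʸ_; sparse-bound-< to sparse-bound-<ʸ)

        7≤r : 7 ≤ r
        7≤r = go m r≡
          where
          go : ∀ m → r ≡ 3 + 4 * m → 7 ≤ r
          go zero    eq = ⊥-elim (<⇒≱ 4≤r (≤-reflexive eq))
          go (suc m) eq = linear 2 (λ r m → r ≋ # 3 ⊕ 4 ⊛ (# 1 ⊕ m) ⇒ ⊢ # 7 ≼ r) r m eq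

        P-far : ∀ {i d} → 4 ≤ i → i ≤ r → dist (path p i) y ≤ d → 1 + r ≤ i + d
        P-far {i} {d} 4≤i i≤r close =
          linear 8 (λ i r d A B C D E → r ≼ A ⇒ A ≼ B ⊕ C ⇒ B ≼ # 3 ⇒ C ≼ D ⊕ E ⇒ D ⊕ # 4 ≼ i ⇒ E ≼ d ⇒ ⊢ # 1 ⊕ r ≼ i ⊕ d) i r d _ _ _ _ _
            y-far (dist-triangle u (path p 4) y) (proj₂ (proj₂ shared)) (dist-triangle _ (path p i) y) (between p 4≤i i≤r) close

        Q-far : ∀ {j d} → d ≤ 2 → j ≤ ℓ → dist (path q j) y ≤ d → 1 + r ≤ j + d
        Q-far {j} {d} d≤2 j≤ℓ close with 3 ≤? j
        ... | yes 3≤j = linear 8 (λ i r d A B C D E → r ≼ A ⇒ A ≼ B ⊕ C ⇒ B ≼ # 2 ⇒ C ≼ D ⊕ E ⇒ D ⊕ # 3 ≼ i ⇒ E ≼ d ⇒ ⊢ # 1 ⊕ r ≼ i ⊕ d) j r d _ _ _ _ _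
            y-far (dist-triangle u (path q 3) y) (proj₁ (proj₂ shared)) (dist-triangle _ (path q j) y) (between q 3≤j j≤ℓ) close
        -- Below Q_3 the way from u through v₀ is short: dist u y would be at most 1 + 2 + 2, less
        -- than 7.
        ... | no ¬3≤j = ⊥-elim (linear 8 (λ i r d A B C D E → r ≼ A ⇒ A ≼ B ⊕ C ⇒ B ≼ # 1 ⇒ C ≼ D ⊕ E ⇒ D ≋ i ⇒ E ≼ d ⇒ d ≼ # 2 ⇒ # 1 ⊕ i ≼ # 3 ⇒ # 7 ≼ r ⇒ absurd) j r d _ _ _ _ _
            y-far (dist-triangle u v₀ y) (dist-adj (adj-sym G (subst (λ v → Adj G v u) (start p) (proj₁ shared))))
            (dist-triangle v₀ (path q j) y) (level q j j≤ℓ) close d≤2 (≰⇒> ¬3≤j) 7≤r)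

        Ok : Item → Set
        Ok (P i) = Selected 0 i × 4 ≤ i × 2 + i ≤ r
        Ok (Q j) = Selected 0 j × 2 + j ≤ r × j ≤ ℓ
        Ok Y     = ⊤
        Ok Z     = ⊥

        noPair : ∀ x → NoPairY Ok x
        noPair x {P i} {P j} (si , li , oi) (sj , lj , oj) i<j a b =
          Sparse.noPair 0 x {P i} {P j} (si , <⇒≤ li , m+n≤o⇒n≤o 2 oi) (sj , <⇒≤ lj , m+n≤o⇒n≤o 2 oj) i<j a b
        noPair x {P i} {Q j} (si , li , oi) (sj , _ , oj) _ a b =
          Sparse.noPair 0 x {P i} {Q j} (si , <⇒≤ li , m+n≤o⇒n≤o 2 oi) (sj , oj) tt a b
        noPair x {P i} {Y} (si , li , oi) _ _ a b =
          linear 2 (λ i r → # 1 ⊕ r ≼ i ⊕ # 2 ⇒ # 2 ⊕ i ≼ r ⇒ absurd) i r (P-far li (m+n≤o⇒n≤o 2 oi) (dist-common a b)) oi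
        noPair x {Q i} {Q j} (si , _ , oi) (sj , _ , oj) i<j a b =
          Sparse.noPair 0 x {Q i} {Q j} (si , oi) (sj , oj) i<j a b
        noPair x {Q j} {Y} (sj , uj , oj) _ _ a b =
          linear 2 (λ j r → # 1 ⊕ r ≼ j ⊕ # 2 ⇒ # 2 ⊕ j ≼ r ⇒ absurd) j r (Q-far ≤-refl oj (dist-common a b)) uj

        isolated : ∀ {a} → Ok a → a ∼ʸ y → ⊥
        isolated {P i} (_ , li , oi) a =
          linear 2 (λ i r → # 1 ⊕ r ≼ i ⊕ # 1 ⇒ # 2 ⊕ i ≼ r ⇒ absurd) i r (P-far li (m+n≤o⇒n≤o 2 oi) (dist-adj a)) oi
        isolated {Q j} (_ , uj , oj) a =
          linear 2 (λ j r → # 1 ⊕ r ≼ j ⊕ # 1 ⇒ # 2 ⊕ j ≼ r ⇒ absurd) j r (Q-far (lit 1 2) oj (dist-adj a)) uj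
        isolated {Y} _ a = irreflexive a

        bound : r * δ < n
        bound = sparse-bound-<ʸ {Ok} {x = justY}
          (All.map (λ {i} (si , l , u) → si , l , linear 3 (λ i r m → # 4 ⊕ i ≼ # 5 ⊕ 4 ⊛ m ⇒ r ≋ # 3 ⊕ 4 ⊛ m ⇒ ⊢ # 2 ⊕ i ≼ r) i r m u r≡)
            (steps-all {Selected 0} (λ _ h → h) m (lit 4 5) tt tt))
          (All.map (λ {j} (sj , l , u) → sj ,
              linear 3 (λ j r m → # 4 ⊕ j ≼ # 1 ⊕ 4 ⊛ (# 1 ⊕ m) ⇒ r ≋ # 3 ⊕ 4 ⊛ m ⇒ ⊢ # 2 ⊕ j ≼ r) j r m u r≡ ,
              linear 5 (λ j r m ℓ t → # 4 ⊕ j ≼ # 1 ⊕ 4 ⊛ (# 1 ⊕ m) ⇒ r ≋ # 3 ⊕ 4 ⊛ m ⇒ ℓ ⊕ t ≋ r ⇒ t ≋ # 1 ⇒ ⊢ j ≼ ℓ) j r m ℓ t u r≡ ℓ+t t≡1)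
            (steps-all {Selected 0} (λ _ h → h) (suc m) z≤n tt tt))
          (tt ∷ []) (steps-sorted m (lit 5 5) (lit 6 8)) (steps-sorted (suc m) (lit 1 1) (lit 2 4)) size noPair y isolated
          where
          size : length (steps 4 5 m) + (length (steps 0 1 (suc m)) + 1) ≡ r
          size rewrite length-steps 4 5 m =
            linear 2 (λ m r → r ≋ # 3 ⊕ 4 ⊛ m ⇒ ⊢ m ⊕ m ⊕ (# 2 ⊕ (m ⊕ m ⊕ # 1)) ≋ r) m r r≡

    -- Now w … v₀ … P_r behaves like a single geodesic; the sparse sets take two vertices out of every
    -- four, starting at w, and y when r is odd.
    module t≡3 (t≡3 : t ≡ 3) where

      PQ : ∀ {i j x} → i ≤ r → j ≤ ℓ → Adj G (path p i) x → Adj G (path q j) x → i + j ≤ 2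
      PQ {i} {j} i≤r j≤ℓ a b with PQ-common i≤r j≤ℓ a b
      ... | inj₁ (_ , h) = linear 3 (λ i j t → i ⊕ j ⊕ t ≼ # 5 ⇒ t ≋ # 3 ⇒ ⊢ i ⊕ j ≼ # 2) i j t h t≡3
      ... | inj₂ (_ , h) = ⊥-elim (linear 3 (λ i j t → t ⊕ j ⊕ # 1 ≼ i ⇒ t ≋ # 3 ⇒ i ≼ # 2 ⊕ j ⇒ absurd) i j t h t≡3
                             (level-gap q p j≤ℓ i≤r b a))

      PQ-shifted : ∀ {a c i j x} → 3 ≤ a + c → a ≤ i → c ≤ j → i ≤ r → j ≤ ℓ → Adj G (path p i) x → Adj G (path q j) x → ⊥
      PQ-shifted {a} {c} {i} {j} h a≤i c≤j i≤r j≤ℓ e f =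
        linear 4 (λ a c i j → # 3 ≼ a ⊕ c ⇒ a ≼ i ⇒ c ≼ j ⇒ i ⊕ j ≼ # 2 ⇒ absurd) a c i j h a≤i c≤j (PQ i≤r j≤ℓ e f)

      -- P is used from index a with phase s, Q from index c with phase s′. With a + c ≥ 3 the paths
      -- share no neighbours; the phases are chosen so that the pattern continues across v₀ when
      -- indices on Q count negatively.
      Ok : ℕ → ℕ → ℕ → ℕ → Item → Set
      Ok s a s′ c (P i) = Selected s i × a ≤ i × i ≤ r
      Ok s a s′ c (Q j) = Selected s′ j × c ≤ j × j ≤ ℓ
      Ok s a s′ c _     = ⊥

      noPair : ∀ s a s′ c → 3 ≤ a + c → ∀ x → WithExtras.NoPair v₀ v₀ (Ok s a s′ c) x
      noPair s a s′ c h x {P i} {P j} (si , _ , oi) (sj , _ , oj) i<j e f with two-apart p i<j oj e f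
      ... | refl = selected-apart s i si sj
      noPair s a s′ c h x {P i} {Q j} (si , a≤i , oi) (sj , c≤j , oj) _ e f = PQ-shifted h a≤i c≤j oi oj e f
      noPair s a s′ c h x {Q i} {Q j} (si , _ , oi) (sj , _ , oj) i<j e f with two-apart q i<j oj e f
      ... | refl = selected-apart s′ i si sj

      bound₀ : ∀ m → r ≡ 4 * m → r * δ ≤ n
      bound₀ m r≡ = WithExtras.sparse-bound v₀ v₀ {Ok 1 3 0 0} {x = none}
        (All.map (λ {i} (si , l , u) → si , l , linear 3 (λ i r m → # 4 ⊕ i ≼ # 4 ⊕ 4 ⊛ m ⇒ r ≋ 4 ⊛ m ⇒ ⊢ i ≼ r) i r m u r≡)
          (steps-all {Selected 1} (λ _ h → h) m (lit 3 4) tt tt))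
        (All.map (λ {j} (sj , l , u) → sj , l , linear 5 (λ j r m ℓ t → # 4 ⊕ j ≼ # 1 ⊕ 4 ⊛ m ⇒ r ≋ 4 ⊛ m ⇒ ℓ ⊕ t ≋ r ⇒ t ≋ # 3 ⇒ ⊢ j ≼ ℓ) j r m ℓ t u r≡ ℓ+t t≡3)
          (steps-all {Selected 0} (λ _ h → h) m (lit 0 1) tt tt))
        [] (steps-sorted m (lit 4 4) (lit 5 7)) (steps-sorted m (lit 1 1) (lit 2 4)) size (noPair 1 3 0 0 (lit 3 3))
        where
        size : length (steps 3 4 m) + (length (steps 0 1 m) + 0) ≡ r
        size rewrite length-steps 3 4 m | length-steps 0 1 m =
          linear 2 (λ m r → r ≋ 4 ⊛ m ⇒ ⊢ m ⊕ m ⊕ (m ⊕ m ⊕ # 0) ≋ r) m r r≡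

      bound₂ : ∀ m → r ≡ 2 + 4 * m → r * δ ≤ n
      bound₂ m r≡ = WithExtras.sparse-bound v₀ v₀ {Ok 3 1 2 2} {x = none}
        (All.map (λ {i} (si , l , u) → si , l , linear 3 (λ i r m → # 4 ⊕ i ≼ # 2 ⊕ 4 ⊛ (# 1 ⊕ m) ⇒ r ≋ # 2 ⊕ 4 ⊛ m ⇒ ⊢ i ≼ r) i r m u r≡)
          (steps-all {Selected 3} (λ _ h → h) (suc m) (lit 1 2) tt tt))
        (All.map (λ {j} (sj , l , u) → sj , l , linear 5 (λ j r m ℓ t → # 4 ⊕ j ≼ # 3 ⊕ 4 ⊛ m ⇒ r ≋ # 2 ⊕ 4 ⊛ m ⇒ ℓ ⊕ t ≋ r ⇒ t ≋ # 3 ⇒ ⊢ j ≼ ℓ) j r m ℓ t u r≡ ℓ+t t≡3)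
          (steps-all {Selected 2} (λ _ h → h) m (lit 2 3) tt tt))
        [] (steps-sorted (suc m) (lit 2 2) (lit 3 5)) (steps-sorted m (lit 3 3) (lit 4 6)) size (noPair 3 1 2 2 (lit 3 3))
        where
        size : length (steps 1 2 (suc m)) + (length (steps 2 3 m) + 0) ≡ r
        size rewrite length-steps 5 6 m | length-steps 2 3 m =
          linear 2 (λ m r → r ≋ # 2 ⊕ 4 ⊛ m ⇒ ⊢ # 2 ⊕ (m ⊕ m ⊕ (m ⊕ m ⊕ # 0)) ≋ r) m r r≡

      module t≡3-WithY (y : V) (y-far : r ≤ dist (path p 1) y) where

        open WithY y y-far

        QY-end : ∀ {j x} → j ≤ ℓ → Adj G (path q j) x → Adj G y x → Adj G w x
        QY-end {j} j≤ℓ a b with linear 4 (λ j ℓ t r → r ≼ # 3 ⊕ j ⇒ ℓ ⊕ t ≋ r ⇒ t ≋ # 3 ⇒ j ≼ ℓ ⇒ ⊢ j ≋ ℓ) j ℓ t r (QY-common j≤ℓ a b) ℓ+t t≡3 j≤ℓ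
        ... | refl = a

        y≁P : ∀ {i} → i ≤ r → 2 + i ≤ r → Adj G (path p i) y → ⊥
        y≁P {zero}  i≤r _ a = linear 1 (λ r → r ≼ # 2 ⇒ # 4 ≼ r ⇒ absurd) r (YQ-close p i≤r (dist-adj a)) 4≤r
        y≁P {suc i} i≤r h a = linear 2 (λ i r → # 1 ⊕ r ≼ # 1 ⊕ i ⊕ # 1 ⇒ # 3 ⊕ i ≼ r ⇒ absurd) i r (YP-close (s≤s z≤n) i≤r (dist-adj a)) h

        y≁Q : ∀ {j} → j ≤ ℓ → Adj G (path q j) y → ⊥
        y≁Q {j} j≤ℓ a = linear 4 (λ j ℓ t r → r ≼ # 1 ⊕ (j ⊕ # 1) ⇒ ℓ ⊕ t ≋ r ⇒ t ≋ # 3 ⇒ j ≼ ℓ ⇒ absurd) j ℓ t r (YQ-close q j≤ℓ (dist-adj a)) ℓ+t t≡3 j≤ℓ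

        -- y can share neighbours only with the last two vertices of P, which are not selected, and
        -- with w, which is excluded here. So y can be the last of the r vertices; being adjacent to
        -- none of them, it also makes the count strict.
        module NoBridge (noBridge : ∀ {x} → Adj G y x → Adj G w x → ⊥) where

          open WithExtras y y using () renaming (NoPair to NoPairY; _∼_ to _∼ʸ_; sparse-bound-< to sparse-bound-<ʸ)

          OkY : ℕ → ℕ → ℕ → ℕ → Item → Set
          OkY s a s′ c (P i) = Selected s i × a ≤ i × 2 + i ≤ r
          OkY s a s′ c (Q j) = Selected s′ j × c ≤ j × j ≤ ℓ
          OkY s a s′ c Y     = ⊤
          OkY s a s′ c Z     = ⊥

          noPairY : ∀ s a s′ c → 3 ≤ a + c → ∀ x → NoPairY (OkY s a s′ c) x
          noPairY s a s′ c h x {P i} {P j} (si , li , oi) (sj , lj , oj) i<j e f =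
            noPair s a s′ c h x {P i} {P j} (si , li , m+n≤o⇒n≤o 2 oi) (sj , lj , m+n≤o⇒n≤o 2 oj) i<j e f
          noPairY s a s′ c h x {P i} {Q j} (si , li , oi) oj _ e f =
            noPair s a s′ c h x {P i} {Q j} (si , li , m+n≤o⇒n≤o 2 oi) oj tt e f
          noPairY s a s′ c h x {P i} {Y} (si , li , oi) _ _ e f =
            linear 2 (λ i r → r ≼ # 1 ⊕ i ⇒ # 2 ⊕ i ≼ r ⇒ absurd) i r (PY-common (m+n≤o⇒n≤o 2 oi) e f) oi
          noPairY s a s′ c h x {Q i} {Q j} oi oj i<j e f = noPair s a s′ c h x {Q i} {Q j} oi oj i<j e f
          noPairY s a s′ c h x {Q j} {Y} (sj , lj , oj) _ _ e f = noBridge f (QY-end oj e f)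

          isolated : ∀ s a s′ c {b} → OkY s a s′ c b → b ∼ʸ y → ⊥
          isolated s a s′ c {P i} (_ , _ , oi) e = y≁P (m+n≤o⇒n≤o 2 oi) oi e
          isolated s a s′ c {Q j} (_ , _ , oj) e = y≁Q oj e
          isolated s a s′ c {Y}   _ e = irreflexive e

          bound₁ : ∀ m → r ≡ 1 + 4 * m → r * δ < n
          bound₁ m r≡ = sparse-bound-<ʸ {OkY 2 2 3 1} {x = justY}
            (All.map (λ {i} (si , l , u) → si , l , linear 3 (λ i r m → # 4 ⊕ i ≼ # 3 ⊕ 4 ⊛ m ⇒ r ≋ # 1 ⊕ 4 ⊛ m ⇒ ⊢ # 2 ⊕ i ≼ r) i r m u r≡)
              (steps-all {Selected 2} (λ _ h → h) m (lit 2 3) tt tt))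
            (All.map (λ {j} (sj , l , u) → sj , l , linear 5 (λ j r m ℓ t → # 4 ⊕ j ≼ # 2 ⊕ 4 ⊛ m ⇒ r ≋ # 1 ⊕ 4 ⊛ m ⇒ ℓ ⊕ t ≋ r ⇒ t ≋ # 3 ⇒ ⊢ j ≼ ℓ) j r m ℓ t u r≡ ℓ+t t≡3)
              (steps-all {Selected 3} (λ _ h → h) m (lit 1 2) tt tt))
            (tt ∷ []) (steps-sorted m (lit 3 3) (lit 4 6)) (steps-sorted m (lit 2 2) (lit 3 5)) size (noPairY 2 2 3 1 (lit 3 3)) y (isolated 2 2 3 1)
            where
            size : length (steps 2 3 m) + (length (steps 1 2 m) + 1) ≡ r
            size rewrite length-steps 2 3 m | length-steps 1 2 m =
              linear 2 (λ m r → r ≋ # 1 ⊕ 4 ⊛ m ⇒ ⊢ m ⊕ m ⊕ (m ⊕ m ⊕ # 1) ≋ r) m r r≡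

          bound₃ : ∀ m → r ≡ 3 + 4 * m → r * δ < n
          bound₃ m r≡ = sparse-bound-<ʸ {OkY 0 0 1 3} {x = justY}
            (All.map (λ {i} (si , l , u) → si , l , linear 3 (λ i r m → # 4 ⊕ i ≼ # 1 ⊕ 4 ⊛ (# 1 ⊕ m) ⇒ r ≋ # 3 ⊕ 4 ⊛ m ⇒ ⊢ # 2 ⊕ i ≼ r) i r m u r≡)
              (steps-all {Selected 0} (λ _ h → h) (suc m) (lit 0 1) tt tt))
            (All.map (λ {j} (sj , l , u) → sj , l , linear 5 (λ j r m ℓ t → # 4 ⊕ j ≼ # 4 ⊕ 4 ⊛ m ⇒ r ≋ # 3 ⊕ 4 ⊛ m ⇒ ℓ ⊕ t ≋ r ⇒ t ≋ # 3 ⇒ ⊢ j ≼ ℓ) j r m ℓ t u r≡ ℓ+t t≡3)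
              (steps-all {Selected 1} (λ _ h → h) m (lit 3 4) tt tt))
            (tt ∷ []) (steps-sorted (suc m) (lit 1 1) (lit 2 4)) (steps-sorted m (lit 4 4) (lit 5 7)) size (noPairY 0 0 1 3 (lit 3 3)) y (isolated 0 0 1 3)
            where
            size : length (steps 0 1 (suc m)) + (length (steps 3 4 m) + 1) ≡ r
            size rewrite length-steps 4 5 m | length-steps 3 4 m =
              linear 2 (λ m r → r ≋ # 3 ⊕ 4 ⊛ m ⇒ ⊢ # 2 ⊕ (m ⊕ m ⊕ (m ⊕ m ⊕ # 1)) ≋ r) m r r≡

        module Bridge (5≤r : 5 ≤ r) {z} (y∼z : Adj G y z) (w∼z : Adj G w z) where

          open WithExtras y z

          2≤ℓ : 2 ≤ ℓ
          2≤ℓ = linear 3 (λ ℓ t r → ℓ ⊕ t ≋ r ⇒ t ≋ # 3 ⇒ # 5 ≼ r ⇒ ⊢ # 2 ≼ ℓ) ℓ t r ℓ+t t≡3 5≤r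

          to-y : ∀ {v x} → Adj G v x → Adj G z x → dist v y ≤ 3
          to-y a b = dist≤walk (step a (step (adj-sym G b) (step (adj-sym G y∼z) here)))

          to-w : ∀ {v x} → Adj G v x → Adj G z x → dist v w ≤ 3
          to-w a b = dist≤walk (step a (step (adj-sym G b) (step (adj-sym G w∼z) here)))

          -- P_i is within 3 of both y and w. Since r ≥ 5, closeness to y forces i ≥ 3, and
          -- closeness to w then forces i = r.
          PZ : ∀ {i x} → i ≤ r → Adj G (path p i) x → Adj G z x → i ≡ r
          PZ {zero}  i≤r a b = ⊥-elim (<⇒≱ 5≤r (YQ-close p i≤r (to-y a b)))
          PZ {suc i} i≤r a b = linear 4 (λ i ℓ t r → t ⊕ ℓ ⊕ # 3 ≼ # 1 ⊕ i ⊕ # 3 ⇒ ℓ ⊕ t ≋ r ⇒ # 1 ⊕ i ≼ r ⇒ ⊢ # 1 ⊕ i ≋ r) i ℓ t r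
            (PQ-after 3≤1+i i≤r ≤-refl (to-w a b)) ℓ+t i≤r
            where
            3≤1+i : 3 ≤ suc i
            3≤1+i = linear 2 (λ i r → # 1 ⊕ r ≼ # 1 ⊕ i ⊕ # 3 ⇒ # 5 ≼ r ⇒ ⊢ # 3 ≼ # 1 ⊕ i) i r (YP-close (s≤s z≤n) i≤r (to-y a b)) 5≤r

          QZ : ∀ {j x} → j ≤ ℓ → Adj G (path q j) x → Adj G z x → suc j ≡ ℓ
          QZ {j} j≤ℓ a b with m≤n⇒m<n∨m≡n j≤ℓ
          ... | inj₁ j<ℓ  = linear 4 (λ j ℓ t r → r ≼ # 1 ⊕ (j ⊕ # 3) ⇒ ℓ ⊕ t ≋ r ⇒ t ≋ # 3 ⇒ # 1 ⊕ j ≼ ℓ ⇒ ⊢ # 1 ⊕ j ≋ ℓ) j ℓ t r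
                              (YQ-close q j≤ℓ (to-y a b)) ℓ+t t≡3 j<ℓ
          ... | inj₂ refl = ⊥-elim (noTriangle w∼z b a)

          QY : ∀ {j x} → j ≤ ℓ → Adj G (path q j) x → Adj G y x → j ≡ ℓ
          QY {j} j≤ℓ a b = linear 4 (λ j ℓ t r → r ≼ # 3 ⊕ j ⇒ ℓ ⊕ t ≋ r ⇒ t ≋ # 3 ⇒ j ≼ ℓ ⇒ ⊢ j ≋ ℓ) j ℓ t r (QY-common j≤ℓ a b) ℓ+t t≡3 j≤ℓ

          z≁end : Adj G z (path p r) → ⊥
          z≁end a = linear 3 (λ ℓ t r → t ⊕ ℓ ⊕ # 3 ≼ r ⊕ # 2 ⇒ ℓ ⊕ t ≋ r ⇒ absurd) ℓ t r
            (PQ-after 3≤r ≤-refl ≤-refl (dist-common (adj-sym G a) w∼z)) ℓ+t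

          noTriple : ∀ x → NoTripleAt both x
          noTriple x {P i} {P j} {P k} oi oj ok i<j i<k j<k a b c = no-three p oj ok i<j j<k a b c
          noTriple x {P i} {P j} {Q k} oi oj (1≤k , ok) i<j _ _ a b c =
            linear 3 (λ i j k → j ≋ # 2 ⊕ i ⇒ j ⊕ k ≼ # 2 ⇒ # 1 ≼ k ⇒ absurd) i j k (two-apart p i<j oj a b) (PQ oj ok b c) 1≤k
          noTriple x {P i} {P j} {Y} oi oj _ i<j _ _ a b c =
            linear 3 (λ i j r → j ≋ # 2 ⊕ i ⇒ j ≼ r ⇒ r ≼ # 1 ⊕ i ⇒ absurd) i j r (two-apart p i<j oj a b) oj (PY-common oi a c)
          noTriple x {P i} {P j} {Z} oi oj _ i<j _ _ a b c = <⇒≢ i<j (trans (PZ oi a c) (sym (PZ oj b c)))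
          noTriple x {P i} {Q j} {Q k} oi (1≤j , oj) (1≤k , ok) _ _ j<k a b c =
            linear 3 (λ i j k → k ≋ # 2 ⊕ j ⇒ i ⊕ k ≼ # 2 ⇒ # 1 ≼ j ⇒ absurd) i j k (two-apart q j<k ok b c) (PQ oi ok a c) 1≤j
          noTriple x {P i} {Q j} {Y} oi (1≤j , oj) _ _ _ _ a b c =
            linear 3 (λ i j r → i ⊕ j ≼ # 2 ⇒ # 1 ≼ j ⇒ r ≼ # 1 ⊕ i ⇒ # 4 ≼ r ⇒ absurd) i j r (PQ oi oj a b) 1≤j (PY-common oi a c) 4≤r
          noTriple x {P i} {Q j} {Z} oi (1≤j , oj) _ _ _ _ a b c =
            linear 3 (λ i j r → i ⊕ j ≼ # 2 ⇒ i ≋ r ⇒ # 4 ≼ r ⇒ absurd) i j r (PQ oi oj a b) (PZ oi a c) 4≤r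
          noTriple x {P i} {Y} {Z} oi _ _ _ _ _ a b c = noTriangle y∼z c b
          noTriple x {Q i} {Q j} {Q k} (_ , oi) (_ , oj) (_ , ok) i<j i<k j<k a b c = no-three q oj ok i<j j<k a b c
          noTriple x {Q i} {Q j} {Y} (_ , oi) (_ , oj) _ i<j _ _ a b c = <⇒≢ i<j (trans (QY oi a c) (sym (QY oj b c)))
          noTriple x {Q i} {Q j} {Z} (_ , oi) (_ , oj) _ i<j _ _ a b c = <⇒≢ i<j (suc-injective (trans (QZ oi a c) (sym (QZ oj b c))))
          noTriple x {Q i} {Y} {Z} _ _ _ _ _ _ a b c = noTriangle y∼z c b

          open-bound : ¬ Adj G y (path p r) → r * δ < n
          open-bound y≁ = paths-bound both (linear 3 (λ ℓ t r → ℓ ⊕ t ≋ r ⇒ t ≋ # 3 ⇒ ⊢ # 1 ⊕ (ℓ ⊕ # 2) ≋ r) ℓ t r ℓ+t t≡3)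
            noTriple (path p r) (end-noPair both (≤-trans (s≤s z≤n) (≤-reflexive (sym t≡3))) 2≤ℓ (λ _ → y≁) (λ _ → z≁end))

          -- P, y, z and Q now close up to a cycle of length 2r, and no vertex is adjacent to two
          -- vertices of this cycle at odd distance along it; each parity class needs ⌈rδ/2⌉ vertices.
          module Closed (y∼end : Adj G y (path p r)) (h : ℕ) (r≡ : r ≡ suc (2 * suc h)) where

            ℓ≡ : ℓ ≡ 2 * h
            ℓ≡ = linear 4 (λ ℓ t r h → ℓ ⊕ t ≋ r ⇒ t ≋ # 3 ⇒ r ≋ # 1 ⊕ 2 ⊛ (# 1 ⊕ h) ⇒ ⊢ ℓ ≋ 2 ⊛ h) ℓ t r h ℓ+t t≡3 r≡

            Even : ℕ → Set
            Even i = ∃[ m ] i ≡ 2 * m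

            clash : ∀ {i j} → Even i → Odd j → i ≡ j → ⊥
            clash (m , refl) (m′ , refl) eq = even≢odd m m′ eq

            clash-two : ∀ {i j} → Even i → Odd j → j ≡ 2 + i → ⊥
            clash-two (m , refl) (m′ , refl) eq = even≢odd (suc m) m′
              (trans (linear 1 (λ m → ⊢ 2 ⊛ (# 1 ⊕ m) ≋ # 2 ⊕ 2 ⊛ m) m) (sym eq))

            clash-two′ : ∀ {i j} → Even i → Odd j → i ≡ 2 + j → ⊥
            clash-two′ (m , refl) (m′ , refl) eq = even≢odd m (suc m′)
              (trans eq (linear 1 (λ m → ⊢ # 3 ⊕ 2 ⊛ m ≋ # 1 ⊕ 2 ⊛ (# 1 ⊕ m)) m′))

            path-clash : ∀ {u k} (g : Geodesic u k) {i j x} → i ≤ k → j ≤ k → Even i → Odd j → Adj G (path g i) x → Adj G (path g j) x → ⊥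
            path-clash g {i} {j} i≤k j≤k ei oj a b with <-cmp i j
            ... | tri< i<j _ _ = clash-two ei oj (two-apart g i<j j≤k a b)
            ... | tri≈ _ eq _  = clash ei oj eq
            ... | tri> _ _ j<i = clash-two′ ei oj (two-apart g j<i i≤k b a)

            -- The cyclic order is P_0, ..., P_r, y, z, w, ..., Q_1. As r is odd and ℓ even, y
            -- belongs to the even class and z to the odd one.
            OkE OkO : Item → Set
            OkE (P i) = i ≤ r × Even i
            OkE (Q j) = 2 ≤ j × j ≤ ℓ × Even j
            OkE Y     = ⊤
            OkE Z     = ⊥
            OkO (P i) = i ≤ r × Odd i
            OkO (Q j) = 1 ≤ j × j ≤ ℓ × Odd j
            OkO Y     = ⊥
            OkO Z     = ⊤

            -- Every admissible sharing joins equal parities: indices differ by 2 within a path;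
            -- between the paths there remain only P_0 with Q_2 and P_1 with Q_1; y shares only with
            -- w and the predecessor of P_r, since P_r is its neighbour; z shares only with P_r and
            -- the predecessor of w.
            disjoint : ∀ x {a b} → OkE a → OkO b → a ∼ x → b ∼ x → ⊥
            disjoint x {P i} {P j} (oi , ei) (oj , ej) a b = path-clash p oi oj ei ej a b
            disjoint x {P 0} {Q 1} (oi , ei) (_ , oj , ej) a b = P₀Q₁ oj a b
            disjoint x {P 0} {Q 2} (oi , ei) (_ , oj , ej) a b = clash (1 , refl) ej refl
            disjoint x {P 0} {Q (suc (suc (suc j)))} (oi , ei) (_ , oj , ej) a b = <⇒≱ (lit 3 3) (≤-trans (m≤m+n 3 j) (PQ oi oj a b))
            disjoint x {P 1} {Q j} (oi , ei) (_ , oj , ej) a b = clash ei (0 , refl) refl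
            disjoint x {P (suc (suc i))} {Q j} (oi , ei) (1≤j , oj , ej) a b =
              linear 2 (λ i j → # 2 ⊕ i ⊕ j ≼ # 2 ⇒ # 1 ≼ j ⇒ absurd) i j (PQ oi oj a b) 1≤j
            disjoint x {P i} {Z} (oi , ei) _ a b = clash ei (suc h , r≡) (PZ oi a b)
            disjoint x {Q i} {P 0} (2≤i , oi , ei) (oj , ej) a b = clash (0 , refl) ej refl
            disjoint x {Q i} {P (suc j)} (2≤i , oi , ei) (oj , ej) a b =
              linear 2 (λ i j → # 1 ⊕ j ⊕ i ≼ # 2 ⇒ # 2 ≼ i ⇒ absurd) i j (PQ oj oi b a) 2≤i
            disjoint x {Q i} {Q j} (_ , oi , ei) (_ , oj , ej) a b = path-clash q oi oj ei ej a b
            disjoint x {Q i} {Z} (_ , oi , (m , refl)) _ a b = even≢odd h m (trans (sym ℓ≡) (sym (QZ oi a b)))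
            disjoint x {Y} {P j} _ (oj , ej) a b with m≤n⇒m<n∨m≡n oj
            ... | inj₂ refl = noTriangle y∼end b a
            ... | inj₁ j<r  = clash (suc h , refl) ej
                                (suc-injective (trans (sym r≡) (≤-antisym (PY-common oj b a) j<r)))
            disjoint x {Y} {Q j} _ (_ , oj , ej) a b = clash (h , ℓ≡) ej (sym (QY oj b a))
            disjoint x {Y} {Z} _ _ a b = noTriangle y∼z b a

            evens odds : List Item
            evens = items (applyUpTo (λ i → 2 * i) (2 + h)) (applyUpTo (λ j → 2 * suc j) h) justY
            odds  = items (applyUpTo (λ i → suc (2 * i)) (2 + h)) (applyUpTo (λ j → suc (2 * j)) h) justZ

            ok-evens : All OkE evens
            ok-evens = items-all {OkE} {x = justY}
              (applyUpTo-all _ (2 + h) λ i i<2+h → linear 3 (λ i h r → # 1 ⊕ i ≼ # 2 ⊕ h ⇒ r ≋ # 1 ⊕ 2 ⊛ (# 1 ⊕ h) ⇒ ⊢ 2 ⊛ i ≼ r) i h r i<2+h r≡ , i , refl)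
              (applyUpTo-all _ h λ j j<h → linear 1 (λ j → ⊢ # 2 ≼ 2 ⊛ (# 1 ⊕ j)) j ,
                linear 3 (λ j h ℓ → # 1 ⊕ j ≼ h ⇒ ℓ ≋ 2 ⊛ h ⇒ ⊢ 2 ⊛ (# 1 ⊕ j) ≼ ℓ) j h ℓ j<h ℓ≡ , suc j , refl)
              (tt ∷ [])

            ok-odds : All OkO odds
            ok-odds = items-all {OkO} {x = justZ}
              (applyUpTo-all _ (2 + h) λ i i<2+h → linear 3 (λ i h r → # 1 ⊕ i ≼ # 2 ⊕ h ⇒ r ≋ # 1 ⊕ 2 ⊛ (# 1 ⊕ h) ⇒ ⊢ # 1 ⊕ 2 ⊛ i ≼ r) i h r i<2+h r≡ , i , refl)
              (applyUpTo-all _ h λ j j<h → s≤s z≤n ,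
                linear 3 (λ j h ℓ → # 1 ⊕ j ≼ h ⇒ ℓ ≋ 2 ⊛ h ⇒ ⊢ # 1 ⊕ 2 ⊛ j ≼ ℓ) j h ℓ j<h ℓ≡ , j , refl)
              (tt ∷ [])

            E⇒path : ∀ {a} → OkE a → OkPath both a
            E⇒path {P i} (oi , _) = oi
            E⇒path {Q j} (2≤j , oj , _) = <⇒≤ 2≤j , oj
            E⇒path {Y} _ = tt

            O⇒path : ∀ {a} → OkO a → OkPath both a
            O⇒path {P i} (oi , _) = oi
            O⇒path {Q j} (1≤j , oj , _) = 1≤j , oj
            O⇒path {Z} _ = tt

            sorted-evens : AllPairs _⊏_ evens
            sorted-evens = items-sorted (applyUpTo-sorted _ (2 + h) (*-monoʳ-< 2)) (applyUpTo-sorted _ h λ i<j → *-monoʳ-< 2 (s≤s i<j)) justY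

            sorted-odds : AllPairs _⊏_ odds
            sorted-odds = items-sorted (applyUpTo-sorted _ (2 + h) (λ i<j → s≤s (*-monoʳ-< 2 i<j))) (applyUpTo-sorted _ h λ i<j → s≤s (*-monoʳ-< 2 i<j)) justZ

            size : ∀ f g x → length (extras x) ≡ 1 → length (items (applyUpTo f (2 + h)) (applyUpTo g h) x) ≡ r
            size f g x eq = trans (length-items (applyUpTo f (2 + h)) (applyUpTo g h) x)
              (trans (cong₂ _+_ (length-applyUpTo f (2 + h)) (cong₂ _+_ (length-applyUpTo g h) eq))
                (linear 2 (λ h r → r ≋ # 1 ⊕ 2 ⊛ (# 1 ⊕ h) ⇒ ⊢ # 2 ⊕ h ⊕ (h ⊕ # 1) ≋ r) h r r≡))

            coveredE coveredO : V → Bool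
            coveredE = covered (All.map E⇒path ok-evens) sorted-evens
            coveredO = covered (All.map O⇒path ok-odds) sorted-odds

            A B : ℕ
            A = count coveredE (allFin n)
            B = count coveredO (allFin n)

            R≤2A : r * δ ≤ 2 * A
            R≤2A = subst (λ m → m * δ ≤ 2 * A) (size (λ i → 2 * i) (λ j → 2 * suc j) justY refl)
              (covering₂ (All.map E⇒path ok-evens) sorted-evens noTriple)

            R≤2B : r * δ ≤ 2 * B
            R≤2B = subst (λ m → m * δ ≤ 2 * B) (size (λ i → suc (2 * i)) (λ j → suc (2 * j)) justZ refl)
              (covering₂ (All.map O⇒path ok-odds) sorted-odds noTriple)

            A+B≤n : A + B ≤ n
            A+B≤n = ≤-trans (count-disjoint coveredE coveredO apart (allFin n)) (≤-reflexive (length-tabulate {n = n} λ i → i))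
              where
              apart : ∀ x → T (coveredE x) → T (coveredO x) → ⊥
              apart x e o with count-witness-all (λ a → adj G (vertex a) x) ok-evens (≤ᵇ⇒≤ 1 _ e)
                              | count-witness-all (λ a → adj G (vertex a) x) ok-odds (≤ᵇ⇒≤ 1 _ o)
              ... | a , oa , ax | b , ob , bx = disjoint x oa ob ax bx

            closed-bound : r * δ ≤ n
            closed-bound = linear 4 (λ R A B n → R ≼ 2 ⊛ A ⇒ R ≼ 2 ⊛ B ⇒ A ⊕ B ≼ n ⇒ ⊢ R ≼ n) (r * δ) A B n R≤2A R≤2B A+B≤n

            closed-bound-< : Odd (r * δ) → r * δ < n
            closed-bound-< (c , rδ≡) = linear 5 (λ R A B c n → A ⊕ B ≼ n ⇒ R ≋ # 1 ⊕ 2 ⊛ c ⇒ # 1 ⊕ c ≼ A ⇒ # 1 ⊕ c ≼ B ⇒ ⊢ # 1 ⊕ R ≼ n)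
                (r * δ) A B c n A+B≤n rδ≡ (half A R≤2A) (half B R≤2B)
              where
              half : ∀ X → r * δ ≤ 2 * X → suc c ≤ X
              half X le = *-cancelˡ-< 2 c X (≤-trans (≤-reflexive (sym rδ≡)) le)

    -- Case distinction on t and on r modulo 4

    module Cases (gain : ∀ u → dist u (path p r) < r → ∃[ w ] (r ≤ dist u w × dist v₀ w < r))
        {y} (y-far : r ≤ dist (path p 1) y) where

      twice-twice : ∀ m → 4 * m ≡ 2 * (2 * m)
      twice-twice = linear 1 λ m → ⊢ 4 ⊛ m ≋ 2 ⊛ (2 ⊛ m)

      result₁ : t ≡ 1 → Bound
      result₁ t≡1 with any? (λ u → T? (adj G (path p 0) u) ×-dec (dist u (path q 3) ≤? 2 ×-dec dist u (path p 4) ≤? 3))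
      ... | no unshared = strictly (Unshared.bound λ u shared → unshared (u , shared))
        where open t≡1 t≡1
      ... | yes (u , shared@(_ , _ , near)) with residue₄ r
      ... | m , inj₁ r≡               = evenly (2 * m) (trans r≡ (twice-twice m)) (t≡1.bound₀ t≡1 m r≡)
      ... | m , inj₂ (inj₁ r≡)        = strictly (t≡1.bound₁ t≡1 m r≡)
      ... | m , inj₂ (inj₂ (inj₁ r≡)) = evenly (suc (2 * m)) (trans r≡ (linear 1 (λ m → ⊢ # 2 ⊕ 4 ⊛ m ≋ 2 ⊛ (# 1 ⊕ 2 ⊛ m)) m)) (t≡1.bound₂ t≡1 m r≡)
      ... | m , inj₂ (inj₂ (inj₂ r≡)) = strictly (t≡1.Apex.bound t≡1 shared (proj₁ (proj₂ gained)) m r≡)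
        where
        -- u reaches P_r through P_4 in at most 3 + (r - 4) steps, so the choice of v₀ applies to u.
        gained = gain u (linear 4 (λ r A B C → A ≼ B ⊕ C ⇒ B ≼ # 3 ⇒ C ⊕ # 4 ≼ r ⇒ ⊢ # 1 ⊕ A ≼ r) r _ _ _
                   (dist-triangle u (path p 4) (path p r)) near (between p 4≤r ≤-refl))

      odd⇒5≤r : ∀ h → r ≡ suc (2 * suc h) → 5 ≤ r
      odd⇒5≤r zero    r≡ = ⊥-elim (<⇒≱ 4≤r (≤-reflexive r≡))
      odd⇒5≤r (suc h) r≡ = linear 2 (λ h r → r ≋ # 1 ⊕ 2 ⊛ (# 2 ⊕ h) ⇒ ⊢ # 5 ≼ r) h r r≡

      result₃-odd : t ≡ 3 → ∀ h → r ≡ suc (2 * suc h) →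
        (∀ (noBridge : ∀ {x} → Adj G y x → Adj G w x → ⊥) → r * δ < n) → Bound
      result₃-odd t≡3 h r≡ otherwise with any? (λ z → T? (adj G y z) ×-dec T? (adj G w z))
      ... | no noBridge = strictly (otherwise λ a b → noBridge (_ , a , b))
      ... | yes (z , y∼z , w∼z) with T? (adj G y (path p r))
      ... | no y≁  = strictly (t≡3.t≡3-WithY.Bridge.open-bound t≡3 y y-far (odd⇒5≤r h r≡) y∼z w∼z y≁)
      ... | yes y∼ = closed-bound , λ r-odd δ-odd → closed-bound-< (*-odd r-odd δ-odd)
        where open t≡3.t≡3-WithY.Bridge.Closed t≡3 y y-far (odd⇒5≤r h r≡) y∼z w∼z y∼ h r≡

      result₃ : t ≡ 3 → Bound
      result₃ t≡3 with residue₄ r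
      ... | m , inj₁ r≡               = evenly (2 * m) (trans r≡ (twice-twice m)) (t≡3.bound₀ t≡3 m r≡)
      ... | m , inj₂ (inj₂ (inj₁ r≡)) = evenly (suc (2 * m)) (trans r≡ (linear 1 (λ m → ⊢ # 2 ⊕ 4 ⊛ m ≋ 2 ⊛ (# 1 ⊕ 2 ⊛ m)) m)) (t≡3.bound₂ t≡3 m r≡)
      ... | zero , inj₂ (inj₁ r≡) = ⊥-elim (<⇒≱ 4≤r (≤-trans (≤-reflexive r≡) (lit 1 3)))
      ... | suc m , inj₂ (inj₁ r≡) = result₃-odd t≡3 (suc (2 * m)) (trans r≡ (linear 1 (λ m → ⊢ # 1 ⊕ 4 ⊛ (# 1 ⊕ m) ≋ # 1 ⊕ 2 ⊛ (# 2 ⊕ 2 ⊛ m)) m))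
          λ noBridge → t≡3.t≡3-WithY.NoBridge.bound₁ t≡3 y y-far noBridge (suc m) r≡
      ... | m , inj₂ (inj₂ (inj₂ r≡)) = result₃-odd t≡3 (2 * m) (trans r≡ (linear 1 (λ m → ⊢ # 3 ⊕ 4 ⊛ m ≋ # 1 ⊕ 2 ⊛ (# 1 ⊕ 2 ⊛ m)) m))
          λ noBridge → t≡3.t≡3-WithY.NoBridge.bound₃ t≡3 y y-far noBridge m r≡

      dichotomy : 1 ≤ t → t ≤ 3 → Bound
      dichotomy 1≤t t≤3 with m≤n⇒m<n∨m≡n t≤3
      ... | inj₂ t≡3 = result₃ t≡3
      ... | inj₁ t<3 with m≤n⇒m<n∨m≡n (s≤s⁻¹ t<3)
      ... | inj₂ t≡2 = strictly (WithY.t≡2.bound y y-far t≡2)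
      ... | inj₁ t<2 = result₁ (≤-antisym (s≤s⁻¹ t<2) 1≤t)

  -- Balance at v₀ puts w closer than r to v₀, hence t ≥ 1; and P_3 is only three steps away from
  -- v₀, hence t ≤ 3.
  radius-bound : V → (∀ v → ∃[ w ] r ≤ dist v w) → Bound
  radius-bound anyVertex eccentric = TwoGeodesics.Cases.dichotomy p q ℓ+t w-far gain (proj₁ (proj₂ gain₁)) 1≤t t≤3
    where
    v₀ : V
    v₀ = proj₁ (balanced-vertex r anyVertex)

    p : Geodesic v₀ r
    p = geodesic v₀ (proj₁ (eccentric v₀)) (proj₂ (eccentric v₀))

    gain : ∀ u → dist u (path p r) < r → ∃[ w ] (r ≤ dist u w × dist v₀ w < r)
    gain u = proj₂ (balanced-vertex r anyVertex) u (path p r) (≤-reflexive (sym (level p r ≤-refl)))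

    ahead-end : ∀ {i} → 1 ≤ i → i ≤ r → dist (path p i) (path p r) < r
    ahead-end {i} 1≤i i≤r = linear 3 (λ i r A → A ⊕ i ≼ r ⇒ # 1 ≼ i ⇒ ⊢ # 1 ⊕ A ≼ r) i r _ (between p i≤r ≤-refl) 1≤i

    gain₃ = gain (path p 3) (ahead-end (lit 1 3) (<⇒≤ 4≤r))
    gain₁ = gain (path p 1) (ahead-end (lit 1 1) (≤-trans (lit 1 4) 4≤r))

    w₃ : V
    w₃ = proj₁ gain₃

    ℓ t : ℕ
    ℓ = dist v₀ w₃
    t = r ∸ ℓ

    q : Geodesic v₀ ℓ
    q = geodesic v₀ w₃ ≤-refl

    ℓ+t : ℓ + t ≡ r
    ℓ+t = m+[n∸m]≡n (<⇒≤ (proj₂ (proj₂ gain₃)))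

    w-far : r ≤ dist (path p 3) (path q ℓ)
    w-far = subst (λ w → r ≤ dist (path p 3) w) (sym (geodesic-end v₀ w₃)) (proj₁ (proj₂ gain₃))

    1≤t : 1 ≤ t
    1≤t = linear 3 (λ ℓ t r → # 1 ⊕ ℓ ≼ r ⇒ ℓ ⊕ t ≋ r ⇒ ⊢ # 1 ≼ t) ℓ t r (proj₂ (proj₂ gain₃)) ℓ+t

    t≤3 : t ≤ 3
    t≤3 = linear 5 (λ ℓ t r A B → r ≼ A ⇒ A ≼ B ⊕ ℓ ⇒ B ≋ # 3 ⇒ ℓ ⊕ t ≋ r ⇒ ⊢ t ≼ # 3) ℓ t r _ _
      (proj₁ (proj₂ gain₃)) (dist-triangle (path p 3) v₀ w₃) (trans (dist-sym _ v₀) (level p 3 (<⇒≤ 4≤r))) ℓ+t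

-- Extremal graphs

count-map : ∀ {A B : Set} (p : B → Bool) (f : A → B) xs → count (λ x → p (f x)) xs ≡ count p (map f xs)
count-map p f []       = refl
count-map p f (x ∷ xs) with p (f x)
... | true  = cong suc (count-map p f xs)
... | false = count-map p f xs

count-++ : ∀ {A : Set} (p : A → Bool) xs ys → count p (xs ++ ys) ≡ count p xs + count p ys
count-++ p []       ys = refl
count-++ p (x ∷ xs) ys with p x
... | true  = cong suc (count-++ p xs ys)
... | false = count-++ p xs ys

module _ {A : Set} (E : A → A → Bool) (L : List A) where

  data LabelWalk : A → A → ℕ → Set where
    nil  : ∀ {a} → LabelWalk a a 0
    cons : ∀ {a b c k} → T (E a b) → b ∈ L → LabelWalk b c k → LabelWalk a c (suc k)

Realised : ℕ → ℕ → ℕ → Set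
Realised n δ R = ∃[ G ] (Admissible {n} G δ × HasRadius G R)

-- Vertices are the positions of L; positions with equal labels are twins.
module BlowUp {A : Set} (E : A → A → Bool) (E-sym : ∀ a b → E a b ≡ E b a)
    (side : A → Bool) (bipartite : ∀ a b → T (E a b) → side b ≡ not (side a)) (L : List A) where

  G : Graph (length L)
  G = record
    { adj    = λ u v → E (lookup L u) (lookup L v)
    ; symm   = λ u v → E-sym (lookup L u) (lookup L v)
    ; irrefl = λ v → loopless (lookup L v) }
    where
    loopless : ∀ a → E a a ≡ false
    loopless a with E a a in eq
    ... | false = refl
    ... | true  = ⊥-elim (not-¬ refl (bipartite a a (subst T (sym eq) tt)))

  deg-labels : ∀ v → deg G v ≡ count (E (lookup L v)) L
  deg-labels v = trans (count-map (E (lookup L v)) (lookup L) (allFin (length L)))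
    (cong (count (E (lookup L v))) (trans (map-tabulate id (lookup L)) (tabulate-lookup L)))

  vertexOf : ∀ {a} → a ∈ L → Fin (length L)
  vertexOf = index

  label-vertexOf : ∀ {a} (a∈L : a ∈ L) → a ≡ lookup L (vertexOf a∈L)
  label-vertexOf = lookup-index

  triangleFree : TriangleFree G
  triangleFree u v w (uv , vw , uw) = 
    not-¬ (trans (bipartite _ _ uw) (sym (bipartite _ _ uv))) (bipartite _ _ vw)

  -- The length must be positive: the empty label walk does not lift when u and v are distinct
  -- twins. This is why `near` below asks for length `suc j`, even back to the central label.
  lift : ∀ k u v → LabelWalk E L (lookup L u) (lookup L v) (suc k) → Walk G u v (suc k)
  lift zero    u v (cons e b∈L nil) = step e here
  lift (suc k) u v (cons e b∈L p)   = step {v = vertexOf b∈L} (subst (λ b → T (E (lookup L u) b)) (label-vertexOf b∈L) e)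
    (lift k (vertexOf b∈L) v (subst (λ b → LabelWalk E L b (lookup L v) _) (label-vertexOf b∈L) p))

  project : ∀ {k u v} → Walk G u v k → LabelWalk E L (lookup L u) (lookup L v) k
  project here               = nil
  project (step {v = v} e p) = cons e (∈-lookup v) (project p)

  module _ {δ R} (degree≥ : ∀ {a} → a ∈ L → δ ≤ count (E a) L)
      {a₀} (a₀∈L : a₀ ∈ L) (degree≡ : count (E a₀) L ≡ δ)
      {c} (c∈L : c ∈ L) (near : ∀ {b} → b ∈ L → ∃[ j ] (suc j ≤ R × LabelWalk E L c b (suc j)))
      (far : ∀ {a} → a ∈ L → ∃[ b ] (b ∈ L × (∀ {k} → LabelWalk E L a b k → R ≤ k))) where

    central : EccLe G (vertexOf c∈L) R
    central w with near (∈-lookup w)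
    ... | j , j<R , p = suc j , j<R , lift j _ w (subst (λ a → LabelWalk E L a _ _) (label-vertexOf c∈L) p)

    admissible : Admissible G δ
    admissible = (λ u w → _ , _⧺_ G (reverse-walk G (proj₂ (proj₂ (central u)))) (proj₂ (proj₂ (central w)))) ,
      triangleFree ,
      (λ v → subst (δ ≤_) (sym (deg-labels v)) (degree≥ (∈-lookup v))) ,
      vertexOf a₀∈L , trans (deg-labels _) (trans (cong (λ a → count (E a) L) (sym (label-vertexOf a₀∈L))) degree≡)

    hasRadius : HasRadius G R
    hasRadius = (vertexOf c∈L , central) , λ r′ (v , ecc) → minimal r′ v ecc
      where
      minimal : ∀ r′ v → EccLe G v r′ → R ≤ r′
      minimal r′ v ecc with far (∈-lookup v)
      ... | b , b∈L , long with ecc (vertexOf b∈L)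
      ... | j , j≤r′ , p = ≤-trans (long (subst (λ b → LabelWalk E L _ b j) (sym (label-vertexOf b∈L)) (project p))) j≤r′

    realised : ∀ {n} → length L ≡ n → Realised n δ R
    realised refl = G , admissible , hasRadius

-- Complete bipartite graphs and crowns

count-none : ∀ {A : Set} (p : A → Bool) xs → (∀ x → p x ≡ false) → count p xs ≡ 0
count-none p xs h = count≡0 p (All.universal (λ x px → subst T (h x) px) xs)

count-all : ∀ {A : Set} (p : A → Bool) xs → (∀ x → p x ≡ true) → count p xs ≡ length xs
count-all p []       h = refl
count-all p (x ∷ xs) h rewrite h x = cong suc (count-all p xs h)

xor-not : ∀ a b → T (a xor b) → b ≡ not a
xor-not false true  _ = refl
xor-not true  false _ = refl

Label : Set
Label = Bool × ℕ

left right : ℕ → Label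
left  i = false , i
right i = true , i

sides : List ℕ → List ℕ → List Label
sides xs ys = map left xs ++ map right ys

length-sides : ∀ xs ys → length (sides xs ys) ≡ length xs + length ys
length-sides xs ys = trans (length-++ (map left xs)) (cong₂ _+_ (length-map left xs) (length-map right ys))

count-sides : ∀ p xs ys → count p (sides xs ys) ≡ count (λ i → p (left i)) xs + count (λ i → p (right i)) ys
count-sides p xs ys = trans (count-++ p (map left xs) (map right ys))
  (cong₂ _+_ (sym (count-map p left xs)) (sym (count-map p right ys)))

left∈ : ∀ {i xs ys} → i ∈ xs → left i ∈ sides xs ys
left∈ i∈xs = ∈-++⁺ˡ (∈-map⁺ left i∈xs)

right∈ : ∀ {i xs ys} → i ∈ ys → right i ∈ sides xs ys
right∈ {xs = xs} i∈ys = ∈-++⁺ʳ (map left xs) (∈-map⁺ right i∈ys)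

left∈⁻ : ∀ {i xs ys} → left i ∈ sides xs ys → i ∈ xs
left∈⁻ {xs = xs} h with ∈-++⁻ (map left xs) h
... | inj₁ h′ with ∈-map⁻ left h′
... | _ , i∈xs , refl = i∈xs
left∈⁻ {xs = xs} h | inj₂ h′ with ∈-map⁻ right h′
... | _ , _ , ()

right∈⁻ : ∀ {i xs ys} → right i ∈ sides xs ys → i ∈ ys
right∈⁻ {xs = xs} h with ∈-++⁻ (map left xs) h
... | inj₂ h′ with ∈-map⁻ right h′
... | _ , i∈ys , refl = i∈ys
right∈⁻ {xs = xs} h | inj₁ h′ with ∈-map⁻ left h′
... | _ , _ , ()

module CompleteBipartite (δ e : ℕ) (2≤δ : 2 ≤ δ) where

  E : Label → Label → Bool
  E (s , _) (s′ , _) = s xor s′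

  L : List Label
  L = sides (downFrom δ) (downFrom (δ + e))

  open BlowUp E (λ a b → xor-comm (proj₁ a) (proj₁ b)) proj₁ (λ a b → xor-not (proj₁ a) (proj₁ b)) L

  ∈L : ∀ s {i} → i < δ → (s , i) ∈ L
  ∈L false i<δ = left∈ (∈-downFrom⁺ i<δ)
  ∈L true  i<δ = right∈ (∈-downFrom⁺ (≤-trans i<δ (m≤m+n δ e)))

  0<δ : 0 < δ
  0<δ = <⇒≤ 2≤δ

  degree : ∀ s i → count (E (s , i)) L ≡ (if s then δ else δ + e)
  degree true  i = trans (count-sides (E (true , i)) (downFrom δ) (downFrom (δ + e)))
    (trans (cong₂ _+_ (trans (count-all _ (downFrom δ) (λ _ → refl)) (length-downFrom δ)) (count-none _ (downFrom (δ + e)) λ _ → refl)) (+-identityʳ δ))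
  degree false i = trans (count-sides (E (false , i)) (downFrom δ) (downFrom (δ + e)))
    (cong₂ _+_ (count-none _ (downFrom δ) λ _ → refl) (trans (count-all _ (downFrom (δ + e)) (λ _ → refl)) (length-downFrom (δ + e))))

  degree≥ : ∀ {a} → a ∈ L → δ ≤ count (E a) L
  degree≥ {true  , i} _ = ≤-reflexive (sym (degree true i))
  degree≥ {false , i} _ = ≤-trans (m≤m+n δ e) (≤-reflexive (sym (degree false i)))

  near : ∀ {b} → b ∈ L → ∃[ j ] (suc j ≤ 2 × LabelWalk E L (left 0) b (suc j))
  near {true  , j} b∈L = 0 , s≤s z≤n , cons tt b∈L nil
  near {false , j} b∈L = 1 , ≤-refl , cons {b = right 0} tt (∈L true 0<δ) (cons tt b∈L nil)

  -- Each side has a second label because δ ≥ 2, and it is not adjacent to the first.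
  twin : ∀ s i → ∃[ b ] (b ∈ L × (∀ {k} → LabelWalk E L (s , i) b k → 2 ≤ k))
  twin s zero = (s , 1) , ∈L s 2≤δ , λ { {1} (cons e _ nil) → ⊥-elim (not-¬ refl (xor-not s s e)) ; {suc (suc k)} _ → s≤s (s≤s z≤n) }
  twin s (suc i) = (s , 0) , ∈L s 0<δ , λ { {1} (cons e _ nil) → ⊥-elim (not-¬ refl (xor-not s s e)) ; {suc (suc k)} _ → s≤s (s≤s z≤n) }

  completeBipartite : Realised (δ + (δ + e)) δ 2
  completeBipartite = realised degree≥ (∈L true 0<δ) (degree true 0) (∈L false 0<δ) near (λ {(s , i)} _ → twin s i)
    (trans (length-sides (downFrom δ) (downFrom (δ + e))) (cong₂ _+_ (length-downFrom δ) (length-downFrom (δ + e))))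

differs : ℕ → ℕ → Bool
differs i j = not (i ≡ᵇ j)

differs-sym : ∀ i j → differs i j ≡ differs j i
differs-sym zero    zero    = refl
differs-sym zero    (suc j) = refl
differs-sym (suc i) zero    = refl
differs-sym (suc i) (suc j) = differs-sym i j

differs-refl : ∀ i → differs i i ≡ false
differs-refl zero    = refl
differs-refl (suc i) = differs-refl i

differs-≢ : ∀ i j → i ≢ j → differs i j ≡ true
differs-≢ zero    zero    h = ⊥-elim (h refl)
differs-≢ zero    (suc j) h = refl
differs-≢ (suc i) zero    h = refl
differs-≢ (suc i) (suc j) h = differs-≢ i j (λ eq → h (cong suc eq))

count-differs-beyond : ∀ i m → m ≤ i → count (differs i) (downFrom m) ≡ m
count-differs-beyond i zero    h = refl
count-differs-beyond i (suc m) h rewrite differs-≢ i m (λ { refl → <-irrefl refl h }) = cong suc (count-differs-beyond i m (<⇒≤ h))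

count-differs : ∀ i m → i ≤ m → count (differs i) (downFrom (suc m)) ≡ m
count-differs i m i≤m with m≤n⇒m<n∨m≡n i≤m
... | inj₂ refl rewrite differs-refl i = count-differs-beyond i i ≤-refl
count-differs i (suc m) i≤m | inj₁ i<m rewrite differs-≢ i (suc m) (<⇒≢ i<m) = cong suc (count-differs i m (s≤s⁻¹ i<m))

-- All e surplus vertices are copies of `right 0`, so right degrees stay exactly δ while left
-- degrees can only grow.
module Crown (δ e : ℕ) (2≤δ : 2 ≤ δ) where

  E : Label → Label → Bool
  E (s , i) (s′ , j) = (s xor s′) ∧ differs i j

  E-sym : ∀ a b → E a b ≡ E b a
  E-sym (s , i) (s′ , j) = cong₂ _∧_ (xor-comm s s′) (differs-sym i j)

  E-side : ∀ a b → T (E a b) → proj₁ b ≡ not (proj₁ a)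
  E-side (s , i) (s′ , j) e = xor-not s s′ (proj₁ (T-∧ (s xor s′) e))

  rights : List ℕ
  rights = downFrom (suc δ) ++ replicate e 0

  L : List Label
  L = sides (downFrom (suc δ)) rights

  open BlowUp E E-sym proj₁ E-side L

  ∈L : ∀ s {i} → i ≤ δ → (s , i) ∈ L
  ∈L false i≤δ = left∈ (∈-downFrom⁺ (s≤s i≤δ))
  ∈L true  i≤δ = right∈ {xs = downFrom (suc δ)} {ys = rights} (∈-++⁺ˡ (∈-downFrom⁺ (s≤s i≤δ)))

  ∈L⁻ : ∀ s {i} → (s , i) ∈ L → i ≤ δ
  ∈L⁻ false h = s≤s⁻¹ (∈-downFrom⁻ (left∈⁻ {ys = rights} h))
  ∈L⁻ true  h with ∈-++⁻ (downFrom (suc δ)) (right∈⁻ {xs = downFrom (suc δ)} h)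
  ... | inj₁ h′ = s≤s⁻¹ (∈-downFrom⁻ h′)
  ... | inj₂ h′ = ≤-trans (≤-reflexive (All.lookup (All.replicate⁺ {P = _≡ 0} e refl) h′)) z≤n

  degree-right : ∀ {i} → i ≤ δ → count (E (right i)) L ≡ δ
  degree-right {i} i≤δ = trans (count-sides (E (right i)) (downFrom (suc δ)) rights)
    (trans (cong₂ _+_ (count-differs i δ i≤δ) (count-none _ rights λ _ → refl)) (+-identityʳ δ))

  degree-left : ∀ {i} → i ≤ δ → δ ≤ count (E (left i)) L
  degree-left {i} i≤δ = begin
    δ                                                      ≡⟨ sym (count-differs i δ i≤δ) ⟩
    count (differs i) (downFrom (suc δ))                   ≤⟨ m≤m+n _ _ ⟩
    count (differs i) (downFrom (suc δ)) + count (differs i) (replicate e 0)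
                                                           ≡⟨ sym (count-++ (differs i) (downFrom (suc δ)) (replicate e 0)) ⟩
    count (differs i) rights                               ≤⟨ m≤n+m _ _ ⟩
    _ + count (differs i) rights                           ≡⟨ sym (count-sides (E (left i)) (downFrom (suc δ)) rights) ⟩
    count (E (left i)) L                                   ∎
    where open ≤-Reasoning

  degree≥ : ∀ {a} → a ∈ L → δ ≤ count (E a) L
  degree≥ {true  , i} h = ≤-reflexive (sym (degree-right (∈L⁻ true h)))
  degree≥ {false , i} h = degree-left (∈L⁻ false h)

  1≤δ : 1 ≤ δ
  1≤δ = <⇒≤ 2≤δ

  near : ∀ {b} → b ∈ L → ∃[ j ] (suc j ≤ 3 × LabelWalk E L (left 0) b (suc j))
  near {true  , zero}  b∈L = 2 , ≤-refl , cons {b = right 1} tt (∈L true 1≤δ) (cons {b = left 2} tt (∈L false 2≤δ) (cons tt b∈L nil))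
  near {true  , suc j} b∈L = 0 , s≤s z≤n , cons tt b∈L nil
  near {false , 1}     b∈L = 1 , s≤s (s≤s z≤n) , cons {b = right 2} tt (∈L true 2≤δ) (cons tt b∈L nil)
  near {false , zero}  b∈L = 1 , s≤s (s≤s z≤n) , cons {b = right 1} tt (∈L true 1≤δ) (cons tt b∈L nil)
  near {false , suc (suc j)} b∈L = 1 , s≤s (s≤s z≤n) , cons {b = right 1} tt (∈L true 1≤δ) (cons tt b∈L nil)

  -- Opposite sides make the length odd, and the deleted matching edge excludes 1.
  opposite : ∀ s i {k} → LabelWalk E L (s , i) (not s , i) k → 3 ≤ k
  opposite s i {zero} p = ⊥-elim (absurd-nil s p)
    where
    absurd-nil : ∀ s → LabelWalk E L (s , i) (not s , i) 0 → ⊥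
    absurd-nil true  ()
    absurd-nil false ()
  opposite s i {1} (cons e _ nil) = ⊥-elim (subst T (differs-refl i) (proj₂ (T-∧ (s xor not s) e)))
  opposite s i {2} (cons {b = b} e _ (cons e′ _ nil)) =
    ⊥-elim (not-¬ (E-side (s , i) b e) (trans (sym (not-involutive (proj₁ b))) (sym (cong not (E-side b (not s , i) e′)))))
  opposite s i {suc (suc (suc k))} _ = s≤s (s≤s (s≤s z≤n))

  crown : Realised (suc δ + (suc δ + e)) δ 3
  crown = realised degree≥ (∈L true {0} z≤n) (degree-right z≤n) (∈L false z≤n) near
    (λ {(s , i)} a∈L → (not s , i) , ∈L (not s) (∈L⁻ s a∈L) , opposite s i)
    (trans (length-sides (downFrom (suc δ)) rights) (cong₂ _+_ (length-downFrom (suc δ))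
      (trans (length-++ (downFrom (suc δ))) (cong₂ _+_ (length-downFrom (suc δ)) (length-replicate e)))))

-- Weighted blow-ups of even cycles

sumBelow : (ℕ → ℕ) → ℕ → ℕ
sumBelow f zero    = 0
sumBelow f (suc m) = f m + sumBelow f m

term≤sumBelow : ∀ f {a m} → a < m → f a ≤ sumBelow f m
term≤sumBelow f {a} {suc m} a<1+m with m≤n⇒m<n∨m≡n (s≤s⁻¹ a<1+m)
... | inj₁ a<m  = ≤-trans (term≤sumBelow f a<m) (m≤n+m _ _)
... | inj₂ refl = m≤m+n _ _

two-terms≤sumBelow : ∀ f {a b m} → a < b → b < m → f a + f b ≤ sumBelow f m
two-terms≤sumBelow f {a} {b} {suc m} a<b b<1+m with m≤n⇒m<n∨m≡n (s≤s⁻¹ b<1+m)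
... | inj₁ b<m  = ≤-trans (two-terms≤sumBelow f a<b b<m) (m≤n+m _ _)
... | inj₂ refl = ≤-trans (≤-reflexive (+-comm (f a) (f b))) (+-monoʳ-≤ (f b) (term≤sumBelow f a<b))

blocks : (ℕ → ℕ) → ℕ → List ℕ
blocks w zero    = []
blocks w (suc m) = replicate (w m) m ++ blocks w m

length-blocks : ∀ w m → length (blocks w m) ≡ sumBelow w m
length-blocks w zero    = refl
length-blocks w (suc m) = trans (length-++ (replicate (w m) m)) (cong₂ _+_ (length-replicate (w m)) (length-blocks w m))

count-replicate : ∀ {A : Set} (p : A → Bool) c a → count p (replicate c a) ≡ (if p a then c else 0)
count-replicate p zero    a with p a
... | true  = refl
... | false = refl
count-replicate p (suc c) a with p a | count-replicate p c a
... | true  | eq = cong suc eq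
... | false | eq = eq

count-blocks : ∀ p w m → count p (blocks w m) ≡ sumBelow (λ i → if p i then w i else 0) m
count-blocks p w zero    = refl
count-blocks p w (suc m) = trans (count-++ p (replicate (w m) m) (blocks w m))
  (cong₂ _+_ (count-replicate p (w m) m) (count-blocks p w m))

∈-replicate : ∀ {A : Set} {a : A} c → 1 ≤ c → a ∈ replicate c a
∈-replicate (suc c) _ = here refl

∈-blocks⁺ : ∀ w → (∀ i → 1 ≤ w i) → ∀ {i m} → i < m → i ∈ blocks w m
∈-blocks⁺ w positive {i} {suc m} i<1+m with m≤n⇒m<n∨m≡n (s≤s⁻¹ i<1+m)
... | inj₁ i<m  = ∈-++⁺ʳ (replicate (w m) m) (∈-blocks⁺ w positive i<m)
... | inj₂ refl = ∈-++⁺ˡ (∈-replicate (w i) (positive i))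

∈-blocks⁻ : ∀ w {i} m → i ∈ blocks w m → i < m
∈-blocks⁻ w (suc m) h with ∈-++⁻ (replicate (w m) m) h
... | inj₁ h′ = s≤s (≤-reflexive (All.lookup (All.replicate⁺ {P = _≡ m} (w m) refl) h′))
... | inj₂ h′ = <-trans (∈-blocks⁻ w m h′) (n<1+n m)

even : ℕ → Bool
even zero    = true
even (suc n) = not (even n)

even-double : ∀ m → even (2 * m) ≡ true
even-double zero    = refl
even-double (suc m) rewrite +-suc m (m + 0) = trans (not-involutive (even (2 * m))) (even-double m)

T-∨ : ∀ a {b} → T (a ∨ b) → T a ⊎ T b
T-∨ true  t = inj₁ tt
T-∨ false t = inj₂ t

T-∨ˡ : ∀ {a b} → T a → T (a ∨ b)
T-∨ˡ {true} _ = tt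

T-∨ʳ : ∀ a {b} → T b → T (a ∨ b)
T-∨ʳ true  _ = tt
T-∨ʳ false t = t

early-next : ∀ i → early (2 + i) ≡ not (early i)
early-next 0 = refl
early-next 1 = refl
early-next 2 = refl
early-next 3 = refl
early-next (suc (suc (suc (suc i)))) = early-next i

-- With weights hi, hi, lo, lo, hi, hi, … the two neighbours of a label weigh lo + hi together;
-- where the cycle closes up they may weigh more.  The surplus vertices all get label 0, so label 2
-- keeps degree exactly lo + hi.
module Cycle (lo hi e h : ℕ) (1≤lo : 1 ≤ lo) (lo≤hi : lo ≤ hi) where

  last m r : ℕ
  last = 3 + 2 * h
  m    = suc last
  r    = 2 + h

  m≡2r : m ≡ r + r
  m≡2r = linear 1 (λ h → ⊢ # 4 ⊕ 2 ⊛ h ≋ # 2 ⊕ h ⊕ (# 2 ⊕ h)) h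

  next : ℕ → ℕ → Bool
  next a b = (suc a ≡ᵇ b) ∨ ((b ≡ᵇ 0) ∧ (a ≡ᵇ last))

  E : ℕ → ℕ → Bool
  E a b = next a b ∨ next b a

  next-cases : ∀ a b → T (next a b) → b ≡ suc a ⊎ (a ≡ last × b ≡ 0)
  next-cases a b t with T-∨ (suc a ≡ᵇ b) t
  ... | inj₁ t′ = inj₁ (sym (≡ᵇ⇒≡ (suc a) b t′))
  ... | inj₂ t′ = inj₂ (≡ᵇ⇒≡ a last (proj₂ (T-∧ (b ≡ᵇ 0) t′)) , ≡ᵇ⇒≡ b 0 (proj₁ (T-∧ (b ≡ᵇ 0) t′)))

  next-suc : ∀ a → T (next a (suc a))
  next-suc a = T-∨ˡ (≡⇒≡ᵇ (suc a) (suc a) refl)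

  next-last : T (next last 0)
  next-last = T-∨ʳ (suc last ≡ᵇ 0) (≡⇒≡ᵇ last last refl)

  E-forward : ∀ {a b} → T (next a b) → T (E a b)
  E-forward = T-∨ˡ

  E-backward : ∀ {a b} → T (next b a) → T (E a b)
  E-backward {a} {b} = T-∨ʳ (next a b)

  even-last : even last ≡ false
  even-last = cong not (trans (not-involutive _) (even-double h))

  next-even : ∀ a b → T (next a b) → even b ≡ not (even a)
  next-even a b t with next-cases a b t
  ... | inj₁ refl          = refl
  ... | inj₂ (refl , refl) = cong not (sym even-last)

  E-even : ∀ a b → T (E a b) → even b ≡ not (even a)
  E-even a b t with T-∨ (next a b) t
  ... | inj₁ t′ = next-even a b t′
  ... | inj₂ t′ = sym (trans (cong not (next-even b a t′)) (not-involutive (even b)))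

  w : ℕ → ℕ
  w i = if early i then hi else lo

  1≤hi : 1 ≤ hi
  1≤hi = ≤-trans 1≤lo lo≤hi

  1≤w : ∀ i → 1 ≤ w i
  1≤w i with early i
  ... | true  = 1≤hi
  ... | false = 1≤lo

  lo≤w : ∀ i → lo ≤ w i
  lo≤w i with early i
  ... | true  = lo≤hi
  ... | false = ≤-refl

  w-pair : ∀ i → w i + w (2 + i) ≡ lo + hi
  w-pair i rewrite early-next i with early i
  ... | true  = +-comm hi lo
  ... | false = refl

  L : List ℕ
  L = blocks w m ++ replicate e 0

  open BlowUp E (λ a b → ∨-comm (next a b) (next b a)) even E-even L

  ∈L : ∀ {i} → i < m → i ∈ L
  ∈L i<m = ∈-++⁺ˡ (∈-blocks⁺ w 1≤w i<m)

  ∈L⁻ : ∀ {i} → i ∈ L → i < m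
  ∈L⁻ h with ∈-++⁻ (blocks w m) h
  ... | inj₁ h′ = ∈-blocks⁻ w m h′
  ... | inj₂ h′ = ≤-trans (s≤s (≤-reflexive (All.lookup (All.replicate⁺ {P = _≡ 0} e refl) h′))) (s≤s z≤n)

  part : ℕ → ℕ → ℕ
  part a i = if E a i then w i else 0

  count-L : ∀ a → count (E a) L ≡ sumBelow (part a) m + (if E a 0 then e else 0)
  count-L a = trans (count-++ (E a) (blocks w m) (replicate e 0)) (cong₂ _+_ (count-blocks (E a) w m) (count-replicate (E a) e 0))

  part-adjacent : ∀ {a b} → T (E a b) → part a b ≡ w b
  part-adjacent {a} {b} t with E a b
  ... | true = refl

  degree-from : ∀ {a b c} → b < c → c < m → T (E a b) → T (E a c) → lo + hi ≤ w b + w c → lo + hi ≤ count (E a) L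
  degree-from {a} {b} {c} b<c c<m ab ac h = begin
    lo + hi                  ≤⟨ h ⟩
    w b + w c                ≡⟨ sym (cong₂ _+_ (part-adjacent {a} {b} ab) (part-adjacent {a} {c} ac)) ⟩
    part a b + part a c      ≤⟨ two-terms≤sumBelow (part a) b<c c<m ⟩
    sumBelow (part a) m      ≤⟨ m≤m+n _ _ ⟩
    sumBelow (part a) m + (if E a 0 then e else 0) ≡⟨ sym (count-L a) ⟩
    count (E a) L            ∎
    where open ≤-Reasoning

  degree≥ : ∀ {a} → a ∈ L → lo + hi ≤ count (E a) L
  degree≥ {zero}  _   = degree-from {0} {1} {last} (s≤s (s≤s z≤n)) ≤-refl (E-forward {0} {1} (next-suc 0)) (E-backward {0} {last} next-last)
    (≤-trans (≤-reflexive (+-comm lo hi)) (+-monoʳ-≤ hi (lo≤w last)))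
  degree≥ {suc a} a∈L with m≤n⇒m<n∨m≡n (s≤s⁻¹ (∈L⁻ a∈L))
  ... | inj₁ 1+a<last = degree-from {suc a} {a} {2 + a} (s≤s (n≤1+n a)) (s≤s 1+a<last) (E-backward {suc a} {a} (next-suc a)) (E-forward {suc a} {2 + a} (next-suc (suc a)))
    (≤-reflexive (sym (w-pair a)))
  ... | inj₂ refl     = degree-from {last} {0} {2 + 2 * h} (s≤s z≤n) (n≤1+n _) (E-forward {last} {0} next-last) (E-backward {last} {2 + 2 * h} (next-suc (2 + 2 * h)))
    (≤-trans (≤-reflexive (+-comm lo hi)) (+-monoʳ-≤ hi (lo≤w (2 + 2 * h))))

  -- The neighbours 1 and 3 of label 2 weigh `hi` and `lo`, and neither is the surplus label 0.
  -- Labels from 4 on contribute 0 by evaluation.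
  degree≡ : count (E 2) L ≡ lo + hi
  degree≡ = trans (count-L 2) (trans (+-identityʳ _) (tail (2 * h)))
    where
    tail : ∀ d → sumBelow (part 2) (4 + d) ≡ lo + hi
    tail zero    = cong (lo +_) (+-identityʳ hi)
    tail (suc d) = tail d

  up : ∀ a d → a + d < m → LabelWalk E L a (a + d) d
  up a zero    h = subst (λ b → LabelWalk E L a b 0) (sym (+-identityʳ a)) nil
  up a (suc d) h = cons (E-forward {a} {suc a} (next-suc a)) (∈L (≤-trans (s≤s (s≤s (m≤m+n a d))) h′))
      (subst (λ b → LabelWalk E L (suc a) b d) (sym (+-suc a d)) (up (suc a) d h′))
    where h′ = subst (_< m) (+-suc a d) h

  down : ∀ b d → b + d < m → LabelWalk E L (b + d) b d
  down b zero    h = subst (λ a → LabelWalk E L a b 0) (sym (+-identityʳ b)) nil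
  down b (suc d) h = subst (λ a → LabelWalk E L a b (suc d)) (sym (+-suc b d))
      (cons (E-backward {suc (b + d)} {b + d} (next-suc (b + d))) (∈L (<⇒≤ h′)) (down b d (<⇒≤ h′)))
    where h′ = subst (_< m) (+-suc b d) h

  near : ∀ {b} → b ∈ L → ∃[ j ] (suc j ≤ r × LabelWalk E L 0 b (suc j))
  -- Twins of the centre are reached by stepping to label 1 and back.
  near {zero}  b∈L = 1 , s≤s (s≤s z≤n) , cons (E-forward {0} {1} (next-suc 0)) (∈L (s≤s (s≤s z≤n))) (cons (E-backward {1} {0} (next-suc 0)) (∈L (s≤s z≤n)) nil)
  near {suc b} b∈L with suc b ≤? r
  ... | yes b<r = b , b<r , up 0 (suc b) (∈L⁻ b∈L)
  ... | no ¬b<r = last ∸ suc b ,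
      linear 3 (λ h b d → # 3 ⊕ h ≼ # 1 ⊕ b ⇒ # 1 ⊕ b ⊕ d ≋ # 3 ⊕ 2 ⊛ h ⇒ ⊢ # 1 ⊕ d ≼ # 2 ⊕ h) h b (last ∸ suc b) (≰⇒> ¬b<r) to-last ,
      cons (E-backward {0} {last} next-last) (∈L ≤-refl)
        (subst (λ a → LabelWalk E L a (suc b) (last ∸ suc b)) to-last (down (suc b) (last ∸ suc b) (s≤s (≤-reflexive to-last))))
    where
    to-last : suc b + (last ∸ suc b) ≡ last
    to-last = m+[n∸m]≡n (s≤s⁻¹ (∈L⁻ b∈L))

  -- Cyclic distance at most k, free of subtraction: directly, or across the seam in either
  -- direction.
  Reach : ℕ → ℕ → ℕ → Set
  Reach a b k = (b ≤ a + k × a ≤ b + k) ⊎ (a + m ≤ b + k) ⊎ (b + m ≤ a + k)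

  reach-step : ∀ {a a′ b k} → b < m → T (E a a′) → Reach a′ b k → Reach a b (suc k)
  reach-step {a} {a′} {b} {k} b<m t ρ with T-∨ (next a a′) t
  reach-step {a} {a′} {b} {k} b<m t ρ | inj₁ t′ with next-cases a a′ t′
  reach-step {a} {a′} {b} {k} b<m t (inj₁ (x , y)) | inj₁ t′ | inj₁ refl =
    inj₁ (linear 3 (λ a b k → b ≼ # 1 ⊕ a ⊕ k ⇒ ⊢ b ≼ a ⊕ (# 1 ⊕ k)) a b k x , linear 3 (λ a b k → # 1 ⊕ a ≼ b ⊕ k ⇒ ⊢ a ≼ b ⊕ (# 1 ⊕ k)) a b k y)
  reach-step {a} {a′} {b} {k} b<m t (inj₂ (inj₁ x)) | inj₁ t′ | inj₁ refl =
    inj₂ (inj₁ (linear 4 (λ a b k m → # 1 ⊕ a ⊕ m ≼ b ⊕ k ⇒ ⊢ a ⊕ m ≼ b ⊕ (# 1 ⊕ k)) a b k m x))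
  reach-step {a} {a′} {b} {k} b<m t (inj₂ (inj₂ x)) | inj₁ t′ | inj₁ refl =
    inj₂ (inj₂ (linear 4 (λ a b k m → b ⊕ m ≼ # 1 ⊕ a ⊕ k ⇒ ⊢ b ⊕ m ≼ a ⊕ (# 1 ⊕ k)) a b k m x))
  reach-step {a} {a′} {b} {k} b<m t (inj₁ (x , y)) | inj₁ t′ | inj₂ (refl , refl) =
    inj₂ (inj₂ (linear 3 (λ b k l → b ≼ k ⇒ ⊢ b ⊕ (# 1 ⊕ l) ≼ l ⊕ (# 1 ⊕ k)) b k last x))
  reach-step {a} {a′} {b} {k} b<m t (inj₂ (inj₁ x)) | inj₁ t′ | inj₂ (refl , refl) =
    inj₁ (linear 3 (λ b k l → # 1 ⊕ b ≼ # 1 ⊕ l ⇒ ⊢ b ≼ l ⊕ (# 1 ⊕ k)) b k last b<m , linear 3 (λ b k l → # 1 ⊕ l ≼ b ⊕ k ⇒ ⊢ l ≼ b ⊕ (# 1 ⊕ k)) b k last x)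
  reach-step {a} {a′} {b} {k} b<m t (inj₂ (inj₂ x)) | inj₁ t′ | inj₂ (refl , refl) =
    inj₂ (inj₂ (linear 3 (λ b k l → b ⊕ (# 1 ⊕ l) ≼ k ⇒ ⊢ b ⊕ (# 1 ⊕ l) ≼ l ⊕ (# 1 ⊕ k)) b k last x))
  reach-step {a} {a′} {b} {k} b<m t ρ | inj₂ t′ with next-cases a′ a t′
  reach-step {a} {a′} {b} {k} b<m t (inj₁ (x , y)) | inj₂ t′ | inj₁ refl =
    inj₁ (linear 3 (λ a b k → b ≼ a ⊕ k ⇒ ⊢ b ≼ # 1 ⊕ a ⊕ (# 1 ⊕ k)) a′ b k x , linear 3 (λ a b k → a ≼ b ⊕ k ⇒ ⊢ # 1 ⊕ a ≼ b ⊕ (# 1 ⊕ k)) a′ b k y)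
  reach-step {a} {a′} {b} {k} b<m t (inj₂ (inj₁ x)) | inj₂ t′ | inj₁ refl =
    inj₂ (inj₁ (linear 4 (λ a b k m → a ⊕ m ≼ b ⊕ k ⇒ ⊢ # 1 ⊕ a ⊕ m ≼ b ⊕ (# 1 ⊕ k)) a′ b k m x))
  reach-step {a} {a′} {b} {k} b<m t (inj₂ (inj₂ x)) | inj₂ t′ | inj₁ refl =
    inj₂ (inj₂ (linear 4 (λ a b k m → b ⊕ m ≼ a ⊕ k ⇒ ⊢ b ⊕ m ≼ # 1 ⊕ a ⊕ (# 1 ⊕ k)) a′ b k m x))
  reach-step {a} {a′} {b} {k} b<m t (inj₁ (x , y)) | inj₂ t′ | inj₂ (refl , refl) =
    inj₂ (inj₁ (linear 3 (λ b k l → l ≼ b ⊕ k ⇒ ⊢ # 1 ⊕ l ≼ b ⊕ (# 1 ⊕ k)) b k last y))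
  reach-step {a} {a′} {b} {k} b<m t (inj₂ (inj₁ x)) | inj₂ t′ | inj₂ (refl , refl) =
    inj₂ (inj₁ (linear 3 (λ b k l → l ⊕ (# 1 ⊕ l) ≼ b ⊕ k ⇒ ⊢ # 1 ⊕ l ≼ b ⊕ (# 1 ⊕ k)) b k last x))
  reach-step {a} {a′} {b} {k} b<m t (inj₂ (inj₂ x)) | inj₂ t′ | inj₂ (refl , refl) =
    inj₁ (linear 3 (λ b k l → b ⊕ (# 1 ⊕ l) ≼ l ⊕ k ⇒ ⊢ b ≼ # 1 ⊕ k) b k last x , z≤n)

  reach : ∀ {a b k} → b < m → LabelWalk E L a b k → Reach a b k
  reach b<m nil          = inj₁ (m≤m+n _ 0 , m≤m+n _ 0)
  reach b<m (cons t _ p) = reach-step b<m t (reach b<m p)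

  -- The witness is the antipode of a on the cycle of length 2r.
  far : ∀ {a} → a ∈ L → ∃[ b ] (b ∈ L × (∀ {k} → LabelWalk E L a b k → r ≤ k))
  far {a} a∈L with r ≤? a
  ... | no ¬r≤a = a + r , ∈L b<m , λ {k} p → conclude k (reach b<m p)
    where
    b<m : a + r < m
    b<m = linear 3 (λ a r m → # 1 ⊕ a ≼ r ⇒ m ≋ r ⊕ r ⇒ ⊢ # 1 ⊕ (a ⊕ r) ≼ m) a r m (≰⇒> ¬r≤a) m≡2r
    conclude : ∀ k → Reach a (a + r) k → r ≤ k
    conclude k (inj₁ (x , _))  = +-cancelˡ-≤ a r k x
    conclude k (inj₂ (inj₁ x)) = linear 4 (λ a r k m → a ⊕ m ≼ a ⊕ r ⊕ k ⇒ m ≋ r ⊕ r ⇒ ⊢ r ≼ k) a r k m x m≡2r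
    conclude k (inj₂ (inj₂ x)) = linear 4 (λ a r k m → a ⊕ r ⊕ m ≼ a ⊕ k ⇒ ⊢ r ≼ k) a r k m x
  ... | yes r≤a = a ∸ r , ∈L b<m , λ {k} p → conclude k (reach b<m p)
    where
    b<m : a ∸ r < m
    b<m = ≤-<-trans (m∸n≤m a r) (∈L⁻ a∈L)
    conclude : ∀ k → Reach a (a ∸ r) k → r ≤ k
    conclude k (inj₁ (_ , x))  = linear 4 (λ a r k b → a ≼ b ⊕ k ⇒ b ⊕ r ≋ a ⇒ ⊢ r ≼ k) a r k (a ∸ r) x (m∸n+n≡m r≤a)
    conclude k (inj₂ (inj₁ x)) = linear 5 (λ a r k m b → a ⊕ m ≼ b ⊕ k ⇒ b ⊕ r ≋ a ⇒ ⊢ r ≼ k) a r k m (a ∸ r) x (m∸n+n≡m r≤a)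
    conclude k (inj₂ (inj₂ x)) = linear 5 (λ a r k m b → b ⊕ m ≼ a ⊕ k ⇒ b ⊕ r ≋ a ⇒ m ≋ r ⊕ r ⇒ ⊢ r ≼ k) a r k m (a ∸ r) x (m∸n+n≡m r≤a) m≡2r

  cycle : Realised (sumBelow w m + e) (lo + hi) r
  cycle = realised degree≥ (∈L {2} (s≤s (s≤s (s≤s z≤n)))) degree≡ (∈L {0} (s≤s z≤n)) near far
    (trans (length-++ (blocks w m)) (cong₂ _+_ (length-blocks w m) (length-replicate e)))

  weight-step : ∀ k → sumBelow w (4 + k) ≡ 2 * (lo + hi) + sumBelow w k
  weight-step k = linear 6 (λ d a b c e s → a ⊕ c ≋ d ⇒ b ⊕ e ≋ d ⇒ ⊢ e ⊕ (c ⊕ (b ⊕ (a ⊕ s))) ≋ 2 ⊛ d ⊕ s)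
    (lo + hi) (w k) (w (1 + k)) (w (2 + k)) (w (3 + k)) (sumBelow w k) (w-pair k) (w-pair (1 + k))

  weight-even : ∀ j → sumBelow w (4 * j) ≡ 2 * j * (lo + hi)
  weight-even zero    = refl
  weight-even (suc j) = trans (cong (sumBelow w) (linear 1 (λ j → ⊢ 4 ⊛ (# 1 ⊕ j) ≋ # 4 ⊕ 4 ⊛ j) j))
    (trans (weight-step (4 * j)) (trans (cong (2 * (lo + hi) +_) (weight-even j)) (lemma j (lo + hi))))
    where
    lemma : ∀ j d → 2 * d + 2 * j * d ≡ 2 * suc j * d
    lemma = solve-∀

  early-4* : ∀ i j → early (i + 4 * j) ≡ early i
  early-4* i zero    = cong early (+-identityʳ i)
  early-4* i (suc j) = trans (cong early (linear 2 (λ i j → ⊢ i ⊕ 4 ⊛ (# 1 ⊕ j) ≋ # 4 ⊕ (i ⊕ 4 ⊛ j)) i j)) (early-4* i j)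

  -- For odd r = 2j + 1 two labels of weight `hi` remain after j full periods, so the total exceeds
  -- rδ by hi - lo.
  weight-odd : ∀ j → sumBelow w (2 + 4 * j) ≡ hi + (hi + 2 * j * (lo + hi))
  weight-odd j rewrite early-4* 0 j | early-4* 1 j | weight-even j = refl

parity : ∀ n → ∃[ m ] (n ≡ 2 * m ⊎ n ≡ suc (2 * m))
parity zero = 0 , inj₁ refl
parity (suc n) with parity n
... | m , inj₁ eq = m , inj₂ (cong suc eq)
... | m , inj₂ eq = suc m , inj₁ (trans (cong suc eq) (linear 1 (λ m → ⊢ # 2 ⊕ 2 ⊛ m ≋ 2 ⊛ (# 1 ⊕ m)) m))

halves : ∀ δ → 2 ≤ δ → ∃[ lo ] ∃[ hi ] (lo + hi ≡ δ × 1 ≤ lo × (hi ≡ lo ⊎ (Odd δ × hi ≡ suc lo)))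
halves δ 2≤δ with parity δ
... | d , inj₁ refl = d , d , cong (d +_) (sym (+-identityʳ d)) , *-cancelˡ-≤ 2 2≤δ , inj₁ refl
... | d , inj₂ refl = d , suc d , linear 1 (λ d → ⊢ d ⊕ (# 1 ⊕ d) ≋ # 1 ⊕ 2 ⊛ d) d , *-cancelˡ-< 2 0 d (s≤s⁻¹ 2≤δ) , inj₂ ((d , refl) , refl)

module _ {n lo hi h} (1≤lo : 1 ≤ lo) (rδ≤n : (2 + h) * (lo + hi) ≤ n)
    (strict : Odd (2 + h) → Odd (lo + hi) → (2 + h) * (lo + hi) < n) where

  private
    δ r : ℕ
    δ = lo + hi
    r = 2 + h

    lo≤hi : hi ≡ lo ⊎ (Odd δ × hi ≡ suc lo) → lo ≤ hi
    lo≤hi (inj₁ refl)       = ≤-refl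
    lo≤hi (inj₂ (_ , refl)) = n≤1+n lo

  cycle-of-halves : hi ≡ lo ⊎ (Odd δ × hi ≡ suc lo) → Realised n δ r
  cycle-of-halves balance = subst (λ n → Realised n δ r) (m+[n∸m]≡n total≤n) (C.cycle (n ∸ total))
    where
    module C (e : ℕ) = Cycle lo hi e h 1≤lo (lo≤hi balance)

    total : ℕ
    total = sumBelow (C.w 0) (C.m 0)

    odd-bound : ∀ j → r ≡ suc (2 * j) → hi ≡ lo ⊎ (Odd δ × hi ≡ suc lo) → hi + (hi + 2 * j * δ) ≤ n
    odd-bound j r≡ (inj₁ hi≡) = linear 5 (λ l x s R n → x ≋ l ⇒ R ≋ l ⊕ x ⊕ s ⇒ R ≼ n ⇒ ⊢ x ⊕ (x ⊕ s) ≼ n)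
      lo hi (2 * j * δ) (r * δ) n hi≡ (cong (_* δ) r≡) rδ≤n
    -- With r and δ both odd the total weight is rδ + 1, which is where strictness is needed.
    odd-bound j r≡ (inj₂ (δ-odd , hi≡)) = linear 5 (λ l x s R n → x ≋ # 1 ⊕ l ⇒ R ≋ l ⊕ x ⊕ s ⇒ # 1 ⊕ R ≼ n ⇒ ⊢ x ⊕ (x ⊕ s) ≼ n)
      lo hi (2 * j * δ) (r * δ) n hi≡ (cong (_* δ) r≡) (strict (j , r≡) δ-odd)

    total≤n : total ≤ n
    total≤n with parity r
    ... | j , inj₁ r≡ = ≤-trans (≤-reflexive (trans
            (cong (sumBelow (C.w 0)) (linear 2 (λ h j → # 2 ⊕ h ≋ 2 ⊛ j ⇒ ⊢ # 4 ⊕ 2 ⊛ h ≋ 4 ⊛ j) h j r≡))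
            (trans (C.weight-even 0 j) (cong (_* δ) (sym r≡))))) rδ≤n
    ... | j , inj₂ r≡ = ≤-trans (≤-reflexive (trans
            (cong (sumBelow (C.w 0)) (linear 2 (λ h j → # 2 ⊕ h ≋ # 1 ⊕ 2 ⊛ j ⇒ ⊢ # 4 ⊕ 2 ⊛ h ≋ # 2 ⊕ 4 ⊛ j) h j r≡))
            (C.weight-odd 0 j))) (odd-bound j r≡ balance)

cycle-realised : ∀ {n δ r} → 2 ≤ δ → 2 ≤ r → r * δ ≤ n → (Odd r → Odd δ → r * δ < n) → Realised n δ r
cycle-realised {r = suc (suc h)} 2≤δ (s≤s (s≤s _)) rδ≤n strict with halves _ 2≤δ
... | lo , hi , refl , 1≤lo , balance = cycle-of-halves {lo = lo} {hi} {h} 1≤lo rδ≤n strict balance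

-- The maximum radius

module _ {n} (G : Graph n) {δ} (2≤δ : 2 ≤ δ) (admissible : Admissible G δ) where

  private
    connected = proj₁ admissible
    triangleFree = proj₁ (proj₂ admissible)
    minDegree = proj₁ (proj₂ (proj₂ admissible))

    open Metric G connected

    length-allFin : length (allFin n) ≡ n
    length-allFin = length-tabulate {n = n} λ i → i

  -- The two ends of an edge have disjoint neighbourhoods.
  order≥2δ : 2 * δ ≤ n
  order≥2δ = subst₂ _≤_ refl (trans (+-identityʳ _) length-allFin)
    (double-count (adj G) (λ _ → δ) (v ∷ u ∷ []) (allFin n) 1 (minDegree v ∷ minDegree u ∷ [])
      λ x → count≤1 {Ok = λ _ → ⊤} {_⊏_ = Adj G} (λ a → adj G a x) (tt ∷ tt ∷ []) ((v∼u ∷ []) ∷ [] ∷ [])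
        λ _ _ ab ax bx → triangleFree _ _ _ (ab , bx , ax))
    where
    v = proj₁ (proj₂ (proj₂ (proj₂ admissible)))
    neighbour = count-witness (adj G v) (allFin n) (≤-trans (<⇒≤ 2≤δ) (minDegree v))
    u = proj₁ neighbour
    v∼u = proj₂ neighbour

  -- Closed neighbourhoods of vertices at distance at least 3 are disjoint. They enter the count in
  -- four pieces: the tag `true` stands for a neighbourhood, `false` for the vertex itself.
  order≥2δ+2 : ∀ {v w} → 3 ≤ dist v w → 2 * δ + 2 ≤ n
  order≥2δ+2 {v} {w} 3≤d = subst₂ _≤_ (linear 1 (λ d → ⊢ d ⊕ (d ⊕ # 2) ≋ 2 ⊛ d ⊕ # 2) δ) (trans (+-identityʳ _) length-allFin)
    (double-count R size as (allFin n) 1 (minDegree v ∷ minDegree w ∷ self v ∷ self w ∷ [])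
      λ x → count≤1 {Ok = λ _ → ⊤} {_⊏_ = Apart} (λ a → R a x) (tt ∷ tt ∷ tt ∷ tt ∷ []) apart λ _ _ clash → clash x)
    where
    R : Bool × Fin n → Fin n → Bool
    R (true  , a) x = adj G a x
    R (false , a) x = ⌊ a ≟ x ⌋
    size : Bool × Fin n → ℕ
    size (true  , _) = δ
    size (false , _) = 1
    self : ∀ a → 1 ≤ count (R (false , a)) (allFin n)
    self a = 1≤count (R (false , a)) (∈-allFin a) (fromWitness {a? = a ≟ a} refl)
    too-close : ∀ {d} → dist v w ≤ d → d ≤ 2 → ⊥
    too-close h d≤2 = <⇒≱ 3≤d (≤-trans h d≤2)
    at : ∀ {a b x d} → T ⌊ b ≟ x ⌋ → dist a x ≤ d → dist a b ≤ d
    at {a} {b} {x} {d} b≡x h = subst (λ u → dist a u ≤ d) (sym (toWitness {a? = b ≟ x} b≡x)) h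
    loop : ∀ {a x} → Adj G a x → T ⌊ a ≟ x ⌋ → ⊥
    loop {a} {x} ax a≡x = subst T (irrefl G a) (subst (Adj G a) (sym (toWitness {a? = a ≟ x} a≡x)) ax)

    as : List (Bool × Fin n)
    as = (true , v) ∷ (true , w) ∷ (false , v) ∷ (false , w) ∷ []
    Apart : Bool × Fin n → Bool × Fin n → Set
    Apart a b = ∀ x → T (R a x) → T (R b x) → ⊥
    apart : AllPairs Apart as
    apart =
      ((λ x vx wx → too-close (dist-common vx wx) ≤-refl) ∷
       (λ x vx v≡x → loop {v} {x} vx v≡x) ∷
       (λ x vx w≡x → too-close (at {v} {w} {x} w≡x (dist-adj vx)) (s≤s z≤n)) ∷ []) ∷
      ((λ x wx v≡x → too-close (≤-trans (≤-reflexive (dist-sym v w)) (at {w} {v} {x} v≡x (dist-adj wx))) (s≤s z≤n)) ∷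
       (λ x wx w≡x → loop {w} {x} wx w≡x) ∷ []) ∷
      ((λ x v≡x w≡x → too-close (at {v} {w} {x} w≡x
         (≤-reflexive (trans (cong (dist v) (sym (toWitness {a? = v ≟ x} v≡x))) (dist-refl v)))) z≤n) ∷ []) ∷ [] ∷ []

  eccentric : ∀ {r} → HasRadius G (suc r) → ∀ v → ∃[ w ] suc r ≤ dist v w
  eccentric {r} (_ , minimal) v with any? (λ w → suc r ≤? dist v w)
  ... | yes far = far
  ... | no ¬far = ⊥-elim (<-irrefl refl (minimal r
        (v , λ w → dist v w , s≤s⁻¹ (≰⇒> λ h → ¬far (w , h)) , dist-walk v w)))

  small-radius : ∀ {r} → HasRadius G r → n < 2 * δ + 2 → r ≤ 2
  small-radius {r} radius n< = ≮⇒≥ (contradict r radius)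
    where
    contradict : ∀ r → HasRadius G r → 2 < r → ⊥
    contradict (suc r) radius@((v , _) , _) 3≤r with eccentric radius v
    ... | w , far = <⇒≱ n< (order≥2δ+2 (≤-trans 3≤r far))

  large-radius : ∀ {r} → HasRadius G r → 4 ≤ r → r * δ ≤ n × (Odd r → Odd δ → r * δ < n)
  large-radius {suc r} radius@((v , _) , _) 4≤r =
    UpperBound.radius-bound G connected triangleFree minDegree 4≤r v (eccentric radius)

at-most-3 : ∀ {n δ} → 2 ≤ δ → n < 4 * δ → (G : Graph n) → ∀ r → Admissible G δ → HasRadius G r → r ≤ 3
at-most-3 {n} {δ} 2≤δ n<4δ G r admissible radius = ≮⇒≥ λ 4≤r →
  <⇒≱ n<4δ (≤-trans (*-monoˡ-≤ δ 4≤r) (proj₁ (large-radius G 2≤δ admissible radius 4≤r)))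

theorem1p1 : ∀ (δ n : ℕ) → 2 ≤ δ → {{_ : NonZero δ}} →
    ((n < 2 * δ → ¬ (∃[ G ] Admissible {n} G δ)) ×
    ((n ≡ 2 * δ ⊎ n ≡ suc (2 * δ)) → MaxRadius n δ 2) ×
    ((2 * δ + 2 ≤ n × n < 4 * δ) → MaxRadius n δ 3) ×
    (4 * δ ≤ n → (Odd δ × (∃[ k ] (Odd k × n ≡ k * δ))) → MaxRadius n δ (n / δ ∸ 1)) ×
    (4 * δ ≤ n → ¬ (Odd δ × (∃[ k ] (Odd k × n ≡ k * δ))) → MaxRadius n δ (n / δ)))
theorem1p1 δ n 2≤δ = none-below , two , three , exceptional , general
  where
  none-below : n < 2 * δ → ¬ (∃[ G ] Admissible {n} G δ)
  none-below n<2δ (G , admissible) = <⇒≱ n<2δ (order≥2δ G 2≤δ admissible)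

  two : (n ≡ 2 * δ ⊎ n ≡ suc (2 * δ)) → MaxRadius n δ 2
  two (inj₁ n≡) = subst (λ n → Realised n δ 2) (trans (linear 1 (λ d → ⊢ d ⊕ (d ⊕ # 0) ≋ 2 ⊛ d) δ) (sym n≡))
      (CompleteBipartite.completeBipartite δ 0 2≤δ) ,
    λ G r admissible radius → small-radius G 2≤δ admissible radius (linear 2 (λ n d → n ≋ 2 ⊛ d ⇒ ⊢ # 1 ⊕ n ≼ 2 ⊛ d ⊕ # 2) n δ n≡)
  two (inj₂ n≡) = subst (λ n → Realised n δ 2) (trans (linear 1 (λ d → ⊢ d ⊕ (d ⊕ # 1) ≋ # 1 ⊕ 2 ⊛ d) δ) (sym n≡))
      (CompleteBipartite.completeBipartite δ 1 2≤δ) ,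
    λ G r admissible radius → small-radius G 2≤δ admissible radius (linear 2 (λ n d → n ≋ # 1 ⊕ 2 ⊛ d ⇒ ⊢ # 1 ⊕ n ≼ 2 ⊛ d ⊕ # 2) n δ n≡)

  three : (2 * δ + 2 ≤ n × n < 4 * δ) → MaxRadius n δ 3
  three (2δ+2≤n , n<4δ) = subst (λ n → Realised n δ 3)
      (linear 3 (λ d n e → 2 ⊛ d ⊕ # 2 ⊕ e ≋ n ⇒ ⊢ # 1 ⊕ d ⊕ (# 1 ⊕ d ⊕ e) ≋ n) δ n (n ∸ (2 * δ + 2)) (m+[n∸m]≡n 2δ+2≤n))
      (Crown.crown δ (n ∸ (2 * δ + 2)) 2≤δ) ,
    at-most-3 2≤δ n<4δ

  quotient-maximal : ∀ {k} → k * δ ≤ n → k ≤ n / δ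
  quotient-maximal {k} h = subst (_≤ n / δ) (m*n/n≡m k δ) (/-monoˡ-≤ δ h)

  at-most-quotient : 4 * δ ≤ n → (G : Graph n) → ∀ r → Admissible G δ → HasRadius G r → r ≤ n / δ
  at-most-quotient 4δ≤n G r admissible radius with 4 ≤? r
  ... | yes 4≤r = quotient-maximal (proj₁ (large-radius G 2≤δ admissible radius 4≤r))
  ... | no ¬4≤r = ≤-trans (<⇒≤ (≰⇒> ¬4≤r)) (quotient-maximal {4} 4δ≤n)

  general : 4 * δ ≤ n → ¬ (Odd δ × (∃[ k ] (Odd k × n ≡ k * δ))) → MaxRadius n δ (n / δ)
  general 4δ≤n unexceptional = cycle-realised 2≤δ (≤-trans (s≤s (s≤s z≤n)) (quotient-maximal {4} 4δ≤n)) (m/n*n≤m n δ)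
      -- Equality with both numbers odd is precisely the exceptional case.
      (λ r-odd δ-odd → ≤∧≢⇒< (m/n*n≤m n δ) λ eq → unexceptional (δ-odd , n / δ , r-odd , sym eq)) ,
    at-most-quotient 4δ≤n

  -- Radius n / δ would give rδ = n with r and δ odd, which the strict bound forbids. One less is
  -- even, so the cycle needs no spare vertex and fits.
  exceptional : 4 * δ ≤ n → (Odd δ × (∃[ k ] (Odd k × n ≡ k * δ))) → MaxRadius n δ (n / δ ∸ 1)
  exceptional 4δ≤n (δ-odd , _ , (m , refl) , n≡) = subst (MaxRadius n δ) (sym (cong (_∸ 1) n/δ≡))
      (cycle-realised 2≤δ (≤-trans (s≤s (s≤s z≤n)) 3≤2m) (≤-trans (*-monoˡ-≤ δ (n≤1+n (2 * m))) (≤-reflexive (sym n≡)))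
        (λ (j , eq) _ → ⊥-elim (even≢odd m j eq)) ,
       λ G r admissible radius → smaller G r admissible radius (subst (r ≤_) n/δ≡ (at-most-quotient 4δ≤n G r admissible radius)))
    where
    n/δ≡ : n / δ ≡ suc (2 * m)
    n/δ≡ = trans (cong (_/ δ) n≡) (m*n/n≡m (suc (2 * m)) δ)
    3≤2m : 3 ≤ 2 * m
    3≤2m = s≤s⁻¹ (subst (4 ≤_) n/δ≡ (quotient-maximal {4} 4δ≤n))
    smaller : (G : Graph n) → ∀ r → Admissible G δ → HasRadius G r → r ≤ suc (2 * m) → r ≤ 2 * m
    smaller G r admissible radius r≤k with m≤n⇒m<n∨m≡n r≤k
    ... | inj₁ r<k  = s≤s⁻¹ r<k
    ... | inj₂ refl = ⊥-elim (<-irrefl (sym n≡)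
          (proj₂ (large-radius G 2≤δ admissible radius (s≤s 3≤2m)) (m , refl) δ-odd))
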